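{- The following sequences (indexed by $n \ge 0$) are lacunary modulo $2$: (1) $\overline{C}_{4,1}(n)$; (2) $\overline{C}_{12,3}(n)$; (3) $\overline{C}_{20,5}(2n)$; (4) $\overline{C}_{28,7}(2n+1)$ and $\overline{C}_{28,7}(4n)$; (5) $\overline{C}_{36,9}(2n+1)$; (6) $\overline{C}_{44,11}(2n)$ and $\overline{C}_{44,11}(4n+1)$; (7) $\overline{C}_{52,13}(2n)$; (8) $\overline{C}_{60,15}(2n+1)$ and $\overline{C}_{60,15}(4n+2)$; (9) $\overline{C}_{68,17}(2n+1)$; (10) $\overline{C}_{84,21}(2n)$; (11) $\overline{C}_{92,23}(2n+1)$.
   Context: For positive integers $k > i$, $\overline{C}_{k,i}(n)$ denotes the number of $(k,i)$-singular overpartitions of $n$ (in the sense of Andrews); equivalently, for $n\ge 1$ it is the number of overpartitions of $n$ (non-increasing sequences of positive integers summing to $n$ in which the first occurrence of each part size may be overlined) in which no part is divisible by $k$ and only parts congruent to $\pm i \pmod k$ may be overlined, and $\overline{C}_{k,i}(0)=1$. Its generating function is \[ \sum_{n=0}^\infty \overline{C}_{k,i}(n) q^n = \prod_{m = 1}^\infty \frac{(1 - q^{km})(1 + q^{k(m - 1) + i})(1 + q^{km - i})}{1 - q^m}. \] A sequence $(a_n)_{n\ge 0}$ of integers is called lacunary modulo $m$ if \[ \lim_{x\to\infty} \frac{\#\{ n \le x : a_n \equiv 0 \pmod m\}}{x} = 1. \] -}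

module Defs where

open import Data.Nat using (ℕ; zero; suc; _+_; _*_; _∸_; _≤_; _%_)
open import Data.Nat.Divisibility using (_∣?_)
import Data.Nat as ℕ
open import Data.Integer as ℤ using (ℤ; +_; ∣_∣)
open import Data.List using (List; upTo; map; filter; length)
open import Data.Rational as ℚ using (ℚ; 0ℚ; 1ℚ)
open import Data.Product using (∃)
open import Relation.Nullary.Decidable using (⌊_⌋)
open import Data.Bool using (if_then_else_)

Series : Set
Series = ℕ → ℤ

sumℤ : List ℤ → ℤ
sumℤ = Data.List.foldr ℤ._+_ (+ 0)

_⊛_ : Series → Series → Series
(f ⊛ g) n = sumℤ (map (λ j → f j ℤ.* g (n ∸ j)) (upTo (suc n)))

δ : ℕ → Series
δ a j = if ⌊ j ℕ.≟ a ⌋ then + 1 else + 0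

one : Series
one = δ 0

onePlus : ℕ → Series
onePlus a j = δ 0 j ℤ.+ δ a j

oneMinus : ℕ → Series
oneMinus a j = δ 0 j ℤ.- δ a j

-- 1 / (1 - q^m) = Σ_{t ≥ 0} q^{m t}, for m ≥ 1 (written m = suc m').
geom : ℕ → Series
geom m' j = if ⌊ j % suc m' ℕ.≟ 0 ⌋ then + 1 else + 0

-- m-th factor (m = suc m') of the generating function:
-- (1 - q^{km})(1 + q^{k(m-1)+i})(1 + q^{km-i}) / (1 - q^m).
factor : ℕ → ℕ → ℕ → Series
factor k i m' =
  oneMinus (k * suc m') ⊛ (onePlus (k * m' + i) ⊛ (onePlus (k * suc m' ∸ i) ⊛ geom m'))

partialProd : ℕ → ℕ → ℕ → Series
partialProd k i zero = one
partialProd k i (suc N) = partialProd k i N ⊛ factor k i N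

-- C̄_{k,i}(n): the coefficient of q^n in the infinite product.  Factors with
-- m > n are ≡ 1 mod q^{n+1} (when k > i ≥ 1), so the partial product up to
-- m = n has the correct coefficient of q^n.
Cbar : ℕ → ℕ → ℕ → ℤ
Cbar k i n = partialProd k i n n

countEven : (ℕ → ℤ) → ℕ → ℕ
countEven a x = length (filter (λ n → 2 ∣? ∣ a n ∣) (upTo (suc x)))

-- Lacunary modulo 2: #{n ≤ x : a n ≡ 0 mod 2} / x → 1 as x → ∞.
-- (Written out with rational ε; x ranges over positive integers x = suc y.)
LacunaryMod2 : (ℕ → ℤ) → Set
LacunaryMod2 a =
  ∀ (ε : ℚ) → 0ℚ ℚ.< ε →
    ∃ λ N → ∀ y → N ≤ y →
      ℚ.∣ ((+ countEven a (suc y)) ℚ./ suc y) ℚ.- 1ℚ ∣ ℚ.< ε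

{-# OPTIONS --safe #-}
-- Let P, ψ, Ω be the series Σ q^{(3z²+z)/2}, Σ q^{2z²+z}, Σ q^{3z²+2z} (z ∈ ℤ) over 𝔽₂, and write f_k for f(q^k).
-- The pentagonal number theorem turns the generating function G of C̄_{4i,i} into ψ_i / P mod 2, and since
-- P⁴ = P_4 and P P_2 = ψ, one gets G P_4 = ψ ψ_i.  The right hand side counts the values of x² + i y² with
-- x, y ≡ 1 (mod 4); affine changes of variables, splittings into residue classes and reflections (whose orbits
-- cancel in pairs) rewrite the required subprogressions of ψ ψ_i as multiples of dilates of P.  After division
-- each sequence is a sum of products of at most two theta series, so that its odd terms occur only at those n
-- for which one of finitely many A n + B is of the form x² + N y².
--
-- The values of x² + N y² have density 0: modulo a prime p the proportion of pairs (x , y) with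
-- p ∣ x² + N y² is about 2/p or at most 1/p², never 1/p as for integers.  Weighting the residues mod p
-- accordingly, Cauchy-Schwarz bounds the density by ∏ (1 - c/p)^{1/2}, which tends to 0 because Σ 1/n diverges.
module Submission where

open import Defs

-- The usual proof that x² + N y² seldom hits a progression works with the primes modulo which -N is
-- a non-residue, and then needs Dirichlet's theorem to know that their reciprocals diverge. Here a
-- large prime of either type saves a factor 1 - 1/(12p), so its type never has to be known. What
-- remains is the divergence of the sum of 1/p, which comes from striking primes out of the harmonic
-- sum. The price is a pair of weights tilted one way for split primes and the other way for inert
-- ones.
--
-- On the side of the series, 1/`P 1` has no convenient sections. Multiplying G by `P 4`, a series
-- in q⁴, cures this: extracting residue classes mod 2 or mod 4 passes through such a factor, and
-- only sections of ψ ψ_i have to be found. Dividing by the surviving `P 2` or `P 1` then stays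
-- within theta products because P_k² = P_2k, P_k P_2k = ψ_k and P_k Ω_k = ψ_3k.

module Density where

  open import Data.Nat
  open import Data.Nat.Properties
  open import Data.Nat.Divisibility
  open import Data.Nat.DivMod using (m%n<n; m≡m%n+[m/n]*n; m/n/o≡m/[n*o]; m/n*n≤m; /-monoʳ-≤; /-congˡ; /-congʳ; m*n/n≡m; n/1≡n)
  open import Data.Nat.Coprimality as Coprimality using (Coprime; coprime-Bézout; prime⇒coprime)
  open import Data.Nat.GCD using (module Bézout)
  open import Data.Nat.ListAction using (product)
  open import Data.Nat.Primality using (Prime; euclidsLemma; prime?; prime⇒irreducible; prime⇒nonTrivial)
  open import Data.Nat.Primality.Factorisation using (factorise)
  open import Data.Nat.Tactic.RingSolver using (solve-∀)
  open import Data.Bool using (Bool; true; false; if_then_else_; _xor_)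
  open import Data.List.Base using ([]; _∷_)
  open import Data.List.Relation.Unary.All using (_∷_)
  open import Data.Product
  open import Data.Sum using (inj₁; inj₂; [_,_])
  open import Data.Empty using (⊥-elim)
  open import Relation.Nullary
  open import Relation.Nullary.Decidable using (⌊_⌋; _×-dec_)
  open import Relation.Binary.PropositionalEquality hiding ([_])

  -- Sums of periodic functions

  ∑ : ℕ → (ℕ → ℕ) → ℕ
  ∑ zero f = 0
  ∑ (suc n) f = ∑ n f + f n

  ∑-cong : ∀ n {f g : ℕ → ℕ} → (∀ i → f i ≡ g i) → ∑ n f ≡ ∑ n g
  ∑-cong zero e = refl
  ∑-cong (suc n) e = cong₂ _+_ (∑-cong n e) (e n)

  ∑-mono : ∀ n {f g : ℕ → ℕ} → (∀ i → i < n → f i ≤ g i) → ∑ n f ≤ ∑ n g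
  ∑-mono zero e = z≤n
  ∑-mono (suc n) e = +-mono-≤ (∑-mono n λ i i<n → e i (m<n⇒m<1+n i<n)) (e n ≤-refl)

  private
    +-interchange : ∀ a b c d → (a + b) + (c + d) ≡ (a + c) + (b + d)
    +-interchange = solve-∀

  ∑-+ : ∀ n (f g : ℕ → ℕ) → ∑ n (λ i → f i + g i) ≡ ∑ n f + ∑ n g
  ∑-+ zero f g = refl
  ∑-+ (suc n) f g = trans (cong (_+ (f n + g n)) (∑-+ n f g)) (+-interchange (∑ n f) (∑ n g) (f n) (g n))

  ∑-*ˡ : ∀ n c (f : ℕ → ℕ) → ∑ n (λ i → c * f i) ≡ c * ∑ n f
  ∑-*ˡ zero c f = sym (*-zeroʳ c)
  ∑-*ˡ (suc n) c f = trans (cong (_+ c * f n) (∑-*ˡ n c f)) (sym (*-distribˡ-+ c (∑ n f) (f n)))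

  ∑-*ʳ : ∀ n c (f : ℕ → ℕ) → ∑ n (λ i → f i * c) ≡ ∑ n f * c
  ∑-*ʳ n c f = trans (∑-cong n λ i → *-comm (f i) c) (trans (∑-*ˡ n c f) (*-comm c (∑ n f)))

  ∑-const : ∀ n c → ∑ n (λ _ → c) ≡ n * c
  ∑-const zero c = refl
  ∑-const (suc n) c = trans (cong (_+ c) (∑-const n c)) (+-comm (n * c) c)

  ∑-swap : ∀ m n (f : ℕ → ℕ → ℕ) → ∑ m (λ i → ∑ n (f i)) ≡ ∑ n (λ j → ∑ m (λ i → f i j))
  ∑-swap zero n f = sym (trans (∑-const n 0) (*-zeroʳ n))
  ∑-swap (suc m) n f = trans (cong (_+ ∑ n (f m)) (∑-swap m n f)) (sym (∑-+ n (λ j → ∑ m (λ i → f i j)) (f m)))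

  ∑-split : ∀ m n (f : ℕ → ℕ) → ∑ (m + n) f ≡ ∑ m f + ∑ n (λ i → f (m + i))
  ∑-split m zero f = trans (cong (λ k → ∑ k f) (+-identityʳ m)) (sym (+-identityʳ _))
  ∑-split m (suc n) f = trans (cong (λ k → ∑ k f) (+-suc m n))
    (trans (cong (_+ f (m + n)) (∑-split m n f)) (+-assoc (∑ m f) _ _))

  ∑-blocks : ∀ a m (f : ℕ → ℕ) → ∑ (a * m) f ≡ ∑ a (λ i → ∑ m (λ j → f (i * m + j)))
  ∑-blocks zero m f = refl
  ∑-blocks (suc a) m f = trans (cong (λ k → ∑ k f) (+-comm m (a * m)))
    (trans (∑-split (a * m) m f) (cong (_+ ∑ m (λ j → f (a * m + j))) (∑-blocks a m f)))

  ∑-mono-range : ∀ {m n} (f : ℕ → ℕ) → m ≤ n → ∑ m f ≤ ∑ n f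
  ∑-mono-range {m} f m≤n with m≤n⇒∃[o]m+o≡n m≤n
  ... | k , refl = ≤-trans (m≤m+n _ _) (≤-reflexive (sym (∑-split m k f)))

  Periodic : ℕ → (ℕ → ℕ) → Set
  Periodic p g = ∀ n → g (n + p) ≡ g n

  periodic-* : ∀ {p g} → Periodic p g → ∀ k n → g (n + k * p) ≡ g n
  periodic-* {p} {g} per zero n = cong g (+-identityʳ n)
  periodic-* {p} {g} per (suc k) n =
    trans (cong g (trans (cong (n +_) (+-comm p (k * p))) (sym (+-assoc n (k * p) p)))) (trans (per (n + k * p)) (periodic-* per k n))

  -- Moving the window by one step drops `g c` and gains `g (c + p)`, which are equal.
  ∑-shift : ∀ {p g} → Periodic p g → ∀ c → ∑ p (λ j → g (c + j)) ≡ ∑ p g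
  ∑-shift {p} {g} per zero = refl
  ∑-shift {p} {g} per (suc c) = trans (+-cancelˡ-≡ (g c) _ _ step) (∑-shift per c)
    where
    first : ∀ n (h : ℕ → ℕ) → h 0 + ∑ n (λ j → h (suc j)) ≡ ∑ n h + h n
    first zero h = +-identityʳ (h 0)
    first (suc n) h = trans (sym (+-assoc (h 0) _ _)) (cong (_+ h (suc n)) (first n h))
    step : g c + ∑ p (λ j → g (suc c + j)) ≡ g c + ∑ p (λ j → g (c + j))
    step = begin
      g c + ∑ p (λ j → g (suc c + j))            ≡⟨ cong₂ _+_ (cong g (sym (+-identityʳ c))) (∑-cong p λ j → cong g (sym (+-suc c j))) ⟩
      g (c + 0) + ∑ p (λ j → g (c + suc j))      ≡⟨ first p (λ j → g (c + j)) ⟩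
      ∑ p (λ j → g (c + j)) + g (c + p)          ≡⟨ cong (∑ p (λ j → g (c + j)) +_) (per c) ⟩
      ∑ p (λ j → g (c + j)) + g c                ≡⟨ +-comm _ (g c) ⟩
      g c + ∑ p (λ j → g (c + j))                ∎
      where open ≡-Reasoning

  ∑-blocks-periodic : ∀ {m g} → Periodic m g → ∀ t → ∑ (t * m) g ≡ t * ∑ m g
  ∑-blocks-periodic {m} {g} per t = trans (∑-blocks t m g)
    (trans (∑-cong t λ i → ∑-shift per (i * m)) (∑-const t (∑ m g)))

  -- The sum over a progression has the coprime periods p and m, hence is constant, and its mean is known.
  ∑-progression : ∀ {p m g} .{{_ : NonZero p}} → Coprime p m → Periodic p g →
                  ∀ j → ∑ p (λ i → g (j + i * m)) ≡ ∑ p g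
  ∑-progression {p} {m} {g} cop per j = trans (const j) (*-cancelˡ-≡ (H 0) (∑ p g) p mean)
    where
    H : ℕ → ℕ
    H j = ∑ p (λ i → g (j + i * m))
    per-m : ∀ j → H (j + m) ≡ H j
    per-m j = trans (∑-cong p λ i → cong g (+-assoc j m (i * m)))
      (∑-shift {p} {λ i → g (j + i * m)} (λ i → trans (cong g (eq j i m p)) (periodic-* per m (j + i * m))) 1)
      where
      eq : ∀ j i m p → j + (i + p) * m ≡ j + i * m + m * p
      eq = solve-∀
    per-p : ∀ j → H (j + p) ≡ H j
    per-p j = ∑-cong p λ i → trans (cong g (eq j p (i * m))) (per (j + i * m))
      where
      eq : ∀ j p k → j + p + k ≡ j + k + p
      eq = solve-∀
    step : ∀ j → H (suc j) ≡ H j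
    step j with coprime-Bézout cop
    ... | Bézout.+- x y e = begin
      H (suc j)            ≡⟨ sym (periodic-* {m} {H} per-m y (suc j)) ⟩
      H (suc j + y * m)    ≡⟨ cong H (trans (sym (+-suc j (y * m))) (cong (j +_) e)) ⟩
      H (j + x * p)        ≡⟨ periodic-* {p} {H} per-p x j ⟩
      H j                  ∎ where open ≡-Reasoning
    ... | Bézout.-+ x y e = begin
      H (suc j)            ≡⟨ sym (periodic-* {p} {H} per-p x (suc j)) ⟩
      H (suc j + x * p)    ≡⟨ cong H (trans (sym (+-suc j (x * p))) (cong (j +_) e)) ⟩
      H (j + y * m)        ≡⟨ periodic-* {m} {H} per-m y j ⟩
      H j                  ∎ where open ≡-Reasoning
    const : ∀ j → H j ≡ H 0
    const zero = refl
    const (suc j) = trans (step j) (const j)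
    mean : p * H 0 ≡ p * ∑ p g
    mean = begin
      p * H 0                                     ≡⟨ sym (∑-const p (H 0)) ⟩
      ∑ p (λ _ → H 0)                             ≡⟨ ∑-cong p (λ j → sym (const j)) ⟩
      ∑ p (λ j → ∑ p (λ i → g (j + i * m)))       ≡⟨ ∑-swap p p _ ⟩
      ∑ p (λ i → ∑ p (λ j → g (j + i * m)))       ≡⟨ ∑-cong p (λ i → ∑-cong p λ j → cong g (+-comm j (i * m))) ⟩
      ∑ p (λ i → ∑ p (λ j → g (i * m + j)))       ≡⟨ ∑-cong p (λ i → ∑-shift per (i * m)) ⟩
      ∑ p (λ i → ∑ p g)                           ≡⟨ ∑-const p (∑ p g) ⟩
      p * ∑ p g                                   ∎ where open ≡-Reasoning

  -- The Chinese remainder theorem for means: along j + i m the factor `h` is constant while `g`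
  -- runs through a full period.
  ∑-coprime : ∀ {p m g h} .{{_ : NonZero p}} → Coprime p m → Periodic p g → Periodic m h →
              ∑ (p * m) (λ n → g n * h n) ≡ ∑ p g * ∑ m h
  ∑-coprime {p} {m} {g} {h} cop pg ph = begin
    ∑ (p * m) (λ n → g n * h n)                                      ≡⟨ ∑-blocks p m _ ⟩
    ∑ p (λ i → ∑ m (λ j → g (i * m + j) * h (i * m + j)))            ≡⟨ ∑-swap p m _ ⟩
    ∑ m (λ j → ∑ p (λ i → g (i * m + j) * h (i * m + j)))            ≡⟨ ∑-cong m (λ j → ∑-cong p λ i → cong₂ _*_ (cong g (+-comm (i * m) j)) (trans (cong h (+-comm (i * m) j)) (periodic-* ph i j))) ⟩
    ∑ m (λ j → ∑ p (λ i → g (j + i * m) * h j))                      ≡⟨ ∑-cong m (λ j → ∑-*ʳ p (h j) _) ⟩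
    ∑ m (λ j → ∑ p (λ i → g (j + i * m)) * h j)                      ≡⟨ ∑-cong m (λ j → cong (_* h j) (∑-progression cop pg j)) ⟩
    ∑ m (λ j → ∑ p g * h j)                                          ≡⟨ ∑-*ˡ m (∑ p g) h ⟩
    ∑ p g * ∑ m h                                                    ∎ where open ≡-Reasoning

  -- Weights on residue classes and their means

  ∑∑ : ℕ → (ℕ → ℕ → ℕ) → ℕ
  ∑∑ n f = ∑ n λ x → ∑ n (f x)

  ∑∑-coprime : ∀ {p m} {g h : ℕ → ℕ → ℕ} .{{_ : NonZero p}} → Coprime p m →
    (∀ x → Periodic p (g x)) → (∀ y → Periodic p (λ x → g x y)) →
    (∀ x → Periodic m (h x)) → (∀ y → Periodic m (λ x → h x y)) →
    ∑∑ (p * m) (λ x y → g x y * h x y) ≡ ∑∑ p g * ∑∑ m h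
  ∑∑-coprime {p} {m} {g} {h} cop g₁ g₂ h₁ h₂ =
    trans (∑-cong (p * m) λ x → ∑-coprime cop (g₁ x) (h₁ x))
          (∑-coprime cop (λ x → ∑-cong p λ y → g₂ y x) (λ x → ∑-cong m λ y → h₂ y x))

  norm : ℕ → ℕ → ℕ → ℕ
  norm N x y = x * x + N * (y * y)

  -- The mean of w over the integers times the mean of v over the values of x² + N y² is at most κ r / s,
  -- whereas w v = κ.
  record Weights (N m r s : ℕ) : Set where
    field
      κ : ℕ
      κ>0 : 0 < κ
      w v : ℕ → ℕ
      wv : ∀ n → w n * v n ≡ κ
      w-periodic : Periodic m w
      v-periodic : Periodic m v
      bound : s * (∑ m w * ∑∑ m (λ x y → v (norm N x y))) ≤ κ * (m * m * m * r)

  module _ {N m : ℕ} {v : ℕ → ℕ} (per : Periodic m v) where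
    norm-periodicʳ : ∀ x → Periodic m (λ y → v (norm N x y))
    norm-periodicʳ x y = trans (cong v (eq N x y m)) (periodic-* per (N * (2 * y + m)) (norm N x y))
      where
      eq : ∀ N x y m → x * x + N * ((y + m) * (y + m)) ≡ x * x + N * (y * y) + N * (2 * y + m) * m
      eq = solve-∀
    norm-periodicˡ : ∀ y → Periodic m (λ x → v (norm N x y))
    norm-periodicˡ y x = trans (cong v (eq N x y m)) (periodic-* per (2 * x + m) (norm N x y))
      where
      eq : ∀ N x y m → (x + m) * (x + m) + N * (y * y) ≡ x * x + N * (y * y) + (2 * x + m) * m
      eq = solve-∀

  trivialWeights : ∀ N → Weights N 1 1 1
  trivialWeights N = record
    { κ = 1 ; κ>0 = ≤-refl ; w = λ _ → 1 ; v = λ _ → 1 ; wv = λ _ → refl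
    ; w-periodic = λ _ → refl ; v-periodic = λ _ → refl ; bound = ≤-refl }

  -- Both means factor over coprime moduli, so the savings r / s of different primes multiply.
  combine : ∀ {N p m r s r' s'} .{{_ : NonZero p}} → Coprime p m →
            Weights N p r s → Weights N m r' s' → Weights N (p * m) (r * r') (s * s')
  combine {N} {p} {m} {r} {s} {r'} {s'} cop U V = record
    { κ = U.κ * V.κ
    ; κ>0 = *-mono-≤ U.κ>0 V.κ>0
    ; w = λ n → U.w n * V.w n
    ; v = λ n → U.v n * V.v n
    ; wv = λ n → trans (*-interchange (U.w n) (V.w n) (U.v n) (V.v n)) (cong₂ _*_ (U.wv n) (V.wv n))
    ; w-periodic = per U.w-periodic V.w-periodic
    ; v-periodic = per U.v-periodic V.v-periodic
    ; bound = begin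
        s * s' * (∑ (p * m) (λ n → U.w n * V.w n) * ∑∑ (p * m) (λ x y → U.v (norm N x y) * V.v (norm N x y)))
          ≡⟨ cong (s * s' *_) (cong₂ _*_ (∑-coprime cop U.w-periodic V.w-periodic)
               (∑∑-coprime cop (norm-periodicʳ {N} {v = U.v} U.v-periodic) (norm-periodicˡ {N} {v = U.v} U.v-periodic)
                  (norm-periodicʳ {N} {v = V.v} V.v-periodic) (norm-periodicˡ {N} {v = V.v} V.v-periodic))) ⟩
        s * s' * ((∑ p U.w * ∑ m V.w) * (∑∑ p (λ x y → U.v (norm N x y)) * ∑∑ m (λ x y → V.v (norm N x y))))
          ≡⟨ eq₁ s s' (∑ p U.w) (∑ m V.w) _ _ ⟩
        s * (∑ p U.w * ∑∑ p (λ x y → U.v (norm N x y))) * (s' * (∑ m V.w * ∑∑ m (λ x y → V.v (norm N x y))))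
          ≤⟨ *-mono-≤ U.bound V.bound ⟩
        U.κ * (p * p * p * r) * (V.κ * (m * m * m * r'))
          ≡⟨ eq₂ U.κ V.κ p m r r' ⟩
        U.κ * V.κ * (p * m * (p * m) * (p * m) * (r * r')) ∎
    }
    where
    module U = Weights U
    module V = Weights V
    open ≤-Reasoning
    *-interchange : ∀ a b c d → (a * b) * (c * d) ≡ (a * c) * (b * d)
    *-interchange = solve-∀
    per : ∀ {f g} → Periodic p f → Periodic m g → Periodic (p * m) (λ n → f n * g n)
    per {f} {g} pf pg n = cong₂ _*_ (trans (cong (λ k → f (n + k)) (*-comm p m)) (periodic-* pf m n)) (periodic-* pg p n)
    eq₁ : ∀ s s' a b c d → s * s' * ((a * b) * (c * d)) ≡ s * (a * c) * (s' * (b * d))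
    eq₁ = solve-∀
    eq₂ : ∀ k l p m r r' → k * (p * p * p * r) * (l * (m * m * m * r')) ≡ k * l * (p * m * (p * m) * (p * m) * (r * r'))
    eq₂ = solve-∀

  -- Weights modulo a prime

  select : ℕ → ℕ → ℕ → ℕ → ℕ
  select p a b n = if ⌊ p ∣? n ⌋ then a else b

  select-∣ : ∀ {p} a b {n} → p ∣ n → select p a b n ≡ a
  select-∣ {p} a b {n} d with p ∣? n
  ... | yes _ = refl
  ... | no ¬d = ⊥-elim (¬d d)

  select-∤ : ∀ {p} a b {n} → ¬ p ∣ n → select p a b n ≡ b
  select-∤ {p} a b {n} ¬d with p ∣? n
  ... | yes d = ⊥-elim (¬d d)
  ... | no _ = refl

  select-periodic : ∀ p a b → Periodic p (select p a b)
  select-periodic p a b n with p ∣? n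
  ... | yes d = select-∣ a b (∣m∣n⇒∣m+n d ∣-refl)
  ... | no ¬d = select-∤ a b λ d → ¬d (∣m+n∣m⇒∣n (subst (p ∣_) (+-comm n p) d) ∣-refl)

  select-* : ∀ p a b c d {k} → a * c ≡ k → b * d ≡ k → ∀ n → select p a b n * select p c d n ≡ k
  select-* p a b c d e e' n with p ∣? n
  ... | yes _ = e
  ... | no _ = e'

  <⇒∤ : ∀ {p n} → 0 < n → n < p → ¬ p ∣ n
  <⇒∤ {p} {suc n} _ n<p d = <⇒≱ n<p (∣⇒≤ d)

  ∑-select : ∀ p' a b → ∑ (suc p') (select (suc p') a b) ≡ a + p' * b
  ∑-select p' a b = go p' ≤-refl
    where
    go : ∀ k → k ≤ p' → ∑ (suc k) (select (suc p') a b) ≡ a + k * b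
    go zero _ = trans (select-∣ a b {0} (suc p' ∣0)) (sym (+-identityʳ a))
    go (suc k) k<p' = trans (cong₂ _+_ (go k (<⇒≤ k<p')) (select-∤ a b {suc k} (<⇒∤ z<s (s≤s k<p'))))
      (trans (+-assoc a (k * b) b) (cong (a +_) (+-comm (k * b) b)))

  ∑-except₁ : ∀ n c (f : ℕ → ℕ) → (∀ i → f i ≤ suc c) → ∀ x → x < n → f x ≤ c → ∑ n f + 1 ≤ n * suc c
  ∑-except₁ (suc n) c f ub x x<n fx with x ≟ n
  ... | yes refl = ≤-trans (≤-reflexive (eq (∑ n f) (f n))) (+-mono-≤ (s≤s fx) (≤-trans (∑-mono n λ i _ → ub i) (≤-reflexive (∑-const n (suc c)))))
    where
    eq : ∀ a b → a + b + 1 ≡ suc b + a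
    eq = solve-∀
  ... | no x≢n = ≤-trans (≤-reflexive (eq (∑ n f) (f n))) (+-mono-≤ (ub n) (∑-except₁ n c f ub x (≤∧≢⇒< (≤-pred x<n) x≢n) fx))
    where
    eq : ∀ a b → a + b + 1 ≡ b + (a + 1)
    eq = solve-∀

  -- Meant for a row x ↦ v (x² + N y²) with y fixed, where the two exceptional places are the roots
  -- x and -x.
  ∑-except₂ : ∀ n c (f : ℕ → ℕ) → (∀ i → f i ≤ suc c) → ∀ x y → x ≢ y → x < n → y < n → f x ≤ c → f y ≤ c → ∑ n f + 2 ≤ n * suc c
  ∑-except₂ (suc n) c f ub x y x≢y x<n y<n fx fy with x ≟ n | y ≟ n
  ... | yes refl | yes refl = ⊥-elim (x≢y refl)
  ... | yes refl | no y≢n = ≤-trans (≤-reflexive (eq (∑ n f) (f n))) (+-mono-≤ (s≤s fx) (∑-except₁ n c f ub y (≤∧≢⇒< (≤-pred y<n) y≢n) fy))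
    where
    eq : ∀ a b → a + b + 2 ≡ suc b + (a + 1)
    eq = solve-∀
  ... | no x≢n | yes refl = ≤-trans (≤-reflexive (eq (∑ n f) (f n))) (+-mono-≤ (s≤s fy) (∑-except₁ n c f ub x (≤∧≢⇒< (≤-pred x<n) x≢n) fx))
    where
    eq : ∀ a b → a + b + 2 ≡ suc b + (a + 1)
    eq = solve-∀
  ... | no x≢n | no y≢n = ≤-trans (≤-reflexive (eq (∑ n f) (f n))) (+-mono-≤ (ub n) (∑-except₂ n c f ub x y x≢y (≤∧≢⇒< (≤-pred x<n) x≢n) (≤∧≢⇒< (≤-pred y<n) y≢n) fx fy))
    where
    eq : ∀ a b → a + b + 2 ≡ b + (a + 2)
    eq = solve-∀

  -- The size conditions stand in for arithmetic ones: 0 < N < p makes N a unit mod p, and p ≥ 5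
  -- excludes 2, where x and -x coincide, and 3, where the bound behind `split-weights` is false.
  module LocalPrime (N p' : ℕ) (pr : Prime (suc p')) (N>0 : 0 < N) (N<p : N < suc p') (p≥5 : 5 ≤ suc p') where
    private
      p : ℕ
      p = suc p'

    RootAt : ℕ → ℕ → Set
    RootAt y x = p ∣ norm N x y

    reduce : ∀ a y → RootAt y a → RootAt y (a % p)
    reduce a y d = ∣m+n∣m⇒∣n (subst (p ∣_) eq' d) (divides ((a / p) * (2 * (a % p) + a / p * p)) refl)
      where
      eq : ∀ r k q N y → (r + k * q) * (r + k * q) + N * (y * y) ≡ k * (2 * r + k * q) * q + (r * r + N * (y * y))
      eq = solve-∀
      eq' : norm N a y ≡ (a / p) * (2 * (a % p) + a / p * p) * p + norm N (a % p) y
      eq' = trans (cong (λ z → norm N z y) (m≡m%n+[m/n]*n a p)) (eq (a % p) (a / p) p N y)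

    -- The form is homogeneous and y₀ is invertible mod p, so (x₀ , y₀) can be multiplied by y / y₀.
    -- One root off the axis y = 0 thus puts a root in every row.
    scale : ∀ x₀ y₀ → 0 < y₀ → y₀ < p → RootAt y₀ x₀ → ∀ y → ∃ λ x → RootAt y x
    scale x₀ y₀ y₀>0 y₀<p d y = go (coprime-Bézout (Coprimality.sym (prime⇒coprime pr {{>-nonZero y₀>0}} y₀<p)))
      where
      eq : ∀ a y x₀ y₀ N → (a * y) * (a * y) * (x₀ * x₀ + N * (y₀ * y₀)) ≡ (a * y * x₀) * (a * y * x₀) + N * (y * y) * ((a * y₀) * (a * y₀))
      eq = solve-∀
      eq₁ : ∀ b q X N y → X + N * (y * y) * ((1 + b * q) * (1 + b * q)) ≡ N * (y * y) * (b * (2 + b * q)) * q + (X + N * (y * y))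
      eq₁ = solve-∀
      eq₂ : ∀ c X M → X + M * (c * c) + M * (2 * c + 1) ≡ X + M * ((1 + c) * (1 + c))
      eq₂ = solve-∀
      go : Bézout.Identity 1 y₀ p → ∃ λ x → RootAt y x
      go (Bézout.+- a b e) = a * y * x₀ ,
        ∣m+n∣m⇒∣n (subst (p ∣_) (trans (eq a y x₀ y₀ N) (trans (cong (λ z → a * y * x₀ * (a * y * x₀) + N * (y * y) * (z * z)) (sym e)) (eq₁ b p (a * y * x₀ * (a * y * x₀)) N y))) (∣n⇒∣m*n (a * y * (a * y)) d))
          (divides (N * (y * y) * (b * (2 + b * p))) refl)
      -- Here a is the inverse of -y₀, which serves equally well because only (a y₀)² enters. The
      -- multiple of 1 + a y₀ added in `key` avoids subtraction in ℕ.
      go (Bézout.-+ a b e) = a * y * x₀ ,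
        ∣m+n∣m⇒∣n (subst (p ∣_) key (∣m∣n⇒∣m+n (∣n⇒∣m*n (a * y * (a * y)) d) (∣n⇒∣m*n M (divides (2 * b) (trans (cong (2 *_) e) (sym (*-assoc 2 b p)))))))
          (∣n⇒∣m*n M (divides (b * (b * p)) (eqb b p)))
        where
        M = N * (y * y)
        X = a * y * x₀ * (a * y * x₀)
        eqb : ∀ b p → b * p * (b * p) ≡ b * (b * p) * p
        eqb = solve-∀
        eq₃ : ∀ c X M → X + M * (c * c) + M * (2 * (1 + c)) ≡ M * ((1 + c) * (1 + c)) + (X + M)
        eq₃ = solve-∀
        key : a * y * (a * y) * (x₀ * x₀ + N * (y₀ * y₀)) + M * (2 * (1 + a * y₀)) ≡ M * (b * p * (b * p)) + (X + M)
        key = trans (cong (_+ M * (2 * (1 + a * y₀))) (eq a y x₀ y₀ N)) (trans (eq₃ (a * y₀) X M) (cong (λ z → M * (z * z) + (X + M)) e))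

    p∤N : ¬ p ∣ N
    p∤N = <⇒∤ N>0 N<p

    p∣sq : ∀ {x} → p ∣ x * x → p ∣ x
    p∣sq {x} d with euclidsLemma x x pr d
    ... | inj₁ e = e
    ... | inj₂ e = e

    -- A root x is nonzero since p divides neither N nor y, and p - x is a second root, distinct
    -- from x because p is odd.
    split-row : ∀ y → 0 < y → y < p → ∃ (RootAt y) → ∑ p (λ x → select p 2 3 (norm N x y)) + 2 ≤ p * 3
    split-row y y>0 y<p (a , d) =
      ∑-except₂ p 2 _ (λ i → le (norm N i y)) x (p ∸ x) x≢ x<p (∸-monoʳ-< x>0 (<⇒≤ x<p))
        (≤-reflexive (select-∣ 2 3 dx)) (≤-reflexive (select-∣ 2 3 dx'))
      where
      le : ∀ n → select p 2 3 n ≤ 3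
      le n with p ∣? n
      ... | yes _ = s≤s (s≤s z≤n)
      ... | no _ = ≤-refl
      x = a % p
      x<p : x < p
      x<p = m%n<n a p
      dx : RootAt y x
      dx = reduce a y d
      x>0 : 0 < x
      x>0 = n≢0⇒n>0 λ x≡0 → [ p∤N , (λ e → <⇒∤ y>0 y<p (p∣sq e)) ] (euclidsLemma N (y * y) pr (subst (λ z → p ∣ norm N z y) x≡0 dx))
      eq : ∀ x z N y → z * z + N * (y * y) + (x * (x + z)) ≡ x * x + N * (y * y) + (z * (x + z))
      eq = solve-∀
      x+z : x + (p ∸ x) ≡ p
      x+z = m+[n∸m]≡n (<⇒≤ x<p)
      dx' : RootAt y (p ∸ x)
      dx' = ∣m+n∣m⇒∣n (subst (p ∣_) (trans (sym (eq x (p ∸ x) N y)) (+-comm _ (x * (x + (p ∸ x))))) (∣m∣n⇒∣m+n dx (∣n⇒∣m*n (p ∸ x) (∣-reflexive (sym x+z))))) (∣n⇒∣m*n x (∣-reflexive (sym x+z)))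
      x≢ : x ≢ p ∸ x
      x≢ e with euclidsLemma 2 x pr (∣-reflexive (trans (sym (trans (cong (x +_) e) x+z)) (sym (cong (x +_) (+-identityʳ x)))))
      ... | inj₁ d2 = <⇒∤ (s≤s z≤n) (≤-trans (s≤s (s≤s (s≤s z≤n))) p≥5) d2
      ... | inj₂ dx = <⇒∤ x>0 x<p dx

    swap-sum : ∀ (f : ℕ → ℕ → ℕ) → ∑∑ p f ≡ ∑ p (λ y → ∑ p (λ x → f x y))
    swap-sum f = ∑-swap p p f

    -- Multiples of p are represented too often, so `v` is smaller on them. The mean of `w` is 2 +
    -- 1/p and that of `v` on values of the form at most 3 - 2(p - 1)/p². Their product is about 6
    -- (1 - 1/(6p)); using 1/(12p) leaves half of the saving for the lower-order terms.
    split-weights : (∀ y → ∃ (RootAt y)) → Weights N p (12 * p ∸ 1) (12 * p)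
    split-weights root = record
      { κ = 6 ; κ>0 = z<s ; w = select p 3 2 ; v = select p 2 3 ; wv = select-* p 3 2 2 3 refl refl
      ; w-periodic = select-periodic p 3 2 ; v-periodic = select-periodic p 2 3 ; bound = bd }
      where
      V = ∑∑ p (λ x y → select p 2 3 (norm N x y))
      le : ∀ n → select p 2 3 n ≤ 3
      le n with p ∣? n
      ... | yes _ = s≤s (s≤s z≤n)
      ... | no _ = ≤-refl
      R : ℕ → ℕ
      R y = ∑ p (λ x → select p 2 3 (norm N x y))
      rows : ∀ k → k ≤ p' → ∑ (suc k) R + k * 2 ≤ suc k * (p * 3)
      -- The row y = 0 has only the root x = 0 and gets the trivial bound; the saving comes from the
      -- other p - 1 rows.
      rows zero _ = ≤-trans (≤-reflexive (+-identityʳ _)) (≤-trans (∑-mono p λ i _ → le _) (≤-reflexive (trans (∑-const p 3) (sym (+-identityʳ _)))))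
      rows (suc k) k<p' = ≤-trans (≤-reflexive (eq (∑ (suc k) R) (R (suc k)) (k * 2))) (+-mono-≤ (split-row (suc k) z<s (s≤s k<p') (root (suc k))) (rows k (<⇒≤ k<p')))
        where
        eq : ∀ a b c → a + b + (2 + c) ≡ (b + 2) + (a + c)
        eq = solve-∀
      Vbound : V + p' * 2 ≤ p * (p * 3)
      Vbound = ≤-trans (≤-reflexive (cong (_+ p' * 2) (swap-sum _))) (rows p' ≤-refl)
      bd : 12 * p * (∑ p (select p 3 2) * V) ≤ 6 * (p * p * p * (12 * p ∸ 1))
      bd = ≤-trans (≤-reflexive (cong (λ z → 12 * p * (z * V)) (∑-select p' 3 2))) (final p' V Vbound p≥5)
        where
        final : ∀ p' V → V + p' * 2 ≤ suc p' * (suc p' * 3) → 5 ≤ suc p' → 12 * suc p' * ((3 + p' * 2) * V) ≤ 6 * (suc p' * suc p' * suc p' * (12 * suc p' ∸ 1))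
        final p' V le (s≤s 4≤p') with m≤n⇒∃[o]m+o≡n 4≤p'
        ... | k , refl = +-cancelʳ-≤ (12 * (5 + k) * ((11 + k * 2) * ((4 + k) * 2))) _ _
             (≤-trans (≤-reflexive (e₁ k V)) (≤-trans (*-monoʳ-≤ (12 * (5 + k) * (11 + k * 2)) le)
               (≤-trans (m≤m+n _ _) (≤-reflexive (e₂ k)))))
          where
          e₁ : ∀ k V → 12 * (5 + k) * ((11 + k * 2) * V) + 12 * (5 + k) * ((11 + k * 2) * ((4 + k) * 2)) ≡ 12 * (5 + k) * (11 + k * 2) * (V + (4 + k) * 2)
          e₁ = solve-∀
          -- With p = 5 + k the difference of the two sides is a polynomial in k without negative
          -- coefficients, so the inequality becomes an identity.
          e₂ : ∀ k → 12 * (5 + k) * (11 + k * 2) * ((5 + k) * ((5 + k) * 3)) + (6 * (5 + k) * (k * k + 6 * k + 1)) ≡ 6 * ((5 + k) * (5 + k) * (5 + k) * (4 + k + 11 * (5 + k))) + 12 * (5 + k) * ((11 + k * 2) * ((4 + k) * 2))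
          e₂ = solve-∀

    -- Now multiples of p are represented too rarely, only at (0 , 0) among the p² pairs, so `v` may
    -- be larger on them. The mean of `w` is 2 - 1/p and that of `v` on values of the form at most 1
    -- + 1/p².
    inert-weights : (∀ x y → x < p → y < p → RootAt y x → y ≡ 0) → Weights N p (12 * p ∸ 1) (12 * p)
    inert-weights noroot = record
      { κ = 2 ; κ>0 = z<s ; w = select p 1 2 ; v = select p 2 1 ; wv = select-* p 1 2 2 1 refl refl
      ; w-periodic = select-periodic p 1 2 ; v-periodic = select-periodic p 2 1 ; bound = bd }
      where
      f : ℕ → ℕ → ℕ
      f x y = select p 2 1 (norm N x y)
      V = ∑∑ p f
      le : ∀ x y → f x y ≤ 2
      le x y with p ∣? norm N x y
      ... | yes _ = ≤-refl
      ... | no _ = s≤s z≤n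
      zero-only : ∀ x y → x < p → y < p → ¬ (x ≡ 0 × y ≡ 0) → f x y ≡ 1
      zero-only x y x<p y<p ne = select-∤ 2 1 λ d → ne (x0 d (noroot x y x<p y<p d) , noroot x y x<p y<p d)
        where
        x0 : RootAt y x → y ≡ 0 → x ≡ 0
        x0 d refl with x ≟ 0
        ... | yes e = e
        ... | no x≢0 = ⊥-elim (<⇒∤ (n≢0⇒n>0 x≢0) x<p (p∣sq (subst (p ∣_) (trans (cong (x * x +_) (*-zeroʳ N)) (+-identityʳ _)) d)))
      row : ∀ x → x < p → ∀ k → k ≤ p → (x ≢ 0) → ∑ k (f x) ≤ k
      row x x<p zero _ _ = z≤n
      row x x<p (suc k) k<p x≢0 = ≤-trans (+-mono-≤ (row x x<p k (<⇒≤ k<p) x≢0) (≤-reflexive (zero-only x k x<p k<p (λ e → x≢0 (proj₁ e))))) (≤-reflexive (+-comm k 1))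
      row0 : ∀ k → k ≤ p' → ∑ (suc k) (f 0) ≤ suc (suc k)
      row0 zero _ = le 0 0
      row0 (suc k) k<p = ≤-trans (+-mono-≤ (row0 k (<⇒≤ k<p)) (≤-reflexive (zero-only 0 (suc k) z<s (s≤s k<p) λ { (_ , ()) }))) (≤-reflexive (+-comm (suc (suc k)) 1))
      rows : ∀ k → k ≤ p' → ∑ (suc k) (λ x → ∑ p (f x)) ≤ suc (suc k * p)
      rows zero _ = ≤-trans (row0 p' ≤-refl) (≤-reflexive (cong suc (sym (+-identityʳ p))))
      rows (suc k) k<p = ≤-trans (+-mono-≤ (rows k (<⇒≤ k<p)) (row (suc k) (s≤s k<p) p ≤-refl (λ ()))) (≤-reflexive (eq p (suc k * p)))
        where
        eq : ∀ a b → suc b + a ≡ suc (a + b)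
        eq = solve-∀
      bd : 12 * p * (∑ p (select p 1 2) * V) ≤ 2 * (p * p * p * (12 * p ∸ 1))
      bd = ≤-trans (≤-reflexive (cong (λ z → 12 * p * (z * V)) (∑-select p' 1 2))) (final p' V (rows p' ≤-refl) p≥5)
        where
        final : ∀ p' V → V ≤ suc (suc p' * suc p') → 5 ≤ suc p' → 12 * suc p' * ((1 + p' * 2) * V) ≤ 2 * (suc p' * suc p' * suc p' * (12 * suc p' ∸ 1))
        final p' V le (s≤s 4≤p') with m≤n⇒∃[o]m+o≡n 4≤p'
        ... | k , refl = ≤-trans (*-monoʳ-≤ (12 * (5 + k)) (*-monoʳ-≤ (9 + k * 2) le)) (≤-trans (m≤m+n _ _) (≤-reflexive (e k)))
          where
          e : ∀ k → 12 * (5 + k) * ((9 + k * 2) * suc ((5 + k) * (5 + k))) + (5 + k) * (142 + 76 * k + 10 * (k * k)) ≡ 2 * ((5 + k) * (5 + k) * (5 + k) * (4 + k + 11 * (5 + k)))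
          e = solve-∀

    -- A finite search for a root with 0 < y < p decides the type of p; the resulting saving is the
    -- same for both.
    weights : Weights N p (12 * p ∸ 1) (12 * p)
    weights with anyUpTo? (λ y → (0 <? y) ×-dec anyUpTo? (λ x → p ∣? norm N x y) p) p
    ... | yes (y₀ , y₀<p , y₀>0 , x₀ , _ , d) = split-weights (scale x₀ y₀ y₀>0 y₀<p d)
    ... | no none = inert-weights λ x y x<p y<p d → n≤0⇒n≡0 (≮⇒≥ λ y>0 → none (y , y<p , y>0 , x , x<p , d))

  -- Sieving the harmonic sum

  DivisorClosed : (ℕ → Bool) → Set
  DivisorClosed S = ∀ {d n} → d ∣ n → S n ≡ true → S d ≡ true

  strike : ℕ → (ℕ → Bool) → ℕ → Bool
  strike p S n = if ⌊ p ∣? n ⌋ then false else S n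

  strike-true : ∀ p S n → strike p S n ≡ true → (¬ p ∣ n) × S n ≡ true
  strike-true p S n e with p ∣? n
  strike-true p S n () | yes _
  ... | no ¬d = ¬d , e

  strike-closed : ∀ p {S} → DivisorClosed S → DivisorClosed (strike p S)
  strike-closed p {S} cl {d} {n} d∣n e with strike-true p S n e
  ... | ¬p∣n , Sn with p ∣? d
  ...   | yes p∣d = ⊥-elim (¬p∣n (∣-trans p∣d d∣n))
  ...   | no _ = cl d∣n Sn

  module Harmonic (k : ℕ) where

    Y : ℕ
    Y = 2 ^ k

    -- Reciprocals scaled by Y and rounded down, which keeps harmonic sums in ℕ. The value 0 at 0
    -- lets sums start at 0 without effect.
    recip : ℕ → ℕ
    recip zero = 0
    recip (suc n) = Y / suc n

    term : (ℕ → Bool) → ℕ → ℕ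
    term S n = if S n then recip n else 0

    H : (ℕ → Bool) → ℕ
    H S = ∑ (suc Y) (term S)

    recip-* : ∀ p n → suc p * recip (suc p * n) ≤ recip n
    recip-* p zero = ≤-reflexive (trans (cong (λ z → suc p * recip z) (*-zeroʳ p)) (*-zeroʳ p))
    recip-* p (suc n) = ≤-trans (≤-reflexive (trans (*-comm (suc p) (Y / (suc p * suc n)))
        (cong (_* suc p) (trans (/-congʳ {m = Y} (*-comm (suc p) (suc n))) (sym (m/n/o≡m/[n*o] Y (suc n) (suc p)))))))
      (m/n*n≤m (Y / suc n) (suc p))

    -- With q = p + 1: a multiple q i in S has i in S by closure under divisors, and its reciprocal
    -- is at most 1/q of that of i. So the multiples of q carry at most H S / q, and striking them
    -- costs at most a factor 1 - 1/q.
    H-strike : ∀ p {S} → DivisorClosed S → p * H S ≤ suc p * H (strike (suc p) S)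
    H-strike p {S} cl = +-cancelʳ-≤ (H S) _ _ (begin
      p * H S + H S                                                    ≡⟨ +-comm (p * H S) (H S) ⟩
      suc p * H S                                                      ≤⟨ *-monoʳ-≤ (suc p) (≤-trans (∑-mono (suc Y) λ n _ → split n) (≤-reflexive (∑-+ (suc Y) (term (strike (suc p) S)) hit))) ⟩
      suc p * (H (strike (suc p) S) + ∑ (suc Y) hit)                   ≡⟨ *-distribˡ-+ (suc p) (H (strike (suc p) S)) (∑ (suc Y) hit) ⟩
      suc p * H (strike (suc p) S) + suc p * ∑ (suc Y) hit             ≤⟨ +-monoʳ-≤ (suc p * H (strike (suc p) S)) multiples ⟩
      suc p * H (strike (suc p) S) + H S ∎)
      where
      open ≤-Reasoning
      hit : ℕ → ℕ
      hit n = if ⌊ suc p ∣? n ⌋ then term S n else 0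
      split : ∀ n → term S n ≤ term (strike (suc p) S) n + hit n
      split n with suc p ∣? n
      ... | yes _ = ≤-refl
      ... | no _ = m≤m+n (term S n) 0
      hit-multiple : ∀ i → suc p * hit (i * suc p) ≤ term S i
      hit-multiple i with suc p ∣? i * suc p
      ... | no _ = ≤-trans (≤-reflexive (*-zeroʳ p)) z≤n
      ... | yes _ with S (i * suc p) in eq
      ...   | false = ≤-trans (≤-reflexive (*-zeroʳ p)) z≤n
      ...   | true rewrite cl (m∣m*n {i} (suc p)) eq = ≤-trans (≤-reflexive (cong (λ z → suc p * recip z) (*-comm i (suc p)))) (recip-* p i)
      hit-other : ∀ i j → j < p → hit (i * suc p + suc j) ≡ 0
      hit-other i j j<p with suc p ∣? i * suc p + suc j
      ... | no _ = refl
      ... | yes d = ⊥-elim (<⇒∤ z<s (s≤s j<p) (∣m+n∣m⇒∣n d (n∣m*n i)))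
      block : ∀ i q → q ≤ p → ∑ (suc q) (λ j → hit (i * suc p + j)) ≤ hit (i * suc p)
      block i zero _ = ≤-reflexive (cong hit (+-identityʳ (i * suc p)))
      block i (suc q) q<p = ≤-trans (+-mono-≤ (block i q (<⇒≤ q<p)) (≤-reflexive (hit-other i q q<p))) (≤-reflexive (+-identityʳ _))
      multiples : suc p * ∑ (suc Y) hit ≤ H S
      multiples = begin
        -- The range is enlarged to a whole number of blocks of length q, each with one multiple of
        -- q, at its start.
        suc p * ∑ (suc Y) hit                                              ≤⟨ *-monoʳ-≤ (suc p) (∑-mono-range hit (m≤m*n (suc Y) (suc p))) ⟩
        suc p * ∑ (suc Y * suc p) hit                                      ≡⟨ cong (suc p *_) (∑-blocks (suc Y) (suc p) hit) ⟩
        suc p * ∑ (suc Y) (λ i → ∑ (suc p) (λ j → hit (i * suc p + j)))    ≤⟨ *-monoʳ-≤ (suc p) (∑-mono (suc Y) λ i _ → block i p ≤-refl) ⟩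
        suc p * ∑ (suc Y) (λ i → hit (i * suc p))                          ≡⟨ sym (∑-*ˡ (suc Y) (suc p) _) ⟩
        ∑ (suc Y) (λ i → suc p * hit (i * suc p))                          ≤⟨ ∑-mono (suc Y) (λ i _ → hit-multiple i) ⟩
        H S ∎

    full : ℕ → Bool
    full _ = true

    -- Dyadic blocks: each of the 2^i numbers in (2^i, 2^(i+1)] has scaled reciprocal at least Y /
    -- 2^(i+1), an exact division as Y is a power of 2, so the block contributes at least Y / 2.
    full-lower : ∀ i → i ≤ k → i * Y ≤ 2 * ∑ (suc (2 ^ i)) (term full)
    full-lower zero _ = z≤n
    full-lower (suc i) i<k with m≤n⇒∃[o]m+o≡n i<k
    ... | o , refl = begin
      Y + i * Y                                                          ≡⟨ +-comm Y (i * Y) ⟩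
      i * Y + Y                                                          ≤⟨ +-mono-≤ (full-lower i (<⇒≤ i<k)) (≤-reflexive Y≡) ⟩
      2 * ∑ (suc (2 ^ i)) (term full) + 2 * (2 ^ i * 2 ^ o)              ≤⟨ +-monoʳ-≤ (2 * ∑ (suc (2 ^ i)) (term full)) (*-monoʳ-≤ 2 (≤-trans (≤-reflexive (sym (∑-const (2 ^ i) (2 ^ o)))) (∑-mono (2 ^ i) blk))) ⟩
      2 * ∑ (suc (2 ^ i)) (term full) + 2 * ∑ (2 ^ i) (λ j → Y / suc (2 ^ i + j))  ≡⟨ sym (*-distribˡ-+ 2 (∑ (suc (2 ^ i)) (term full)) (∑ (2 ^ i) (λ j → Y / suc (2 ^ i + j)))) ⟩
      2 * (∑ (suc (2 ^ i)) (term full) + ∑ (2 ^ i) (λ j → Y / suc (2 ^ i + j)))    ≡⟨ cong (2 *_) (sym (∑-split (suc (2 ^ i)) (2 ^ i) (term full))) ⟩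
      2 * ∑ (suc (2 ^ i) + 2 ^ i) (term full)                            ≡⟨ cong (λ z → 2 * ∑ (suc (2 ^ i) + z) (term full)) (sym (+-identityʳ (2 ^ i))) ⟩
      2 * ∑ (suc (2 ^ suc i)) (term full) ∎
      where
      open ≤-Reasoning
      Y≡ : Y ≡ 2 * (2 ^ i * 2 ^ o)
      Y≡ = trans (^-distribˡ-+-* 2 (suc i) o) (*-assoc 2 (2 ^ i) (2 ^ o))
      blk : ∀ j → j < 2 ^ i → 2 ^ o ≤ Y / suc (2 ^ i + j)
      blk j j<2^i = ≤-trans (≤-reflexive (sym (m*n/n≡m (2 ^ o) (2 ^ suc i) {{m^n≢0 2 (suc i)}})))
        (≤-trans (≤-reflexive (/-congˡ {{m^n≢0 2 (suc i)}} (trans (*-comm (2 ^ o) (2 ^ suc i)) (sym (^-distribˡ-+-* 2 (suc i) o)))))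
          (/-monoʳ-≤ Y {{m^n≢0 2 (suc i)}} (≤-trans (≤-reflexive (sym (+-suc (2 ^ i) j))) (+-monoʳ-≤ (2 ^ i) (≤-trans j<2^i (≤-reflexive (sym (+-identityʳ (2 ^ i)))))))))

    -- This is the situation after all primes up to Y are struck. Compared with `full-lower` it
    -- forces the product of the factors 1 - 1/p to be of order 1/k.
    H-only-one : ∀ S → (∀ n → n ≤ Y → S n ≡ true → n ≤ 1) → H S ≤ Y
    H-only-one S only = go Y ≤-refl
      where
      vanish : ∀ n → n ≤ Y → 1 < n → term S n ≡ 0
      vanish n n≤Y 1<n with S n in eq
      ... | true = ⊥-elim (<⇒≱ 1<n (only n n≤Y eq))
      ... | false = refl
      go : ∀ n → n ≤ Y → ∑ (suc n) (term S) ≤ Y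
      go zero _ with S 0
      ... | true = z≤n
      ... | false = z≤n
      go (suc zero) _ with S 0 | S 1
      ... | true | true = ≤-reflexive (n/1≡n Y)
      ... | true | false = z≤n
      ... | false | true = ≤-reflexive (n/1≡n Y)
      ... | false | false = z≤n
      go (suc (suc n)) n≤Y = ≤-trans (+-mono-≤ (go (suc n) (<⇒≤ n≤Y)) (≤-reflexive (vanish (suc (suc n)) n≤Y (s≤s z<s)))) (≤-reflexive (+-identityʳ Y))

  primeDivisor : ∀ n → 1 < n → ∃ λ q → Prime q × q ∣ n
  primeDivisor n@(suc _) 1<n with factorise n
  ... | record { factors = [] ; isFactorisation = e } = ⊥-elim (<⇒≢ 1<n (sym e))
  ... | record { factors = q ∷ qs ; isFactorisation = e ; factorsPrime = pq ∷ _ } = q , pq , divides (product qs) (trans e (*-comm q (product qs)))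

  bernoulli : ∀ a e → a ^ suc e + suc e * a ^ e ≤ suc a ^ suc e
  bernoulli a zero = ≤-reflexive (eq a)
    where
    eq : ∀ a → a * 1 + (1 + 0) ≡ (1 + a) * 1
    eq = solve-∀
  bernoulli a (suc e) = ≤-trans (m≤m+n _ (suc e * a ^ e)) (≤-trans (≤-reflexive (eq a (a ^ e) e)) (*-monoʳ-≤ (suc a) (bernoulli a e)))
    where
    eq : ∀ a x e → a * (a * x) + (2 + e) * (a * x) + (1 + e) * x ≡ (1 + a) * (a * x + (1 + e) * x)
    eq = solve-∀

  -- (1 - 1/(12p))^(e+1) ≤ 1 - 1/p
  local-power : ∀ e → 23 ≤ e → ∀ p' → 1 ≤ p' → (12 * suc p' ∸ 1) ^ suc e * suc p' ≤ (12 * suc p') ^ suc e * p'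
  local-power e 23≤e p' p≥1 = begin
    a ^ suc e * suc p'                          ≡⟨ eq₁ (a ^ suc e) p' ⟩
    p' * a ^ suc e + a ^ suc e                  ≤⟨ +-monoʳ-≤ (p' * a ^ suc e) (*-monoˡ-≤ (a ^ e) a≤) ⟩
    p' * a ^ suc e + p' * suc e * a ^ e         ≡⟨ eq₂ p' (a ^ suc e) (suc e) (a ^ e) ⟩
    p' * (a ^ suc e + suc e * a ^ e)            ≤⟨ *-monoʳ-≤ p' (bernoulli a e) ⟩
    p' * suc a ^ suc e                          ≡⟨ *-comm p' (suc a ^ suc e) ⟩
    suc a ^ suc e * p' ∎
    where
    open ≤-Reasoning
    a : ℕ
    a = 12 * suc p' ∸ 1
    eq₁ : ∀ x p → x * suc p ≡ p * x + x
    eq₁ = solve-∀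
    eq₂ : ∀ p x e y → p * x + p * e * y ≡ p * (x + e * y)
    eq₂ = solve-∀
    -- Bernoulli's inequality needs 12 p' + 11 ≤ (e + 1) p' for all p' ≥ 1. The constant 24 = 2 * 12
    -- suffices, hence 23 ≤ e.
    a≤ : a ≤ p' * suc e
    a≤ = ≤-trans (≤-reflexive (eq p')) (≤-trans (+-monoʳ-≤ (12 * p') (≤-trans (n≤1+n 11) (*-monoʳ-≤ 12 p≥1))) (≤-trans (≤-reflexive (eq' p')) (*-monoʳ-≤ p' (s≤s 23≤e))))
      where
      eq : ∀ p → p + 11 * suc p ≡ 12 * p + 11
      eq = solve-∀
      eq' : ∀ p → 12 * p + 12 * p ≡ p * 24
      eq' = solve-∀

  ^-distribʳ-* : ∀ n a b → (a * b) ^ n ≡ a ^ n * b ^ n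
  ^-distribʳ-* zero a b = refl
  ^-distribʳ-* (suc n) a b = trans (cong (a * b *_) (^-distribʳ-* n a b)) (eq a b (a ^ n) (b ^ n))
    where
    eq : ∀ a b x y → a * b * (x * y) ≡ a * x * (b * y)
    eq = solve-∀

  module Stages (N c' k e : ℕ) (23≤e : 23 ≤ e) (N>0 : 0 < N) (N≤c : N ≤ suc c') (4≤c : 4 ≤ suc c') where
    open Harmonic k

    c : ℕ
    c = suc c'

    -- The primes up to c admit no local weights but must be struck as well. Striking every q from 2
    -- to i + 1, prime or not, makes the losses q / (q - 1) telescope to i + 1.
    initial : ∀ i → ∃ λ S → DivisorClosed S × (∀ q → Prime q → q ≤ suc i → ∀ n → S n ≡ true → ¬ q ∣ n) × H full ≤ suc i * H S
    initial zero = full , (λ _ _ → refl) , (λ q pq q≤1 → ⊥-elim (¬≤1 pq q≤1)) , ≤-reflexive (sym (+-identityʳ _))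
      where
      ¬≤1 : ∀ {q} → Prime q → ¬ q ≤ 1
      ¬≤1 pq q≤1 = <⇒≱ (nonTrivial⇒n>1 _ {{prime⇒nonTrivial pq}}) q≤1
    initial (suc i) with initial i
    ... | S , cl , av , h = strike (2+ i) S , strike-closed (2+ i) cl , av' , ≤-trans h (H-strike (suc i) cl)
      where
      av' : ∀ q → Prime q → q ≤ 2+ i → ∀ n → strike (2+ i) S n ≡ true → ¬ q ∣ n
      av' q pq q≤ n e with q ≟ 2+ i
      ... | yes refl = proj₁ (strike-true (2+ i) S n e)
      ... | no q≢ = av q pq (≤-pred (≤∧≢⇒< q≤ q≢)) n (proj₂ (strike-true (2+ i) S n e))

    -- Over the primes p with c < p ≤ c + j, r / s is the product of 1 - 1/(12p) and a / b that of 1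
    -- - 1/p. The field `harmonic` is the sieve bound, and `power` compares the two products.
    record Stage (j : ℕ) : Set where
      field
        m r s a b : ℕ
        S : ℕ → Bool
        closed : DivisorClosed S
        avoids : ∀ q → Prime q → q ≤ c + j → ∀ n → S n ≡ true → ¬ q ∣ n
        harmonic : a * H full ≤ c * (b * H S)
        weights : Weights N m r s
        fresh : ∀ q → Prime q → c + j < q → ¬ q ∣ m
        m>0 : 0 < m
        r>0 : 0 < r
        b>0 : 0 < b
        power : r ^ suc e * b ≤ s ^ suc e * a

    stage : ∀ j → Stage j
    stage zero with initial c'
    ... | S , cl , av , h = record
      { m = 1 ; r = 1 ; s = 1 ; a = 1 ; b = 1 ; S = S ; closed = cl
      ; avoids = λ q pq q≤ → av q pq (subst (q ≤_) (+-identityʳ (suc c')) q≤)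
      ; harmonic = ≤-trans (≤-reflexive (+-identityʳ (H full))) (≤-trans h (≤-reflexive (cong (suc c' *_) (sym (+-identityʳ (H S))))))
      ; weights = trivialWeights N
      ; fresh = λ q pq _ q∣1 → <⇒≢ (nonTrivial⇒n>1 q {{prime⇒nonTrivial pq}}) (sym (∣1⇒≡1 q∣1))
      ; m>0 = z<s ; r>0 = z<s ; b>0 = z<s ; power = ≤-reflexive (cong (_* 1) (trans (^-zeroˡ (suc e)) (sym (^-zeroˡ (suc e))))) }
    stage (suc j) with stage j | prime? (suc (c + j))
    ... | st | no ¬p = record
      { m = m ; r = r ; s = s ; a = a ; b = b ; S = S ; closed = closed
      ; avoids = λ q pq q≤ → avoids q pq (≤-pred (≤∧≢⇒< (subst (q ≤_) (+-suc c j) q≤) λ { refl → ¬p pq }))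
      ; harmonic = harmonic ; weights = weights
      ; fresh = λ q pq <q → fresh q pq (<⇒≤ (subst (_< q) (+-suc c j) <q))
      ; m>0 = m>0 ; r>0 = r>0 ; b>0 = b>0 ; power = power }
      where open Stage st
    ... | st | yes pp = record
      { m = p * m ; r = (12 * p ∸ 1) * r ; s = 12 * p * s ; a = p' * a ; b = p * b
      ; S = strike p S ; closed = strike-closed p closed
      ; avoids = av
      ; harmonic = ≤-trans (≤-reflexive (eq₁ p' a (H full))) (≤-trans (*-monoʳ-≤ p' harmonic) (≤-trans (≤-reflexive (eq₂ p' c b (H S))) (≤-trans (*-monoʳ-≤ (c * b) (H-strike p' closed)) (≤-reflexive (eq₃ p c b (H (strike p S)))))))
      ; weights = combine cop (LocalPrime.weights N p' pp N>0 (s≤s (≤-trans N≤c (m≤m+n c j))) (s≤s (≤-trans 4≤c (m≤m+n c j)))) weights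
      ; fresh = λ q pq <q q∣ → [ (λ q∣p → <⇒∤ z<s (subst (_< q) (+-suc c j) <q) q∣p) , fresh q pq (<⇒≤ (subst (_< q) (+-suc c j) <q)) ] (euclidsLemma p m pq q∣)
      ; m>0 = *-mono-≤ (z<s {p'}) m>0
      ; r>0 = *-mono-≤ {1} {12 * p ∸ 1} (≤-trans (s≤s z≤n) (m≤n+m (11 * p) p')) r>0
      ; b>0 = *-mono-≤ (z<s {p'}) b>0
      ; power = ≤-trans (≤-reflexive (trans (cong (_* (p * b)) (^-distribʳ-* (suc e) (12 * p ∸ 1) r)) (eq₄ ((12 * p ∸ 1) ^ suc e) (r ^ suc e) p b)))
          (≤-trans (*-mono-≤ (local-power e 23≤e p' (≤-trans (s≤s z≤n) (≤-trans 4≤c (m≤m+n c j)))) power)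
            (≤-reflexive (trans (eq₄' ((12 * p) ^ suc e) (s ^ suc e) p' a) (cong (_* (p' * a)) (sym (^-distribʳ-* (suc e) (12 * p) s)))))) }
      where
      open Stage st
      p' p : ℕ
      p' = c + j
      p = suc p'
      av : ∀ q → Prime q → q ≤ c + suc j → ∀ n → strike p S n ≡ true → ¬ q ∣ n
      av q pq q≤ n e with q ≟ p
      ... | yes refl = proj₁ (strike-true p S n e)
      ... | no q≢ = avoids q pq (≤-pred (≤∧≢⇒< (subst (q ≤_) (+-suc c j) q≤) q≢)) n (proj₂ (strike-true p S n e))
      cop : Coprime p m
      cop (d∣p , d∣m) with prime⇒irreducible pp d∣p
      ... | inj₁ d≡1 = d≡1
      ... | inj₂ refl = ⊥-elim (fresh p pp ≤-refl d∣m)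
      eq₁ : ∀ p a h → p * a * h ≡ p * (a * h)
      eq₁ = solve-∀
      eq₂ : ∀ p c b h → p * (c * (b * h)) ≡ c * b * (p * h)
      eq₂ = solve-∀
      eq₃ : ∀ p c b h → c * b * (p * h) ≡ c * (p * b * h)
      eq₃ = solve-∀
      eq₄ : ∀ x y p b → x * y * (p * b) ≡ x * p * (y * b)
      eq₄ = solve-∀
      eq₄' : ∀ x y p b → x * p * (y * b) ≡ x * y * (p * b)
      eq₄' = solve-∀

  -- K is squared because Cauchy-Schwarz bounds the square of a count.
  record GoodWeights (N K : ℕ) : Set where
    field
      m r s : ℕ
      m>0 : 0 < m
      r>0 : 0 < r
      small : r * (K * K) ≤ s
      weights : Weights N m r s

  goodWeights′ : ∀ e → 23 ≤ e → ∀ N K → 0 < N → GoodWeights N K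
  goodWeights′ e 23≤e N K N>0 = record { m = m ; r = r ; s = s ; m>0 = m>0 ; r>0 = r>0 ; small = small ; weights = weights }
    where
    k : ℕ
    -- Chosen so that `ak≤` reads a / b ≤ (K²)^-(e+1): the factor 2 comes from `full-lower` and 4 +
    -- N = c from `initial`.
    k = 2 * (4 + N) * (K * K) ^ suc e
    open Harmonic k
    open Stages N (3 + N) k e 23≤e N>0 (m≤n+m N 4) (m≤m+n 4 N)
    open Stage (stage Y)
    only : ∀ n → n ≤ Y → S n ≡ true → n ≤ 1
    only n n≤Y Sn = ≮⇒≥ λ 1<n → let (q , pq , q∣n) = primeDivisor n 1<n in
      avoids q pq (≤-trans (∣⇒≤ {{>-nonZero (<-trans z<s 1<n)}} q∣n) (≤-trans n≤Y (m≤n+m Y c))) n Sn q∣n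
    -- At stage Y all primes up to Y are struck, so H S ≤ Y, whereas H full ≥ k Y / 2.
    ak≤ : a * k ≤ 2 * c * b
    ak≤ = *-cancelʳ-≤ _ _ Y {{m^n≢0 2 k}} (begin
      a * k * Y                ≡⟨ *-assoc a k Y ⟩
      a * (k * Y)              ≤⟨ *-monoʳ-≤ a (full-lower k ≤-refl) ⟩
      a * (2 * H full)         ≡⟨ eq₁ a (H full) ⟩
      2 * (a * H full)         ≤⟨ *-monoʳ-≤ 2 harmonic ⟩
      2 * (c * (b * H S))      ≤⟨ *-monoʳ-≤ 2 (*-monoʳ-≤ c (*-monoʳ-≤ b (H-only-one S only))) ⟩
      2 * (c * (b * Y))        ≡⟨ eq₂ c b Y ⟩
      2 * c * b * Y ∎)
      where
      open ≤-Reasoning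
      eq₁ : ∀ a h → a * (2 * h) ≡ 2 * (a * h)
      eq₁ = solve-∀
      eq₂ : ∀ c b y → 2 * (c * (b * y)) ≡ 2 * c * b * y
      eq₂ = solve-∀
    powers : (r * (K * K)) ^ suc e ≤ s ^ suc e
    powers = *-cancelʳ-≤ _ _ (2 * c * b) {{>-nonZero (*-mono-≤ {1} {2 * c} (s≤s z≤n) b>0)}} (begin
      (r * (K * K)) ^ suc e * (2 * c * b)        ≡⟨ cong (_* (2 * c * b)) (^-distribʳ-* (suc e) r (K * K)) ⟩
      r ^ suc e * (K * K) ^ suc e * (2 * c * b)     ≡⟨ eq₁ (r ^ suc e) ((K * K) ^ suc e) (2 * c) b ⟩
      r ^ suc e * b * k                          ≤⟨ *-monoˡ-≤ k power ⟩
      s ^ suc e * a * k                          ≡⟨ *-assoc (s ^ suc e) a k ⟩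
      s ^ suc e * (a * k)                        ≤⟨ *-monoʳ-≤ (s ^ suc e) ak≤ ⟩
      s ^ suc e * (2 * c * b) ∎)
      where
      open ≤-Reasoning
      eq₁ : ∀ x y d b → x * y * (d * b) ≡ x * b * (d * y)
      eq₁ = solve-∀
    small : r * (K * K) ≤ s
    small = ≮⇒≥ λ s< → <⇒≱ (^-monoˡ-< (suc e) s<) powers

  -- With `e` a variable above, the powers stay symbolic; 23 is the least value that `local-power`
  -- admits.
  goodWeights : ∀ N K → 0 < N → GoodWeights N K
  goodWeights = goodWeights′ 23 ≤-refl

  -- Cauchy-Schwarz and sets of density zero

  only : Bool → ℕ → ℕ
  only b n = if b then n else 0

  only-≤ : ∀ b n → only b n ≤ n
  only-≤ true n = ≤-refl
  only-≤ false n = z≤n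

  count : (ℕ → Bool) → ℕ → ℕ
  count f X = ∑ X λ n → only (f n) 1

  square-cancel-≤ : ∀ a b → a * a ≤ b * b → a ≤ b
  square-cancel-≤ a b le = ≮⇒≥ λ b<a → <⇒≱ (*-mono-< b<a b<a) le

  am-gm : ∀ a b t → t * t ≤ a * b → 2 * t ≤ a + b
  am-gm a b t le = square-cancel-≤ (2 * t) (a + b) (≤-trans (≤-reflexive (eq t)) (≤-trans (*-monoʳ-≤ 4 le) (4ab a b)))
    where
    eq : ∀ t → 2 * t * (2 * t) ≡ 4 * (t * t)
    eq = solve-∀
    4ab-≤ : ∀ a b → a ≤ b → 4 * (a * b) ≤ (a + b) * (a + b)
    4ab-≤ a b a≤b with m≤n⇒∃[o]m+o≡n a≤b
    ... | d , refl = ≤-trans (m≤m+n _ (d * d)) (≤-reflexive (eq' a d))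
      where
      eq' : ∀ a d → 4 * (a * (a + d)) + d * d ≡ (a + (a + d)) * (a + (a + d))
      eq' = solve-∀
    4ab : ∀ a b → 4 * (a * b) ≤ (a + b) * (a + b)
    4ab a b with ≤-total a b
    ... | inj₁ a≤b = 4ab-≤ a b a≤b
    ... | inj₂ b≤a = ≤-trans (≤-reflexive (cong (4 *_) (*-comm a b))) (≤-trans (4ab-≤ b a b≤a) (≤-reflexive (cong₂ _*_ (+-comm b a) (+-comm b a))))

  -- Induction on X. A new element adds 2 κ c + κ on the left and U v + u V + u v on the right.
  -- Since (κ c)² ≤ (U v)(u V) by the induction hypothesis, the arithmetic-geometric mean inequality
  -- covers the cross terms, with no square roots.
  cauchy-schwarz : ∀ (f : ℕ → Bool) (u v : ℕ → ℕ) κ → (∀ n → u n * v n ≡ κ) → ∀ X →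
    κ * (count f X * count f X) ≤ ∑ X (λ n → only (f n) (u n)) * ∑ X (λ n → only (f n) (v n))
  cauchy-schwarz f u v κ uv zero = ≤-reflexive (*-zeroʳ κ)
  cauchy-schwarz f u v κ uv (suc X) with f X | cauchy-schwarz f u v κ uv X
  ... | false | ih = ≤-trans (≤-reflexive (cong (λ z → κ * (z * z)) (+-identityʳ (count f X))))
      (≤-trans ih (≤-reflexive (sym (cong₂ _*_ (+-identityʳ (∑ X (λ n → only (f n) (u n)))) (+-identityʳ (∑ X (λ n → only (f n) (v n))))))))
  ... | true | ih = begin
    κ * ((c + 1) * (c + 1))                     ≡⟨ eq₁ κ c ⟩
    κ * (c * c) + (2 * (κ * c) + κ)             ≤⟨ +-mono-≤ ih (+-mono-≤ (am-gm (U * v X) (u X * V) (κ * c) cross) (≤-reflexive (sym (uv X)))) ⟩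
    U * V + (U * v X + u X * V + u X * v X)     ≡⟨ eq₂ U V (u X) (v X) ⟩
    (U + u X) * (V + v X) ∎
    where
    open ≤-Reasoning
    c = count f X
    U = ∑ X (λ n → only (f n) (u n))
    V = ∑ X (λ n → only (f n) (v n))
    eq₁ : ∀ κ c → κ * ((c + 1) * (c + 1)) ≡ κ * (c * c) + (2 * (κ * c) + κ)
    eq₁ = solve-∀
    eq₂ : ∀ U V u v → U * V + (U * v + u * V + u * v) ≡ (U + u) * (V + v)
    eq₂ = solve-∀
    eq₃ : ∀ κ c → κ * c * (κ * c) ≡ κ * (κ * (c * c))
    eq₃ = solve-∀
    eq₄ : ∀ u v U V → u * v * (U * V) ≡ U * v * (u * V)
    eq₄ = solve-∀
    cross : κ * c * (κ * c) ≤ U * v X * (u X * V)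
    cross = ≤-trans (≤-reflexive (eq₃ κ c)) (≤-trans (*-monoʳ-≤ κ ih) (≤-reflexive (trans (cong (_* (U * V)) (sym (uv X))) (eq₄ (u X) (v X) U V))))

  ∑-affine : ∀ a b (h : ℕ → ℕ) X → ∑ X (λ n → h (suc a * n + b)) ≤ ∑ (suc a * X + b) h
  ∑-affine a b h zero = z≤n
  ∑-affine a b h (suc X) = begin
    ∑ X (λ n → h (suc a * n + b)) + h (suc a * X + b)     ≤⟨ +-monoˡ-≤ _ (∑-affine a b h X) ⟩
    ∑ (suc (suc a * X + b)) h                             ≤⟨ ∑-mono-range h (≤-trans (m≤m+n _ a) (≤-reflexive (eq a b X))) ⟩
    ∑ (suc a * suc X + b) h ∎
    where
    open ≤-Reasoning
    eq : ∀ a b X → suc (suc a * X + b) + a ≡ suc a * suc X + b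
    eq = solve-∀

  δ≟ : ℕ → ℕ → ℕ → ℕ
  δ≟ a b n = only ⌊ a ≟ b ⌋ n

  ∑-term : ∀ n (g : ℕ → ℕ) i → i < n → g i ≤ ∑ n g
  ∑-term (suc n) g i i<n with i ≟ n
  ... | yes refl = m≤n+m (g i) (∑ n g)
  ... | no i≢n = ≤-trans (∑-term n g i (≤∧≢⇒< (≤-pred i<n) i≢n)) (m≤m+n _ _)

  -- Ensures that a pair (x , y) is charged by at most one n.
  ∑-δ : ∀ (φ : ℕ → ℕ) → (∀ {i j} → φ i ≡ φ j → i ≡ j) → ∀ c z X → ∑ X (λ n → δ≟ c (φ n) z) ≤ z
  ∑-δ φ inj c z zero = z≤n
  ∑-δ φ inj c z (suc X) with c ≟ φ X
  ... | no _ = ≤-trans (≤-reflexive (+-identityʳ _)) (∑-δ φ inj c z X)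
  ... | yes refl = ≤-trans (+-monoˡ-≤ z (≤-reflexive (miss X ≤-refl))) ≤-refl
    where
    miss : ∀ Y → Y ≤ X → ∑ Y (λ n → δ≟ (φ X) (φ n) z) ≡ 0
    miss zero _ = refl
    miss (suc Y) Y<X with φ X ≟ φ Y
    ... | yes e = ⊥-elim (<⇒≢ Y<X (sym (inj e)))
    ... | no _ = trans (+-identityʳ _) (miss Y (<⇒≤ Y<X))

  -- Density zero, with 1/K in the role of ε so that no quotient occurs.
  Sparse : (ℕ → Bool) → Set
  Sparse f = ∀ K → ∃ λ X₀ → ∀ X → X₀ ≤ X → K * count f X ≤ X

  -- A square root rounded to multiples of m, because the box of pairs (x , y) has to consist of
  -- whole periods.
  sqrt-bracket : ∀ m → 0 < m → ∀ Z → ∃ λ t → (t * m) * (t * m) ≤ Z × Z < (suc t * m) * (suc t * m)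
  sqrt-bracket m m>0 zero = 0 , z≤n , *-mono-≤ (≤-trans m>0 (m≤m+n m 0)) (≤-trans m>0 (m≤m+n m 0))
  sqrt-bracket m m>0 (suc Z) with sqrt-bracket m m>0 Z
  ... | t , lo , hi with suc Z ≟ (suc t * m) * (suc t * m)
  ...   | no ne = t , ≤-trans lo (n≤1+n Z) , ≤∧≢⇒< hi ne
  ...   | yes e = suc t , ≤-reflexive (sym e) , ≤-trans (s≤s (≤-reflexive e)) (*-mono-< (m<n+m (suc t * m) m>0) (m<n+m (suc t * m) m>0))

  module _ (f : ℕ → Bool) (a b N : ℕ) (N>0 : 0 < N)
           (rep : ∀ n → f n ≡ true → ∃₂ λ x y → suc a * n + b ≡ norm N x y) where
    private
      φ : ℕ → ℕ
      φ n = suc a * n + b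

      φ-inj : ∀ {i j} → φ i ≡ φ j → i ≡ j
      φ-inj {i} {j} e = *-cancelˡ-≡ i j (suc a) (+-cancelʳ-≡ b (suc a * i) (suc a * j) e)

    -- Put B = t m. The values φ n lie below B², so the `w`-sum is at most that over all integers
    -- below B²; each φ n has a representation inside the B by B box, so the `v`-sum is at most that
    -- over the box. Both ranges are whole numbers of periods, and `bound` applies to the product.
    box-bound : ∀ {K m r s t} → Weights N m r s → 0 < r → r * (K * K) ≤ s → ∀ X → φ X ≤ (t * m) * (t * m) →
                K * count f X ≤ (t * m) * (t * m)
    box-bound {K} {m} {r} {s} {t} W r>0 small X φX≤ =
      square-cancel-≤ (K * c) (B * B) (*-cancelˡ-≤ (W.κ * r) {{>-nonZero (*-mono-≤ W.κ>0 r>0)}} (begin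
        W.κ * r * (K * c * (K * c))                        ≡⟨ eq₁ W.κ r K c ⟩
        r * (K * K) * (W.κ * (c * c))                      ≤⟨ *-mono-≤ small (≤-trans (cauchy-schwarz f (λ n → W.w (φ n)) (λ n → W.v (φ n)) W.κ (λ n → W.wv (φ n)) X) (*-mono-≤ U≤ V≤)) ⟩
        s * (B * t * ∑ m W.w * (t * (t * VV)))             ≡⟨ eq₂ s t m (∑ m W.w) VV ⟩
        t * t * t * t * m * (s * (∑ m W.w * VV))           ≤⟨ *-monoʳ-≤ (t * t * t * t * m) W.bound ⟩
        t * t * t * t * m * (W.κ * (m * m * m * r))        ≡⟨ eq₃ t m W.κ r ⟩
        W.κ * r * (B * B * (B * B)) ∎))
      where
      open ≤-Reasoning
      module W = Weights W
      B c VV : ℕ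
      B = t * m
      c = count f X
      VV = ∑∑ m (λ x y → W.v (norm N x y))
      eq₁ : ∀ κ r K c → κ * r * (K * c * (K * c)) ≡ r * (K * K) * (κ * (c * c))
      eq₁ = solve-∀
      eq₂ : ∀ s t m x y → s * (t * m * t * x * (t * (t * y))) ≡ t * t * t * t * m * (s * (x * y))
      eq₂ = solve-∀
      eq₃ : ∀ t m κ r → t * t * t * t * m * (κ * (m * m * m * r)) ≡ κ * r * (t * m * (t * m) * (t * m * (t * m)))
      eq₃ = solve-∀
      eq₄ : ∀ t m → t * m * (t * m) ≡ t * m * t * m
      eq₄ = solve-∀
      U≤ : ∑ X (λ n → only (f n) (W.w (φ n))) ≤ B * t * ∑ m W.w
      U≤ = begin
        ∑ X (λ n → only (f n) (W.w (φ n)))       ≤⟨ ∑-mono X (λ n _ → only-≤ (f n) (W.w (φ n))) ⟩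
        ∑ X (λ n → W.w (φ n))                    ≤⟨ ∑-affine a b W.w X ⟩
        ∑ (φ X) W.w                              ≤⟨ ∑-mono-range W.w φX≤ ⟩
        ∑ (B * B) W.w                            ≡⟨ cong (λ z → ∑ z W.w) (eq₄ t m) ⟩
        ∑ (B * t * m) W.w                        ≡⟨ ∑-blocks-periodic W.w-periodic (B * t) ⟩
        B * t * ∑ m W.w ∎
      g : ℕ → ℕ → ℕ
      g x y = W.v (norm N x y)
      V-box : ∑∑ B g ≡ t * (t * VV)
      V-box = begin-equality
        ∑ B (λ x → ∑ B (g x))           ≡⟨ ∑-cong B (λ x → ∑-blocks-periodic (norm-periodicʳ {N} {m} {W.v} W.v-periodic x) t) ⟩
        ∑ B (λ x → t * ∑ m (g x))       ≡⟨ ∑-*ˡ B t _ ⟩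
        t * ∑ B (λ x → ∑ m (g x))       ≡⟨ cong (t *_) (∑-blocks-periodic (λ x → ∑-cong m λ y → norm-periodicˡ {N} {m} {W.v} W.v-periodic y x) t) ⟩
        t * (t * VV) ∎
      small-coordinate : ∀ z {M} → z * z ≤ M → M < B * B → z < B
      small-coordinate z le lt = ≰⇒> λ B≤z → <⇒≱ lt (≤-trans (*-mono-≤ B≤z B≤z) le)
      pick : ∀ n → n < X → only (f n) (W.v (φ n)) ≤ ∑ B (λ x → ∑ B (λ y → δ≟ (norm N x y) (φ n) (g x y)))
      pick n n<X with f n in eq
      ... | false = z≤n
      ... | true = let (x , y , e) = rep n eq
                       lt : norm N x y < B * B
                       lt = ≤-trans (s≤s (≤-reflexive (sym e))) (≤-trans (+-monoˡ-< b (*-monoʳ-< (suc a) n<X)) φX≤)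
                   in begin
        W.v (φ n)                                                        ≡⟨ cong W.v e ⟩
        g x y                                                            ≡⟨ sym (hit (norm N x y) (φ n) (g x y) (sym e)) ⟩
        δ≟ (norm N x y) (φ n) (g x y)                                    ≤⟨ ∑-term B (λ y → δ≟ (norm N x y) (φ n) (g x y)) y (small-coordinate y (≤-trans (m≤n*m (y * y) N {{>-nonZero N>0}}) (m≤n+m _ (x * x))) lt) ⟩
        ∑ B (λ y → δ≟ (norm N x y) (φ n) (g x y))                        ≤⟨ ∑-term B (λ x → ∑ B (λ y → δ≟ (norm N x y) (φ n) (g x y))) x (small-coordinate x (m≤m+n (x * x) _) lt) ⟩
        ∑ B (λ x → ∑ B (λ y → δ≟ (norm N x y) (φ n) (g x y))) ∎
        where
        hit : ∀ c d z → c ≡ d → δ≟ c d z ≡ z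
        hit c d z e with c ≟ d
        ... | yes _ = refl
        ... | no ne = ⊥-elim (ne e)
      V≤ : ∑ X (λ n → only (f n) (W.v (φ n))) ≤ t * (t * VV)
      V≤ = begin
        ∑ X (λ n → only (f n) (W.v (φ n)))                                          ≤⟨ ∑-mono X pick ⟩
        ∑ X (λ n → ∑ B (λ x → ∑ B (λ y → δ≟ (norm N x y) (φ n) (g x y))))           ≡⟨ ∑-swap X B _ ⟩
        ∑ B (λ x → ∑ X (λ n → ∑ B (λ y → δ≟ (norm N x y) (φ n) (g x y))))           ≡⟨ ∑-cong B (λ x → ∑-swap X B _) ⟩
        ∑ B (λ x → ∑ B (λ y → ∑ X (λ n → δ≟ (norm N x y) (φ n) (g x y))))           ≤⟨ ∑-mono B (λ x _ → ∑-mono B λ y _ → ∑-δ φ φ-inj (norm N x y) (g x y) X) ⟩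
        ∑∑ B g                                                                      ≡⟨ V-box ⟩
        t * (t * VV) ∎

    -- The factor 4 pays for rounding the side of the box up, which at most doubles it, and
    -- `suc a + b` for passing from φ X back to X.
    weighted-bound : ∀ K → GoodWeights N (4 * (suc a + b) * K) → ∃ λ X₀ → ∀ X → X₀ ≤ X → K * count f X ≤ X
    weighted-bound K gw = suc (m * m) , bound
      where
      A K' : ℕ
      A = suc a + b
      K' = 4 * A * K
      open GoodWeights gw
      bound : ∀ X → suc (m * m) ≤ X → K * count f X ≤ X
      bound X X≥ with sqrt-bracket m m>0 (φ X)
      -- X > m² excludes t = 0, where rounding up could not be bounded by doubling.
      ... | zero , lo , hi = ⊥-elim (<⇒≱ hi (≤-trans (≤-reflexive (cong₂ _*_ (+-identityʳ m) (+-identityʳ m))) (≤-trans (<⇒≤ X≥) (≤-trans (m≤m+n X (a * X)) (m≤m+n _ b)))))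
      ... | suc t , lo , hi = *-cancelˡ-≤ (4 * A) (begin
        4 * A * (K * count f X)                     ≡⟨ sym (*-assoc (4 * A) K (count f X)) ⟩
        K' * count f X                              ≤⟨ box-bound {K'} {m} {r} {s} {2+ t} weights r>0 small X (<⇒≤ hi) ⟩
        (m + (m + t * m)) * (m + (m + t * m))       ≤⟨ *-mono-≤ dbl dbl ⟩
        2 * (suc t * m) * (2 * (suc t * m))         ≡⟨ eq₁ (suc t * m) ⟩
        4 * (suc t * m * (suc t * m))               ≤⟨ *-monoʳ-≤ 4 lo ⟩
        4 * (suc a * X + b)                         ≤⟨ *-monoʳ-≤ 4 (+-monoʳ-≤ (suc a * X) (≤-trans (≤-reflexive (sym (*-identityʳ b))) (*-monoʳ-≤ b (≤-trans (s≤s z≤n) X≥)))) ⟩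
        4 * (suc a * X + b * X)                     ≡⟨ eq₂ (suc a) b X ⟩
        4 * A * X ∎)
        where
        open ≤-Reasoning
        eq₁ : ∀ z → 2 * z * (2 * z) ≡ 4 * (z * z)
        eq₁ = solve-∀
        eq₂ : ∀ a b X → 4 * (a * X + b * X) ≡ 4 * (a + b) * X
        eq₂ = solve-∀
        dbl : m + (m + t * m) ≤ 2 * (suc t * m)
        dbl = +-mono-≤ (m≤m+n m (t * m)) (≤-reflexive (sym (+-identityʳ _)))

    norm-sparse : Sparse f
    norm-sparse K = weighted-bound K (goodWeights N (4 * (suc a + b) * K) N>0)

  sparse-⊆ : ∀ {f g : ℕ → Bool} → (∀ n → f n ≡ true → g n ≡ true) → Sparse g → Sparse f
  sparse-⊆ {f} {g} sub sp K with sp K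
  ... | X₀ , h = X₀ , λ X X≥ → ≤-trans (*-monoʳ-≤ K (∑-mono X λ n _ → le n)) (h X X≥)
    where
    le : ∀ n → only (f n) 1 ≤ only (g n) 1
    le n with f n in eq
    ... | false = z≤n
    ... | true rewrite sub n eq = ≤-refl

  sparse-xor : ∀ {f g : ℕ → Bool} → Sparse f → Sparse g → Sparse (λ n → f n xor g n)
  sparse-xor {f} {g} sf sg K with sf (2 * K) | sg (2 * K)
  ... | X₁ , h₁ | X₂ , h₂ = X₁ + X₂ , λ X X≥ → *-cancelˡ-≤ 2 (begin
    2 * (K * count (λ n → f n xor g n) X)              ≤⟨ *-monoʳ-≤ 2 (*-monoʳ-≤ K (≤-trans (∑-mono X λ n _ → le (f n) (g n)) (≤-reflexive (∑-+ X _ _)))) ⟩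
    2 * (K * (count f X + count g X))                  ≡⟨ eq K (count f X) (count g X) ⟩
    2 * K * count f X + 2 * K * count g X              ≤⟨ +-mono-≤ (h₁ X (≤-trans (m≤m+n X₁ X₂) X≥)) (h₂ X (≤-trans (m≤n+m X₂ X₁) X≥)) ⟩
    X + X                                              ≡⟨ cong (X +_) (sym (+-identityʳ X)) ⟩
    2 * X ∎)
    where
    open ≤-Reasoning
    le : ∀ b c → only (b xor c) 1 ≤ only b 1 + only c 1
    le true true = z≤n
    le true false = ≤-refl
    le false true = ≤-refl
    le false false = z≤n
    eq : ∀ K a b → 2 * (K * (a + b)) ≡ 2 * K * a + 2 * K * b
    eq = solve-∀

  count-suc : ∀ (f : ℕ → Bool) X → count f (suc X) ≡ only (f 0) 1 + count (λ n → f (suc n)) X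
  count-suc f zero = sym (+-identityʳ _)
  count-suc f (suc X) = trans (cong (_+ only (f (suc X)) 1) (count-suc f X)) (+-assoc (only (f 0) 1) _ _)

  sparse-tail : ∀ {f : ℕ → Bool} → Sparse f → Sparse (λ n → f (suc n))
  sparse-tail {f} sf K with sf (2 * K)
  ... | X₀ , h = suc X₀ , λ X X≥ → *-cancelˡ-≤ 2 (begin
    2 * (K * count (λ n → f (suc n)) X)        ≡⟨ sym (*-assoc 2 K _) ⟩
    2 * K * count (λ n → f (suc n)) X          ≤⟨ *-monoʳ-≤ (2 * K) (≤-trans (m≤n+m _ (only (f 0) 1)) (≤-reflexive (sym (count-suc f X)))) ⟩
    2 * K * count f (suc X)                    ≤⟨ h (suc X) (≤-trans (<⇒≤ X≥) (n≤1+n X)) ⟩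
    1 + X                                      ≤⟨ +-mono-≤ (≤-trans (s≤s z≤n) X≥) (m≤m+n X 0) ⟩
    2 * X ∎)
    where open ≤-Reasoning

  double-halves : ∀ (f : ℕ → Bool) X → count f (2 * X) ≡ count (λ n → f (2 * n)) X + count (λ n → f (suc (2 * n))) X
  double-halves f zero = refl
  double-halves f (suc X) = begin
    count f (2 * suc X)                                                             ≡⟨ cong (count f) (*-suc 2 X) ⟩
    count f (2 * X) + only (f (2 * X)) 1 + only (f (suc (2 * X))) 1                 ≡⟨ cong (λ z → z + only (f (2 * X)) 1 + only (f (suc (2 * X))) 1) (double-halves f X) ⟩
    count (λ n → f (2 * n)) X + count (λ n → f (suc (2 * n))) X + only (f (2 * X)) 1 + only (f (suc (2 * X))) 1
      ≡⟨ eq (count (λ n → f (2 * n)) X) (count (λ n → f (suc (2 * n))) X) (only (f (2 * X)) 1) (only (f (suc (2 * X))) 1) ⟩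
    count (λ n → f (2 * n)) (suc X) + count (λ n → f (suc (2 * n))) (suc X) ∎
    where
    open ≡-Reasoning
    eq : ∀ a b c d → a + b + c + d ≡ (a + c) + (b + d)
    eq = solve-∀

  sparse-halves : ∀ {f : ℕ → Bool} → Sparse (λ n → f (2 * n)) → Sparse (λ n → f (suc (2 * n))) → Sparse f
  sparse-halves {f} se so K with se (2 * K) | so (2 * K)
  ... | X₁ , h₁ | X₂ , h₂ = 2 * (X₁ + X₂) , bound
    where
    open ≤-Reasoning
    bound : ∀ X → 2 * (X₁ + X₂) ≤ X → K * count f X ≤ X
    bound X X≥ = *-cancelˡ-≤ 2 (begin
      2 * (K * count f X)                  ≡⟨ sym (*-assoc 2 K _) ⟩
      2 * K * count f X                    ≤⟨ *-monoʳ-≤ (2 * K) (≤-trans (∑-mono-range _ (m≤n*m X 2)) (≤-reflexive (double-halves f X))) ⟩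
      2 * K * (count (λ n → f (2 * n)) X + count (λ n → f (suc (2 * n))) X)  ≡⟨ *-distribˡ-+ (2 * K) _ _ ⟩
      2 * K * count (λ n → f (2 * n)) X + 2 * K * count (λ n → f (suc (2 * n))) X  ≤⟨ +-mono-≤ (h₁ X X≥₁) (h₂ X X≥₂) ⟩
      X + X                                ≡⟨ cong (X +_) (sym (+-identityʳ X)) ⟩
      2 * X ∎)
      where
      X≥₁ : X₁ ≤ X
      X≥₁ = ≤-trans (m≤m+n X₁ X₂) (≤-trans (m≤n*m _ 2) X≥)
      X≥₂ : X₂ ≤ X
      X≥₂ = ≤-trans (m≤n+m X₂ X₁) (≤-trans (m≤n*m _ 2) X≥)

-- Power series over the field with two elements

module Series where

  open import Defs
  open import Data.Nat as ℕ using (ℕ; zero; suc; _≤_; _<_; z≤n; s≤s; _∸_; _%_)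
  open import Data.Nat.Properties using (≤-refl; ≤-trans; m≤n⇒m≤1+n; m≤n⇒∃[o]m+o≡n; <-≤-connex; +-suc; +-comm)
  open import Data.Nat.DivMod using ([m+n]%n≡m%n; m<n⇒m%n≡m)
  open import Data.Integer as ℤ using (ℤ; +_; -[1+_]; ∣_∣)
  import Data.Integer.Properties as ℤP
  open import Data.Bool using (Bool; true; false; _∧_; _xor_; not)
  open import Data.Bool.Properties using (xor-assoc; xor-comm; xor-identityʳ; xor-same; ∧-comm; ∧-assoc; ∧-idem; ∧-zeroʳ; ∧-distribˡ-xor; ∧-distribʳ-xor; ∧-identityʳ; xor-∧-commutativeRing)
  open import Data.List using (applyUpTo)
  open import Data.List.Properties using (map-applyUpTo)
  open import Data.Maybe using (Maybe; just; nothing)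
  open import Data.Product using (_,_)
  open import Data.Sum using (inj₁; inj₂)
  open import Data.Empty using (⊥-elim)
  open import Algebra.Bundles using (CommutativeRing)
  import Algebra.Solver.Ring
  open import Algebra.Solver.Ring.AlmostCommutativeRing using (AlmostCommutativeRing; fromCommutativeRing; _-Raw-AlmostCommutative⟶_)
  open import Level using (0ℓ)
  open import Relation.Nullary
  import Relation.Binary.Reasoning.Setoid
  open import Relation.Binary.PropositionalEquality

  Ser : Set
  Ser = ℕ → Bool

  infix 4 _≈_ _≈[_]_
  infixl 6 _⊕_
  infixl 7 _·_

  _≈_ : Ser → Ser → Set
  f ≈ g = ∀ n → f n ≡ g n

  _≈[_]_ : Ser → ℕ → Ser → Set
  f ≈[ n ] g = ∀ j → j ≤ n → f j ≡ g j

  tail : Ser → Ser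
  tail f n = f (suc n)

  𝟘 𝟙 : Ser
  𝟘 _ = false
  𝟙 zero = true
  𝟙 (suc _) = false

  _⊕_ : Ser → Ser → Ser
  (f ⊕ g) n = f n xor g n

  -- The Cauchy product through f = f 0 + q (tail f), a structural recursion that makes the ring
  -- laws short inductions.
  _·_ : Ser → Ser → Ser
  (f · g) zero = f 0 ∧ g 0
  (f · g) (suc n) = (f 0 ∧ g (suc n)) xor (tail f · g) n

  xor-interchange : ∀ a b c d → (a xor b) xor (c xor d) ≡ (a xor c) xor (b xor d)
  xor-interchange a b c d = trans (xor-assoc a b (c xor d)) (trans (cong (a xor_) (trans (sym (xor-assoc b c d)) (trans (cong (_xor d) (xor-comm b c)) (xor-assoc c b d)))) (sym (xor-assoc a c (b xor d))))

  ·-cong[] : ∀ n {f f' g g'} → f ≈[ n ] f' → g ≈[ n ] g' → (f · g) n ≡ (f' · g') n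
  ·-cong[] zero e e' = cong₂ _∧_ (e 0 z≤n) (e' 0 z≤n)
  ·-cong[] (suc n) e e' = cong₂ _xor_ (cong₂ _∧_ (e 0 z≤n) (e' (suc n) ≤-refl))
    (·-cong[] n (λ j j≤n → e (suc j) (s≤s j≤n)) (λ j j≤n → e' j (m≤n⇒m≤1+n j≤n)))

  ·-cong : ∀ {f f' g g'} → f ≈ f' → g ≈ g' → f · g ≈ f' · g'
  ·-cong e e' n = ·-cong[] n (λ j _ → e j) (λ j _ → e' j)

  ·-≈[] : ∀ {n f f' g g'} → f ≈[ n ] f' → g ≈[ n ] g' → f · g ≈[ n ] f' · g'
  ·-≈[] e e' j j≤n = ·-cong[] j (λ i i≤j → e i (≤-trans i≤j j≤n)) (λ i i≤j → e' i (≤-trans i≤j j≤n))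

  ·-distribʳ : ∀ h f g → (f ⊕ g) · h ≈ f · h ⊕ g · h
  ·-distribʳ h f g zero = ∧-distribʳ-xor (h 0) (f 0) (g 0)
  ·-distribʳ h f g (suc n) = trans (cong₂ _xor_ (∧-distribʳ-xor (h (suc n)) (f 0) (g 0)) (·-distribʳ h (tail f) (tail g) n))
    (xor-interchange (f 0 ∧ h (suc n)) (g 0 ∧ h (suc n)) _ _)

  ·-sucʳ : ∀ n f g → (f · g) (suc n) ≡ (f · tail g) n xor (f (suc n) ∧ g 0)
  ·-sucʳ zero f g = refl
  ·-sucʳ (suc n) f g = trans (cong ((f 0 ∧ g (suc (suc n))) xor_) (·-sucʳ n (tail f) g)) (sym (xor-assoc (f 0 ∧ g (suc (suc n))) _ _))

  ·-comm : ∀ f g → f · g ≈ g · f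
  ·-comm f g zero = ∧-comm (f 0) (g 0)
  ·-comm f g (suc n) = trans (xor-comm (f 0 ∧ g (suc n)) _) (trans (cong₂ _xor_ (·-comm (tail f) g n) (∧-comm (f 0) (g (suc n)))) (sym (·-sucʳ n g f)))

  ·-distribˡ : ∀ h f g → h · (f ⊕ g) ≈ h · f ⊕ h · g
  ·-distribˡ h f g n = trans (·-comm h (f ⊕ g) n) (trans (·-distribʳ h f g n) (cong₂ _xor_ (·-comm f h n) (·-comm g h n)))

  ·-scalar : ∀ b f g n → ((λ k → b ∧ f k) · g) n ≡ b ∧ (f · g) n
  ·-scalar b f g zero = ∧-assoc b (f 0) (g 0)
  ·-scalar b f g (suc n) = trans (cong₂ _xor_ (∧-assoc b (f 0) (g (suc n))) (·-scalar b (tail f) g n)) (sym (∧-distribˡ-xor b (f 0 ∧ g (suc n)) ((tail f · g) n)))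

  ·-assoc : ∀ f g h → (f · g) · h ≈ f · (g · h)
  ·-assoc f g h zero = ∧-assoc (f 0) (g 0) (h 0)
  ·-assoc f g h (suc n) = begin
    ((f 0 ∧ g 0) ∧ h (suc n)) xor (((λ k → f 0 ∧ g (suc k)) ⊕ tail f · g) · h) n
      ≡⟨ cong₂ _xor_ (∧-assoc (f 0) (g 0) (h (suc n))) (·-distribʳ h (λ k → f 0 ∧ g (suc k)) (tail f · g) n) ⟩
    (f 0 ∧ (g 0 ∧ h (suc n))) xor (((λ k → f 0 ∧ g (suc k)) · h) n xor ((tail f · g) · h) n)
      ≡⟨ cong₂ (λ x y → (f 0 ∧ (g 0 ∧ h (suc n))) xor (x xor y)) (·-scalar (f 0) (tail g) h n) (·-assoc (tail f) g h n) ⟩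
    (f 0 ∧ (g 0 ∧ h (suc n))) xor ((f 0 ∧ (tail g · h) n) xor (tail f · (g · h)) n)
      ≡⟨ sym (xor-assoc (f 0 ∧ (g 0 ∧ h (suc n))) _ _) ⟩
    ((f 0 ∧ (g 0 ∧ h (suc n))) xor (f 0 ∧ (tail g · h) n)) xor (tail f · (g · h)) n
      ≡⟨ cong (_xor (tail f · (g · h)) n) (sym (∧-distribˡ-xor (f 0) (g 0 ∧ h (suc n)) ((tail g · h) n))) ⟩
    (f · (g · h)) (suc n) ∎
    where open ≡-Reasoning

  ·-zeroˡ : ∀ f → 𝟘 · f ≈ 𝟘
  ·-zeroˡ f zero = refl
  ·-zeroˡ f (suc n) = ·-zeroˡ f n

  ·-identityˡ : ∀ f → 𝟙 · f ≈ f
  ·-identityˡ f zero = refl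
  ·-identityˡ f (suc n) = trans (cong (f (suc n) xor_) (·-zeroˡ f n)) (xor-identityʳ (f (suc n)))

  ≈-refl : ∀ {f} → f ≈ f
  ≈-refl n = refl

  ≈-sym : ∀ {f g} → f ≈ g → g ≈ f
  ≈-sym e n = sym (e n)

  ≈-trans : ∀ {f g h} → f ≈ g → g ≈ h → f ≈ h
  ≈-trans e e' n = trans (e n) (e' n)

  seriesRing : CommutativeRing 0ℓ 0ℓ
  seriesRing = record
    { Carrier = Ser ; _≈_ = _≈_ ; _+_ = _⊕_ ; _*_ = _·_ ; -_ = λ f → f ; 0# = 𝟘 ; 1# = 𝟙
    ; isCommutativeRing = record
      { isRing = record
        { +-isAbelianGroup = record
          { isGroup = record
            { isMonoid = record
              { isSemigroup = record
                { isMagma = record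
                  { isEquivalence = record { refl = ≈-refl ; sym = ≈-sym ; trans = ≈-trans }
                  ; ∙-cong = λ e e' n → cong₂ _xor_ (e n) (e' n) }
                ; assoc = λ f g h n → xor-assoc (f n) (g n) (h n) }
              ; identity = (λ f n → refl) , (λ f n → xor-identityʳ (f n)) }
            ; inverse = (λ f n → xor-same (f n)) , (λ f n → xor-same (f n))
            ; ⁻¹-cong = λ e → e }
          ; comm = λ f g n → xor-comm (f n) (g n) }
        ; *-cong = ·-cong
        ; *-assoc = ·-assoc
        ; *-identity = ·-identityˡ , (λ f → ≈-trans (·-comm f 𝟙) (·-identityˡ f))
        ; distrib = ·-distribˡ , ·-distribʳ }
      ; *-comm = ·-comm } }

  private
    solverRing : AlmostCommutativeRing 0ℓ 0ℓ
    solverRing = fromCommutativeRing seriesRing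

    constant : Bool → Ser
    constant true = 𝟙
    constant false = 𝟘

    coefficients : CommutativeRing.rawRing xor-∧-commutativeRing -Raw-AlmostCommutative⟶ solverRing
    coefficients = record
      { ⟦_⟧ = constant
      ; +-homo = λ { true true n → sym (xor-same (𝟙 n)) ; true false n → sym (xor-identityʳ (𝟙 n)) ; false y n → refl }
      ; *-homo = λ { true y n → sym (·-identityˡ (constant y) n) ; false y n → sym (·-zeroˡ (constant y) n) }
      ; -‿homo = λ x n → refl
      ; 0-homo = λ n → refl
      ; 1-homo = λ n → refl }

    coefficient-≟ : ∀ x y → Maybe (constant x ≈ constant y)
    coefficient-≟ true true = just (λ n → refl)
    coefficient-≟ false false = just (λ n → refl)
    coefficient-≟ _ _ = nothing

  -- Its coefficients live in 𝔽₂, so that f ⊕ f cancels.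
  module SeriesSolver = Algebra.Solver.Ring (CommutativeRing.rawRing xor-∧-commutativeRing) solverRing coefficients coefficient-≟

  mono : ℕ → Ser
  mono zero = 𝟙
  mono (suc a) zero = false
  mono (suc a) (suc n) = mono a n

  mono-+ : ∀ a b → mono a · mono b ≈ mono (a ℕ.+ b)
  mono-+ zero b = ·-identityˡ (mono b)
  mono-+ (suc a) b zero = refl
  mono-+ (suc a) b (suc n) = mono-+ a b n

  mono-below : ∀ a f n → n < a → (mono a · f) n ≡ false
  mono-below (suc a) f zero _ = refl
  mono-below (suc a) f (suc n) (s≤s n<a) = mono-below a f n n<a

  mono-shift : ∀ a f n → (mono a · f) (a ℕ.+ n) ≡ f n
  mono-shift zero f n = ·-identityˡ f n
  mono-shift (suc a) f n = mono-shift a f n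

  double : ℕ → ℕ
  double zero = zero
  double (suc n) = suc (suc (double n))

  double≡2* : ∀ n → double n ≡ 2 ℕ.* n
  double≡2* zero = refl
  double≡2* (suc n) = trans (cong (λ z → suc (suc z)) (double≡2* n)) (cong suc (sym (+-suc n (n ℕ.+ 0))))

  even odd : Ser → Ser
  even f n = f (double n)
  odd f n = f (suc (double n))

  dilate : Ser → Ser
  dilate g zero = g 0
  dilate g (suc zero) = false
  dilate g (suc (suc n)) = dilate (tail g) n

  dilate-double : ∀ g n → dilate g (double n) ≡ g n
  dilate-double g zero = refl
  dilate-double g (suc n) = dilate-double (tail g) n

  dilate-odd : ∀ g n → dilate g (suc (double n)) ≡ false
  dilate-odd g zero = refl
  dilate-odd g (suc n) = dilate-odd (tail g) n

  ·-sucsucʳ : ∀ n f g → (f · dilate g) (suc (suc n)) ≡ (f · dilate (tail g)) n xor (f (suc (suc n)) ∧ g 0)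
  ·-sucsucʳ n f g = trans (·-sucʳ (suc n) f (dilate g)) (cong (_xor (f (suc (suc n)) ∧ g 0))
    (trans (·-sucʳ n f (tail (dilate g))) (trans (cong ((f · dilate (tail g)) n xor_) (∧-zeroʳ (f (suc n)))) (xor-identityʳ ((f · dilate (tail g)) n)))))

  -- A factor in q² preserves the parity of exponents. This is what carries `P 4` through the
  -- sections of G.
  even-· : ∀ f g → even (f · dilate g) ≈ even f · g
  even-· f g zero = refl
  even-· f g (suc n) = trans (·-sucsucʳ (double n) f g) (trans (cong (_xor (f (double (suc n)) ∧ g 0)) (even-· f (tail g) n)) (sym (·-sucʳ n (even f) g)))

  odd-· : ∀ f g → odd (f · dilate g) ≈ odd f · g
  odd-· f g zero = cong (_xor (f 1 ∧ g 0)) (∧-zeroʳ (f 0))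
  odd-· f g (suc n) = trans (·-sucsucʳ (suc (double n)) f g) (trans (cong (_xor (f (suc (double (suc n))) ∧ g 0)) (odd-· f (tail g) n)) (sym (·-sucʳ n (odd f) g)))

  -- Frobenius: the terms f i f j and f j f i cancel. The induction removes the two outermost ones,
  -- f 0 f (n + 2) from either end.
  square : ∀ f → f · f ≈ dilate f
  square f zero = ∧-idem (f 0)
  square f (suc zero) = trans (cong ((f 0 ∧ f 1) xor_) (∧-comm (f 1) (f 0))) (xor-same (f 0 ∧ f 1))
  square f (suc (suc n)) = begin
    (f 0 ∧ f (2 ℕ.+ n)) xor (tail f · f) (suc n)                                  ≡⟨ cong ((f 0 ∧ f (2 ℕ.+ n)) xor_) (·-sucʳ n (tail f) f) ⟩
    (f 0 ∧ f (2 ℕ.+ n)) xor ((tail f · tail f) n xor (f (2 ℕ.+ n) ∧ f 0))          ≡⟨ cong ((f 0 ∧ f (2 ℕ.+ n)) xor_) (trans (xor-comm ((tail f · tail f) n) _) (cong (_xor (tail f · tail f) n) (∧-comm (f (2 ℕ.+ n)) (f 0)))) ⟩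
    (f 0 ∧ f (2 ℕ.+ n)) xor ((f 0 ∧ f (2 ℕ.+ n)) xor (tail f · tail f) n)          ≡⟨ sym (xor-assoc (f 0 ∧ f (2 ℕ.+ n)) _ _) ⟩
    ((f 0 ∧ f (2 ℕ.+ n)) xor (f 0 ∧ f (2 ℕ.+ n))) xor (tail f · tail f) n          ≡⟨ cong (_xor (tail f · tail f) n) (xor-same (f 0 ∧ f (2 ℕ.+ n))) ⟩
    (tail f · tail f) n                                                           ≡⟨ square (tail f) n ⟩
    dilate f (suc (suc n)) ∎
    where open ≡-Reasoning

  -- The lowest coefficient of d survives in d h, so the coefficients vanish one after another. The
  -- truncated form is needed because finite products agree with theta series only up to a degree.
  annihilate : ∀ n h → h 0 ≡ true → ∀ d → (∀ j → j ≤ n → (d · h) j ≡ false) → ∀ j → j ≤ n → d j ≡ false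
  annihilate n h h0 d z zero _ = trans (sym (∧-identityʳ (d 0))) (trans (cong (d 0 ∧_) (sym h0)) (z 0 z≤n))
  annihilate (suc n) h h0 d z (suc j) (s≤s j≤n) = annihilate n h h0 (tail d)
    (λ i i≤n → trans (cong (λ b → (b ∧ h (suc i)) xor (tail d · h) i) (sym (annihilate (suc n) h h0 d z 0 z≤n))) (z (suc i) (s≤s i≤n))) j j≤n

  xor-false⇒≡ : ∀ a b → a xor b ≡ false → a ≡ b
  xor-false⇒≡ true true _ = refl
  xor-false⇒≡ false false _ = refl

  ·-cancelʳ-≈[] : ∀ {n f g} h → h 0 ≡ true → f · h ≈[ n ] g · h → f ≈[ n ] g
  ·-cancelʳ-≈[] {n} {f} {g} h h0 e j j≤n = xor-false⇒≡ (f j) (g j) (annihilate n h h0 (f ⊕ g)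
    (λ i i≤n → trans (·-distribʳ h f g i) (trans (cong (_xor (g · h) i) (e i i≤n)) (xor-same ((g · h) i)))) j j≤n)

  ·-cancelʳ : ∀ {f g} h → h 0 ≡ true → f · h ≈ g · h → f ≈ g
  ·-cancelʳ h h0 e n = ·-cancelʳ-≈[] {n} h h0 (λ j _ → e j) n ≤-refl

  isOdd : ℕ → Bool
  isOdd zero = false
  isOdd (suc n) = not (isOdd n)

  not-xorˡ : ∀ a b → not a xor b ≡ not (a xor b)
  not-xorˡ true true = refl
  not-xorˡ true false = refl
  not-xorˡ false true = refl
  not-xorˡ false false = refl

  isOdd-+ : ∀ m n → isOdd (m ℕ.+ n) ≡ isOdd m xor isOdd n
  isOdd-+ zero n = refl
  isOdd-+ (suc m) n = trans (cong not (isOdd-+ m n)) (sym (not-xorˡ (isOdd m) (isOdd n)))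

  isOdd-* : ∀ m n → isOdd (m ℕ.* n) ≡ isOdd m ∧ isOdd n
  isOdd-* zero n = refl
  isOdd-* (suc m) n = trans (isOdd-+ n (m ℕ.* n)) (trans (cong (isOdd n xor_) (isOdd-* m n)) (lem (isOdd m) (isOdd n)))
    where
    lem : ∀ a b → b xor (a ∧ b) ≡ not a ∧ b
    lem true true = refl
    lem true false = refl
    lem false b = xor-identityʳ b

  isOdd-⊖ : ∀ m n → isOdd ∣ m ℤ.⊖ n ∣ ≡ isOdd m xor isOdd n
  isOdd-⊖ zero zero = refl
  isOdd-⊖ zero (suc n) = refl
  isOdd-⊖ (suc m) zero = sym (xor-identityʳ _)
  isOdd-⊖ (suc m) (suc n) = trans (cong (λ z → isOdd ∣ z ∣) (ℤP.[1+m]⊖[1+n]≡m⊖n m n)) (trans (isOdd-⊖ m n) (lem (isOdd m) (isOdd n)))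
    where
    lem : ∀ a b → a xor b ≡ not a xor not b
    lem true true = refl
    lem true false = refl
    lem false true = refl
    lem false false = refl

  odd? : ℤ → Bool
  odd? z = isOdd ∣ z ∣

  odd?-+ : ∀ a b → odd? (a ℤ.+ b) ≡ odd? a xor odd? b
  odd?-+ (+ m) (+ n) = isOdd-+ m n
  odd?-+ (+ m) -[1+ n ] = isOdd-⊖ m (suc n)
  odd?-+ -[1+ m ] (+ n) = trans (isOdd-⊖ n (suc m)) (xor-comm (isOdd n) _)
  odd?-+ -[1+ m ] -[1+ n ] = trans (cong isOdd (cong suc (sym (+-suc m n)))) (isOdd-+ (suc m) (suc n))

  odd?-* : ∀ a b → odd? (a ℤ.* b) ≡ odd? a ∧ odd? b
  odd?-* a b = trans (cong isOdd (ℤP.abs-* a b)) (isOdd-* ∣ a ∣ ∣ b ∣)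

  odd?-neg : ∀ a → odd? (ℤ.- a) ≡ odd? a
  odd?-neg a = cong isOdd (ℤP.∣-i∣≡∣i∣ a)

  mod2 : Series → Ser
  mod2 f n = odd? (f n)

  mod2-⊛ : ∀ f g → mod2 (f ⊛ g) ≈ mod2 f · mod2 g
  mod2-⊛ f g n = trans (cong (λ l → odd? (sumℤ l)) (map-applyUpTo (λ j → j) (λ j → f j ℤ.* g (n ∸ j)) (suc n))) (go n f)
    where
    go : ∀ n f → odd? (sumℤ (applyUpTo (λ j → f j ℤ.* g (n ∸ j)) (suc n))) ≡ (mod2 f · mod2 g) n
    go zero f = trans (odd?-+ (f 0 ℤ.* g 0) (+ 0)) (trans (xor-identityʳ _) (odd?-* (f 0) (g 0)))
    go (suc n) f = trans (odd?-+ (f 0 ℤ.* g (suc n)) _) (cong₂ _xor_ (odd?-* (f 0) (g (suc n))) (go n (λ j → f (suc j))))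

  mod2-δ : ∀ a → mod2 (δ a) ≈ mono a
  mod2-δ zero zero = refl
  mod2-δ zero (suc n) = refl
  mod2-δ (suc a) zero = refl
  mod2-δ (suc a) (suc n) with suc n ℕ.≟ suc a | n ℕ.≟ a | mod2-δ a n
  ... | yes _ | yes _ | e = e
  ... | no _ | no _ | e = e
  ... | yes refl | no ne | _ = ⊥-elim (ne refl)
  ... | no ne | yes refl | _ = ⊥-elim (ne refl)

  binomial : ℕ → Ser
  binomial a = 𝟙 ⊕ mono a

  mod2-onePlus : ∀ a → mod2 (onePlus a) ≈ binomial a
  mod2-onePlus a n = trans (odd?-+ (δ 0 n) (δ a n)) (cong₂ _xor_ (mod2-δ 0 n) (mod2-δ a n))

  mod2-oneMinus : ∀ a → mod2 (oneMinus a) ≈ binomial a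
  mod2-oneMinus a n = trans (odd?-+ (δ 0 n) (ℤ.- δ a n)) (cong₂ _xor_ (mod2-δ 0 n) (trans (odd?-neg (δ a n)) (mod2-δ a n)))

  geom-inverse : ∀ m' → mod2 (geom m') · binomial (suc m') ≈ 𝟙
  geom-inverse m' n = trans (·-comm (mod2 (geom m')) (binomial (suc m')) n)
    (trans (·-distribʳ (mod2 (geom m')) 𝟙 (mono (suc m')) n)
    (trans (cong (_xor (mono (suc m') · mod2 (geom m')) n) (·-identityˡ (mod2 (geom m')) n)) (go n)))
    where
    g = mod2 (geom m')
    small : ∀ n → n < suc m' → g n ≡ 𝟙 n
    small zero _ = refl
    small (suc n) lt rewrite m<n⇒m%n≡m lt = refl
    big : ∀ n → g (suc m' ℕ.+ n) ≡ g n
    big n rewrite trans (cong (_% suc m') (+-comm (suc m') n)) ([m+n]%n≡m%n n (suc m')) = refl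
    go : ∀ n → g n xor (mono (suc m') · g) n ≡ 𝟙 n
    go n with <-≤-connex n (suc m')
    ... | inj₁ lt = trans (cong₂ _xor_ (small n lt) (mono-below (suc m') g n lt)) (xor-identityʳ (𝟙 n))
    ... | inj₂ ge with m≤n⇒∃[o]m+o≡n ge
    ...   | o , refl = trans (cong₂ _xor_ (big o) (mono-shift (suc m') g o)) (xor-same (g o))

  module ≈-Reasoning = Relation.Binary.Reasoning.Setoid (CommutativeRing.setoid seriesRing)

  ≡⇒≈ : ∀ {A : Set} (h : A → Ser) {a b} → a ≡ b → h a ≈ h b
  ≡⇒≈ h refl n = refl

  ⊕-cong : ∀ {f f' g g'} → f ≈ f' → g ≈ g' → f ⊕ g ≈ f' ⊕ g'
  ⊕-cong e e' n = cong₂ _xor_ (e n) (e' n)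

  ⊕-same : ∀ f → f ⊕ f ≈ 𝟘
  ⊕-same f n = xor-same (f n)

-- The generating function and finite Euler products

module EulerProduct where

  open Series
  open import Defs
  open import Data.Nat as ℕ using (ℕ; zero; suc; _≤_; _<_; z≤n; s≤s; _∸_; _+_; _*_; _≤?_)
  open import Data.Nat.Properties
  open import Data.Nat.Tactic.RingSolver using (solve-∀)
  open import Data.Bool using (true; false; _xor_)
  open import Data.Bool.Properties using (xor-assoc; xor-comm; xor-identityʳ; xor-same)
  open import Data.Empty using (⊥-elim)
  open import Relation.Nullary
  open import Relation.Binary.PropositionalEquality
  open SeriesSolver using (solve; _:*_; _:+_; _:=_; con)

  euler : ℕ → ℕ → Ser
  euler i zero = 𝟙
  euler i (suc n) = euler i n · binomial (i * suc n)

  numerator : ℕ → ℕ → Ser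
  numerator i zero = 𝟙
  numerator i (suc n) = numerator i n · (binomial (4 * i * suc n) · (binomial (4 * i * n + i) · binomial (4 * i * suc n ∸ i)))

  partialProd-euler : ∀ i n → mod2 (partialProd (4 * i) i n) · euler 1 n ≈ numerator i n
  partialProd-euler i zero = ≈-trans (·-cong (mod2-δ 0) ≈-refl) (·-identityˡ 𝟙)
  partialProd-euler i (suc n) = begin
    mod2 (partialProd (4 * i) i n ⊛ factor (4 * i) i n) · (euler 1 n · binomial (1 * suc n))
      ≈⟨ ·-cong (≈-trans (mod2-⊛ (partialProd (4 * i) i n) (factor (4 * i) i n)) (·-cong (≈-refl {X}) factor≈)) (·-cong (≈-refl {euler 1 n}) (≡⇒≈ binomial (+-identityʳ (suc n)))) ⟩
    (X · (a · (b · (c · g)))) · (euler 1 n · binomial (suc n))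
      ≈⟨ shuffle X a b c g (euler 1 n) (binomial (suc n)) ⟩
    ((X · euler 1 n) · (a · (b · c))) · (g · binomial (suc n))
      ≈⟨ ·-cong (·-cong (partialProd-euler i n) (≈-refl {a · (b · c)})) (geom-inverse n) ⟩
    (numerator i n · (a · (b · c))) · 𝟙
      ≈⟨ unit (numerator i n · (a · (b · c))) ⟩
    numerator i (suc n) ∎
    where
    open ≈-Reasoning
    X a b c g : Ser
    X = mod2 (partialProd (4 * i) i n)
    a = binomial (4 * i * suc n)
    b = binomial (4 * i * n + i)
    c = binomial (4 * i * suc n ∸ i)
    g = mod2 (geom n)
    factor≈ : mod2 (factor (4 * i) i n) ≈ a · (b · (c · g))
    factor≈ = ≈-trans (mod2-⊛ (oneMinus (4 * i * suc n)) (onePlus (4 * i * n + i) ⊛ (onePlus (4 * i * suc n ∸ i) ⊛ geom n))) (·-cong (mod2-oneMinus (4 * i * suc n))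
      (≈-trans (mod2-⊛ (onePlus (4 * i * n + i)) (onePlus (4 * i * suc n ∸ i) ⊛ geom n)) (·-cong (mod2-onePlus (4 * i * n + i))
        (≈-trans (mod2-⊛ (onePlus (4 * i * suc n ∸ i)) (geom n)) (·-cong (mod2-onePlus (4 * i * suc n ∸ i)) (≈-refl {g}))))))
    shuffle : ∀ X a b c g e h → (X · (a · (b · (c · g)))) · (e · h) ≈ ((X · e) · (a · (b · c))) · (g · h)
    shuffle = solve 7 (λ X a b c g e h → (X :* (a :* (b :* (c :* g)))) :* (e :* h) := ((X :* e) :* (a :* (b :* c))) :* (g :* h)) ≈-refl
    unit : ∀ X → X · 𝟙 ≈ X
    unit = solve 1 (λ X → X :* con true := X) ≈-refl

  -- The numerator supplies the multiples of i in the classes 0, 1, 3 mod 4 and `euler (2 * i)`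
  -- those in the classes 0, 2. Together they give every class once and class 0 a second time.
  numerator-euler : ∀ i n → numerator i n · euler (2 * i) (2 * n) ≈ euler i (4 * n) · euler (4 * i) n
  numerator-euler i zero = ≈-refl
  numerator-euler i (suc n) = begin
    (numerator i n · (x₄ · (binomial (4 * i * n + i) · binomial (4 * i * suc n ∸ i)))) · euler (2 * i) (2 * suc n)
      ≈⟨ ·-cong (·-cong (≈-refl {numerator i n}) (·-cong (≈-refl {x₄}) (·-cong (≡⇒≈ binomial e₁) (≡⇒≈ binomial e₃)))) (≈-trans (≡⇒≈ (euler (2 * i)) (d₂ n)) (·-cong (·-cong (≈-refl {euler (2 * i) (2 * n)}) (≡⇒≈ binomial e₂)) (≡⇒≈ binomial e₂'))) ⟩
    (numerator i n · (x₄ · (x₁ · x₃))) · ((euler (2 * i) (2 * n) · x₂) · x₄)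
      ≈⟨ shuffle (numerator i n) (euler (2 * i) (2 * n)) x₁ x₂ x₃ x₄ ⟩
    (numerator i n · euler (2 * i) (2 * n)) · ((((x₁ · x₂) · x₃) · x₄) · x₄)
      ≈⟨ ·-cong (numerator-euler i n) ≈-refl ⟩
    (euler i (4 * n) · euler (4 * i) n) · ((((x₁ · x₂) · x₃) · x₄) · x₄)
      ≈⟨ shuffle' (euler i (4 * n)) (euler (4 * i) n) x₁ x₂ x₃ x₄ ⟩
    ((((euler i (4 * n) · x₁) · x₂) · x₃) · x₄) · (euler (4 * i) n · x₄)
      ≈⟨ ·-cong (·-cong (·-cong (·-cong (·-cong (≈-refl {euler i (4 * n)}) (≡⇒≈ binomial f₁)) (≡⇒≈ binomial f₂)) (≡⇒≈ binomial f₃)) (≡⇒≈ binomial f₄)) ≈-refl ⟩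
    euler i (4 + 4 * n) · euler (4 * i) (suc n)
      ≈⟨ ·-cong (≡⇒≈ (euler i) (sym (*-suc 4 n))) ≈-refl ⟩
    euler i (4 * suc n) · euler (4 * i) (suc n) ∎
    where
    open ≈-Reasoning
    x₁ x₂ x₃ x₄ : Ser
    x₁ = binomial (i + 4 * i * n)
    x₂ = binomial (2 * i + 4 * i * n)
    x₃ = binomial (3 * i + 4 * i * n)
    x₄ = binomial (4 * i * suc n)
    d₂ : ∀ n → 2 * suc n ≡ 2 + 2 * n
    d₂ = *-suc 2
    e₁ : 4 * i * n + i ≡ i + 4 * i * n
    e₁ = +-comm (4 * i * n) i
    e₃ : 4 * i * suc n ∸ i ≡ 3 * i + 4 * i * n
    e₃ = trans (cong (_∸ i) (eq i n)) (m+n∸n≡m (3 * i + 4 * i * n) i)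
      where
      eq : ∀ i n → 4 * i * suc n ≡ 3 * i + 4 * i * n + i
      eq = solve-∀
    e₂ : 2 * i * suc (2 * n) ≡ 2 * i + 4 * i * n
    e₂ = eq i n
      where
      eq : ∀ i n → 2 * i * suc (2 * n) ≡ 2 * i + 4 * i * n
      eq = solve-∀
    e₂' : 2 * i * suc (suc (2 * n)) ≡ 4 * i * suc n
    e₂' = eq i n
      where
      eq : ∀ i n → 2 * i * suc (suc (2 * n)) ≡ 4 * i * suc n
      eq = solve-∀
    f₁ : i + 4 * i * n ≡ i * suc (4 * n)
    f₁ = eq i n
      where
      eq : ∀ i n → i + 4 * i * n ≡ i * suc (4 * n)
      eq = solve-∀
    f₂ : 2 * i + 4 * i * n ≡ i * suc (suc (4 * n))
    f₂ = eq i n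
      where
      eq : ∀ i n → 2 * i + 4 * i * n ≡ i * suc (suc (4 * n))
      eq = solve-∀
    f₃ : 3 * i + 4 * i * n ≡ i * suc (suc (suc (4 * n)))
    f₃ = eq i n
      where
      eq : ∀ i n → 3 * i + 4 * i * n ≡ i * suc (suc (suc (4 * n)))
      eq = solve-∀
    f₄ : 4 * i * suc n ≡ i * suc (suc (suc (suc (4 * n))))
    f₄ = eq i n
      where
      eq : ∀ i n → 4 * i * suc n ≡ i * suc (suc (suc (suc (4 * n))))
      eq = solve-∀
    shuffle : ∀ N E a b c d → (N · (d · (a · c))) · ((E · b) · d) ≈ (N · E) · ((((a · b) · c) · d) · d)
    shuffle = solve 6 (λ N E a b c d → (N :* (d :* (a :* c))) :* ((E :* b) :* d) := (N :* E) :* ((((a :* b) :* c) :* d) :* d)) ≈-refl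
    shuffle' : ∀ N E a b c d → (N · E) · ((((a · b) · c) · d) · d) ≈ ((((N · a) · b) · c) · d) · (E · d)
    shuffle' = solve 6 (λ N E a b c d → (N :* E) :* ((((a :* b) :* c) :* d) :* d) := ((((N :* a) :* b) :* c) :* d) :* (E :* d)) ≈-refl

  -- Shanks' finite form of the pentagonal number theorem, mod 2

  tri : ℕ → ℕ
  tri zero = 0
  tri (suc n) = suc n + tri n

  ⨁ : ℕ → (ℕ → Ser) → Ser
  ⨁ zero h = 𝟘
  ⨁ (suc n) h = ⨁ n h ⊕ h n

  ⨁-cong : ∀ n {h h'} → (∀ s → s < n → h s ≈ h' s) → ⨁ n h ≈ ⨁ n h'
  ⨁-cong zero e = ≈-refl
  ⨁-cong (suc n) e = ⊕-cong (⨁-cong n λ s lt → e s (m<n⇒m<1+n lt)) (e n ≤-refl)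

  ⨁-⊕ : ∀ n h h' → ⨁ n (λ s → h s ⊕ h' s) ≈ ⨁ n h ⊕ ⨁ n h'
  ⨁-⊕ zero h h' k = refl
  ⨁-⊕ (suc n) h h' = ≈-trans (⊕-cong (⨁-⊕ n h h') ≈-refl) (λ k → xor-interchange (⨁ n h k) (⨁ n h' k) (h n k) (h' n k))

  ⨁-head : ∀ n h → ⨁ (suc n) h ≈ h 0 ⊕ ⨁ n (λ s → h (suc s))
  ⨁-head zero h k = xor-comm false (h 0 k)
  ⨁-head (suc n) h k = trans (cong (_xor h (suc n) k) (⨁-head n h k)) (xor-assoc (h 0 k) _ _)

  module Pentagonal (i : ℕ) where

    x^ : ℕ → Ser
    x^ a = mono (i * a)

    -- ∏_{s < m ≤ n} (1 + q^{im})
    R : ℕ → ℕ → Ser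
    R s zero = 𝟙
    R s (suc n) with s ≤? n
    ... | yes _ = R s n · binomial (i * suc n)
    ... | no _ = 𝟙

    R-last : ∀ {s n} → s ≤ n → R s (suc n) ≈ R s n · binomial (i * suc n)
    R-last {s} {n} s≤n with s ≤? n
    ... | yes _ = ≈-refl
    ... | no ¬le = ⊥-elim (¬le s≤n)

    R-diag : ∀ n → R n n ≈ 𝟙
    R-diag zero = ≈-refl
    R-diag (suc n) with suc n ≤? n
    ... | yes lt = ⊥-elim (<-irrefl refl lt)
    ... | no _ = ≈-refl

    R-first : ∀ {s n} → s < n → R s n ≈ R (suc s) n · binomial (i * suc s)
    R-first {s} {suc n} (s≤s s≤n) with s ≟ n
    ... | yes refl = ≈-trans (R-last s≤n) (·-cong (≈-trans (R-diag n) (≈-sym (R-diag (suc n)))) ≈-refl)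
    ... | no s≢n = ≈-trans (R-last s≤n) (≈-trans (·-cong (R-first lt) ≈-refl) (≈-trans (swap (R (suc s) n) (binomial (i * suc s)) (binomial (i * suc n))) (·-cong (≈-sym (R-last lt)) ≈-refl)))
      where
      lt = ≤∧≢⇒< s≤n s≢n
      swap : ∀ a b c → (a · b) · c ≈ (a · c) · b
      swap = solve 3 (λ a b c → (a :* b) :* c := (a :* c) :* b) ≈-refl

    R-euler : ∀ n → R 0 n ≈ euler i n
    R-euler zero = ≈-refl
    R-euler (suc n) = ≈-trans (R-last z≤n) (·-cong (R-euler n) ≈-refl)

    F : ℕ → Ser
    F n = ⨁ (suc n) λ s → x^ (s * n + tri s) · R s n

    private
      X Y : ℕ → ℕ → Ser
      X n s = x^ (s * suc n + tri s) · R s n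
      Y n s = x^ (suc s * suc n + tri s) · R s n

    x^-+ : ∀ a b → x^ a · x^ b ≈ x^ (a + b)
    x^-+ a b = ≈-trans (mono-+ (i * a) (i * b)) (≡⇒≈ mono (sym (*-distribˡ-+ i a b)))

    -- Splitting off the last factor of R s (n + 1) turns the terms of F (n + 1) into X + Y. Adding
    -- F n to the X and restoring the first factor of R s n gives Y back, shifted by one in s, so
    -- that only the end terms survive.
    F-step : ∀ n → F (suc n) ⊕ F n ≈ x^ (suc n * suc n + tri n) ⊕ x^ (suc n * suc n + tri (suc n))
    F-step n = begin
      (⨁ (suc n) (λ s → x^ (s * suc n + tri s) · R s (suc n)) ⊕ x^ (suc n * suc n + tri (suc n)) · R (suc n) (suc n)) ⊕ F n
        ≈⟨ ⊕-cong (⊕-cong (≈-trans (⨁-cong (suc n) λ s lt → top s (≤-pred lt)) (⨁-⊕ (suc n) (X n) (Y n))) last) ≈-refl ⟩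
      ((⨁ (suc n) (X n) ⊕ ⨁ (suc n) (Y n)) ⊕ e₂) ⊕ F n
        ≈⟨ reorder (⨁ (suc n) (X n)) (⨁ (suc n) (Y n)) e₂ (F n) ⟩
      (F n ⊕ ⨁ (suc n) (X n)) ⊕ (⨁ (suc n) (Y n) ⊕ e₂)
        ≈⟨ ⊕-cong telescope ≈-refl ⟩
      ⨁ n (Y n) ⊕ ((⨁ n (Y n) ⊕ Y n n) ⊕ e₂)
        ≈⟨ reorder' (⨁ n (Y n)) (Y n n) e₂ ⟩
      (⨁ n (Y n) ⊕ ⨁ n (Y n)) ⊕ (Y n n ⊕ e₂)
        ≈⟨ ⊕-cong (⊕-same (⨁ n (Y n))) (⊕-cong (≈-trans (·-cong (≈-refl {x^ (suc n * suc n + tri n)}) (R-diag n)) (unit (x^ (suc n * suc n + tri n)))) ≈-refl) ⟩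
      𝟘 ⊕ (x^ (suc n * suc n + tri n) ⊕ e₂)
        ≈⟨ ≈-refl ⟩
      x^ (suc n * suc n + tri n) ⊕ e₂ ∎
      where
      open ≈-Reasoning
      e₂ : Ser
      e₂ = x^ (suc n * suc n + tri (suc n))
      unit : ∀ X → X · 𝟙 ≈ X
      unit = solve 1 (λ X → X :* con true := X) ≈-refl
      last : x^ (suc n * suc n + tri (suc n)) · R (suc n) (suc n) ≈ e₂
      last = ≈-trans (·-cong (≈-refl {e₂}) (R-diag (suc n))) (unit e₂)
      reorder : ∀ a b c d → ((a ⊕ b) ⊕ c) ⊕ d ≈ (d ⊕ a) ⊕ (b ⊕ c)
      reorder = solve 4 (λ a b c d → ((a :+ b) :+ c) :+ d := (d :+ a) :+ (b :+ c)) ≈-refl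
      reorder' : ∀ a b c → a ⊕ ((a ⊕ b) ⊕ c) ≈ (a ⊕ a) ⊕ (b ⊕ c)
      reorder' = solve 3 (λ a b c → a :+ ((a :+ b) :+ c) := (a :+ a) :+ (b :+ c)) ≈-refl
      top : ∀ s → s ≤ n → x^ (s * suc n + tri s) · R s (suc n) ≈ X n s ⊕ Y n s
      top s s≤n = ≈-trans (·-cong (≈-refl {x^ (s * suc n + tri s)}) (R-last s≤n)) (≈-trans (expand (x^ (s * suc n + tri s)) (R s n) (x^ (suc n)))
        (⊕-cong (≈-refl {X n s}) (·-cong (≈-trans (x^-+ (s * suc n + tri s) (suc n)) (≡⇒≈ x^ (eq s n (tri s)))) (≈-refl {R s n}))))
        where
        expand : ∀ a r b → a · (r · (𝟙 ⊕ b)) ≈ a · r ⊕ (a · b) · r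
        expand = solve 3 (λ a r b → a :* (r :* (con true :+ b)) := a :* r :+ (a :* b) :* r) ≈-refl
        eq : ∀ s n t → s * suc n + t + suc n ≡ suc s * suc n + t
        eq = solve-∀
      pair : ∀ s → s < n → x^ (suc s * n + tri (suc s)) · R (suc s) n ⊕ X n (suc s) ≈ Y n s
      pair s s<n = ≈-trans (⊕-cong (·-cong (≡⇒≈ x^ (eq₁ s n (tri s))) (≈-refl {R (suc s) n})) (·-cong (≈-trans (≡⇒≈ x^ (eq₂ s n (tri s))) (≈-sym (x^-+ (suc s * suc n + tri s) (suc s)))) (≈-refl {R (suc s) n})))
        (≈-trans (collect (x^ (suc s * suc n + tri s)) (x^ (suc s)) (R (suc s) n)) (·-cong (≈-refl {x^ (suc s * suc n + tri s)}) (≈-sym (R-first s<n))))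
        where
        eq₁ : ∀ s n t → suc s * n + (suc s + t) ≡ suc s * suc n + t
        eq₁ = solve-∀
        eq₂ : ∀ s n t → suc s * suc n + (suc s + t) ≡ suc s * suc n + t + suc s
        eq₂ = solve-∀
        collect : ∀ a b r → a · r ⊕ (a · b) · r ≈ a · (r · (𝟙 ⊕ b))
        collect = solve 3 (λ a b r → a :* r :+ (a :* b) :* r := a :* (r :* (con true :+ b))) ≈-refl
      telescope : F n ⊕ ⨁ (suc n) (X n) ≈ ⨁ n (Y n)
      telescope = ≈-trans (≈-sym (⨁-⊕ (suc n) (λ s → x^ (s * n + tri s) · R s n) (X n)))
        (≈-trans (⨁-head n _) (≈-trans (⊕-cong (⊕-same (x^ 0 · R 0 n)) (⨁-cong n pair)) ≈-refl))

    pent : ℕ → Ser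
    pent zero = 𝟙
    pent (suc n) = pent n ⊕ (x^ (suc n * suc n + tri n) ⊕ x^ (suc n * suc n + tri (suc n)))

    F-pent : ∀ n → F n ≈ pent n
    F-pent zero = ≈-trans (·-cong (≡⇒≈ mono (*-zeroʳ i)) ≈-refl) (·-identityˡ 𝟙)
    F-pent (suc n) = ≈-trans (insert (F (suc n)) (F n)) (⊕-cong (F-pent n) (F-step n))
      where
      insert : ∀ a b → a ≈ b ⊕ (a ⊕ b)
      insert a b k = trans (sym (trans (sym (xor-assoc (b k) (b k) (a k))) (cong (_xor a k) (xor-same (b k))))) (cong (b k xor_) (xor-comm (b k) (a k)))

    -- The term s = 0 of `F` is the Euler product itself; every other term has all its exponents
    -- above n.
    euler-pent : ∀ n → 0 < i → euler i n ≈[ n ] pent n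
    euler-pent n i>0 j j≤n = trans (sym (trans (·-cong (≡⇒≈ mono (*-zeroʳ i)) (R-euler n) j) (·-identityˡ (euler i n) j)))
      (trans (sym (xor-identityʳ _)) (trans (cong ((x^ 0 · R 0 n) j xor_) (sym (rest n ≤-refl))) (trans (sym (⨁-head n (λ s → x^ (s * n + tri s) · R s n) j)) (F-pent n j))))
      where
      rest : ∀ k → k ≤ n → ⨁ k (λ s → x^ (suc s * n + tri (suc s)) · R (suc s) n) j ≡ false
      rest zero _ = refl
      rest (suc k) k<n = cong₂ _xor_ (rest k (<⇒≤ k<n)) (mono-below (i * (suc k * n + tri (suc k))) (R (suc k) n) j
        (≤-trans (s≤s j≤n) (≤-trans (≤-trans (≤-reflexive (+-comm 1 n)) (+-mono-≤ (m≤m+n n (k * n)) (s≤s z≤n))) (m≤n*m _ i {{ℕ.>-nonZero i>0}}))))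

-- Parities of finite sets

module Theta where

  open Series
  open EulerProduct using (tri; euler; module Pentagonal)
  open import Data.Nat as ℕ using (ℕ; zero; suc; _≤_; _<_; z≤n; s≤s)
  import Data.Nat.Properties as ℕP
  import Data.Nat.Tactic.RingSolver as ℕS
  open import Data.Fin.Base using (Fin; zero; suc; splitAt; join; remQuot; combine)
  open import Data.Fin.Properties using (splitAt-join; join-splitAt; remQuot-combine; combine-remQuot; injective⇒≤)
  open import Data.Integer as ℤ using (ℤ; +_; -[1+_]; ∣_∣; _+_; _*_; _-_; -_; _/ℕ_; _%ℕ_)
  open import Data.Integer.Properties using (pos-+; pos-*; +-injective; *-assoc; *-cancelˡ-≡; abs-*)
  open import Data.Integer.DivMod using (a≡a%ℕn+[a/ℕn]*n; n%ℕd<d)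
  open import Data.Integer.Tactic.RingSolver using (solve-∀)
  open import Data.Bool using (Bool; true; false; _∧_; _xor_)
  open import Data.Bool.Properties using (xor-same; xor-identityʳ; xor-assoc; xor-comm)
  open import Data.Product
  open import Data.Sum using (_⊎_; inj₁; inj₂; [_,_]′)
  open import Data.Empty using (⊥; ⊥-elim)
  open import Function using (_∘_; case_of_; it)
  open import Relation.Nullary
  open import Relation.Binary.PropositionalEquality
  open import Axiom.UniquenessOfIdentityProofs using (module Decidable⇒UIP)
  open SeriesSolver using (solve; _:+_; _:=_)

  infix 3 _≅_

  record _≅_ (A B : Set) : Set where
    field
      to : A → B
      from : B → A
      to-from : ∀ b → to (from b) ≡ b
      from-to : ∀ a → from (to a) ≡ a

  open _≅_ public

  ≅-sym : ∀ {A B} → A ≅ B → B ≅ A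
  ≅-sym e = record { to = from e ; from = to e ; to-from = from-to e ; from-to = to-from e }

  ≅-trans : ∀ {A B C} → A ≅ B → B ≅ C → A ≅ C
  ≅-trans e f = record
    { to = to f ∘ to e ; from = from e ∘ from f
    ; to-from = λ c → trans (cong (to f) (to-from e (from f c))) (to-from f c)
    ; from-to = λ a → trans (cong (from e) (from-to f (to e a))) (from-to e a) }

  ⊎-≅ : ∀ {A B C D} → A ≅ C → B ≅ D → (A ⊎ B) ≅ (C ⊎ D)
  ⊎-≅ e f = record
    { to = [ inj₁ ∘ to e , inj₂ ∘ to f ]′ ; from = [ inj₁ ∘ from e , inj₂ ∘ from f ]′
    ; to-from = λ { (inj₁ c) → cong inj₁ (to-from e c) ; (inj₂ d) → cong inj₂ (to-from f d) }
    ; from-to = λ { (inj₁ a) → cong inj₁ (from-to e a) ; (inj₂ b) → cong inj₂ (from-to f b) } }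

  ×-≅ : ∀ {A B C D} → A ≅ C → B ≅ D → (A × B) ≅ (C × D)
  ×-≅ e f = record
    { to = map (to e) (to f) ; from = map (from e) (from f)
    ; to-from = λ (c , d) → cong₂ _,_ (to-from e c) (to-from f d)
    ; from-to = λ (a , b) → cong₂ _,_ (from-to e a) (from-to f b) }

  record Parity (A : Set) (b : Bool) : Set where
    constructor parity
    field
      size : ℕ
      enumeration : A ≅ Fin size
      isOdd-size : isOdd size ≡ b

  Fin-injective : ∀ {m n} → Fin m ≅ Fin n → m ≡ n
  Fin-injective e = ℕP.≤-antisym (injective⇒≤ (inj e)) (injective⇒≤ (inj (≅-sym e)))
    where
    inj : ∀ {A B} (e : A ≅ B) {x y} → to e x ≡ to e y → x ≡ y
    inj e {x} {y} eq = trans (sym (from-to e x)) (trans (cong (from e) eq) (from-to e y))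

  parity-≅ : ∀ {A B b} → A ≅ B → Parity A b → Parity B b
  parity-≅ e (parity n f o) = parity n (≅-trans (≅-sym e) f) o

  parity-unique : ∀ {A b c} → Parity A b → Parity A c → b ≡ c
  parity-unique (parity m e o) (parity n f p) =
    trans (sym o) (trans (cong isOdd (Fin-injective (≅-trans (≅-sym e) f))) p)

  parity-≡ : ∀ {A b c} → b ≡ c → Parity A b → Parity A c
  parity-≡ refl p = p

  parity-⊥ : ∀ {A} → ¬ A → Parity A false
  parity-⊥ ¬a = parity 0 (record { to = λ a → ⊥-elim (¬a a) ; from = λ () ; to-from = λ () ; from-to = λ a → ⊥-elim (¬a a) }) refl

  parity-⊤ : ∀ {A} (a : A) → (∀ b → a ≡ b) → Parity A true
  parity-⊤ a u = parity 1 (record { to = λ _ → zero ; from = λ _ → a ; to-from = λ { zero → refl } ; from-to = u }) refl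

  parity-⊎ : ∀ {A B b c} → Parity A b → Parity B c → Parity (A ⊎ B) (b xor c)
  parity-⊎ (parity m e o) (parity n f p) = parity (m ℕ.+ n)
    (≅-trans (⊎-≅ e f) (record { to = join m n ; from = splitAt m ; to-from = join-splitAt m n ; from-to = splitAt-join m n }))
    (trans (isOdd-+ m n) (cong₂ _xor_ o p))

  parity-× : ∀ {A B b c} → Parity A b → Parity B c → Parity (A × B) (b ∧ c)
  parity-× (parity m e o) (parity n f p) = parity (m ℕ.* n)
    (≅-trans (×-≅ e f) (record { to = uncurry combine ; from = remQuot {m} n ; to-from = combine-remQuot {m} n ; from-to = λ (i , j) → remQuot-combine {m} i j }))
    (trans (isOdd-* m n) (cong₂ _∧_ o p))

  parity-true : ∀ {A} → Parity A true → A
  parity-true (parity (suc n) e _) = from e zero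

  Fin-suc-Σ : ∀ {n} {P : Fin (suc n) → Set} → Σ (Fin (suc n)) P ≅ (P zero ⊎ Σ (Fin n) (P ∘ suc))
  Fin-suc-Σ = record
    { to = λ { (zero , p) → inj₁ p ; (suc i , p) → inj₂ (i , p) }
    ; from = λ { (inj₁ p) → zero , p ; (inj₂ (i , p)) → suc i , p }
    ; to-from = λ { (inj₁ p) → refl ; (inj₂ _) → refl }
    ; from-to = λ { (zero , p) → refl ; (suc i , p) → refl } }

  Bool-uip : ∀ {a b : Bool} (p q : a ≡ b) → p ≡ q
  Bool-uip refl refl = refl

  Fin-filter : ∀ n (f : Fin n → Bool) → ∃ (Parity (Σ (Fin n) λ i → f i ≡ true))
  Fin-filter zero f = false , parity-⊥ λ { (() , _) }
  Fin-filter (suc n) f = _ , parity-≅ (≅-sym (Fin-suc-Σ {n} {λ i → f i ≡ true})) (parity-⊎ (proj₂ (bool (f zero))) (proj₂ (Fin-filter n (f ∘ suc))))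
    where
    bool : ∀ b → ∃ (Parity (b ≡ true))
    bool true = true , parity-⊤ refl λ { refl → refl }
    bool false = false , parity-⊥ λ ()

  parity-filter : ∀ {A b} → Parity A b → (f : A → Bool) → ∃ (Parity (Σ A λ a → f a ≡ true))
  parity-filter {A} (parity n e o) f = _ , parity-≅ transport (proj₂ (Fin-filter n (f ∘ from e)))
    where
    Σ-≡ : ∀ {B : Set} {g : B → Bool} {x y} {p : g x ≡ true} {q : g y ≡ true} → x ≡ y → _≡_ {A = Σ B λ b → g b ≡ true} (x , p) (y , q)
    Σ-≡ refl = cong (_ ,_) (Bool-uip _ _)
    transport : (Σ (Fin n) λ i → f (from e i) ≡ true) ≅ (Σ A λ a → f a ≡ true)
    transport = record
      { to = λ (i , p) → from e i , p
      ; from = λ (a , p) → to e a , trans (cong f (from-to e a)) p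
      ; to-from = λ (a , p) → Σ-≡ {g = f} (from-to e a)
      ; from-to = λ (i , p) → Σ-≡ {g = f ∘ from e} (to-from e i) }

  module _ {A B : Set} where
    private
      left right : A ⊎ B → Bool
      left (inj₁ _) = true
      left (inj₂ _) = false
      right (inj₁ _) = false
      right (inj₂ _) = true

    -- Only the union is known to be finite; the summands are recovered as decidable subsets of it.
    -- This spares separate finiteness proofs for each residue class in the lattice arguments.
    parity-split : ∀ {b} → Parity (A ⊎ B) b → Σ Bool λ c → Σ Bool λ d → Parity A c × Parity B d × b ≡ c xor d
    parity-split p = c , d , pA , pB , parity-unique p (parity-⊎ pA pB)
      where
      c = proj₁ (parity-filter p left)
      d = proj₁ (parity-filter p right)
      pA : Parity A c
      pA = parity-≅ (record { to = λ { (inj₁ a , _) → a ; (inj₂ _ , ()) } ; from = λ a → inj₁ a , refl ; to-from = λ _ → refl ; from-to = λ { (inj₁ a , refl) → refl } }) (proj₂ (parity-filter p left))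
      pB : Parity B d
      pB = parity-≅ (record { to = λ { (inj₂ b , _) → b ; (inj₁ _ , ()) } ; from = λ b → inj₂ b , refl ; to-from = λ _ → refl ; from-to = λ { (inj₂ b , refl) → refl } }) (proj₂ (parity-filter p right))

  -- Weighted index sets

  ℤ-uip : ∀ {a b : ℤ} (p q : a ≡ b) → p ≡ q
  ℤ-uip = Decidable⇒UIP.≡-irrelevant ℤ._≟_

  Fiber : {I : Set} → (I → ℤ) → ℤ → Set
  Fiber {I} w v = Σ I λ i → w i ≡ v

  fiber-≡ : ∀ {I} {w : I → ℤ} {v i j} {p : w i ≡ v} {q : w j ≡ v} → i ≡ j → _≡_ {A = Fiber w v} (i , p) (j , q)
  fiber-≡ refl = cong (_ ,_) (ℤ-uip _ _)

  fiber-≅ : ∀ {I J} {w : I → ℤ} {w' : J → ℤ} (e : I ≅ J) → (∀ j → w (from e j) ≡ w' j) → ∀ v → Fiber w v ≅ Fiber w' v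
  fiber-≅ {w = w} {w'} e eq v = record
    { to = λ (i , p) → to e i , trans (sym (eq (to e i))) (trans (cong w (from-to e i)) p)
    ; from = λ (j , p) → from e j , trans (eq j) p
    ; to-from = λ (j , _) → fiber-≡ {w = w'} (to-from e j)
    ; from-to = λ (i , _) → fiber-≡ {w = w} (from-to e i) }

  fiber-⊎ : ∀ {I J} (w : I ⊎ J → ℤ) v → Fiber w v ≅ (Fiber (w ∘ inj₁) v ⊎ Fiber (w ∘ inj₂) v)
  fiber-⊎ w v = record
    { to = λ { (inj₁ i , p) → inj₁ (i , p) ; (inj₂ j , p) → inj₂ (j , p) }
    ; from = λ { (inj₁ (i , p)) → inj₁ i , p ; (inj₂ (j , p)) → inj₂ j , p }
    ; to-from = λ { (inj₁ _) → refl ; (inj₂ _) → refl }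
    ; from-to = λ { (inj₁ i , p) → refl ; (inj₂ j , p) → refl } }

  module Count (v : ℕ → ℤ) where

    -- A series tied to a weight on an index set: coefficient n is the parity of the fibre over
    -- `v n`. Series identities become bijections of index sets that respect the weight, checked by
    -- ring identities over ℤ.
    record Counts {I : Set} (w : I → ℤ) (f : Ser) : Set where
      constructor counted
      field
        at : ∀ n → Parity (Fiber w (v n)) (f n)

    open Counts public

    counts-≈ : ∀ {I} {w : I → ℤ} {f g} → f ≈ g → Counts w f → Counts w g
    counts-≈ e c = counted λ n → parity-≡ (e n) (at c n)

    counts-unique : ∀ {I} {w : I → ℤ} {f g} → Counts w f → Counts w g → f ≈ g
    counts-unique c d n = parity-unique (at c n) (at d n)

    reindex : ∀ {I J} {w : I → ℤ} {w' : J → ℤ} {f} (e : I ≅ J) → (∀ j → w (from e j) ≡ w' j) → Counts w f → Counts w' f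
    reindex {w = w} {w'} e eq c = counted λ n → parity-≅ (fiber-≅ {w = w} {w'} e eq (v n)) (at c n)

    counts-unique₀ : ∀ {I} {w : I → ℤ} {f g} → Counts w (mono 0 · f) → Counts w g → f ≈ g
    counts-unique₀ {f = f} c d n = trans (sym (·-identityˡ f n)) (counts-unique c d n)

    counts-≈₀ : ∀ {I} {w : I → ℤ} {f g h} → Counts w (mono 0 · f) → mono 0 · f ≈ g → g ≈ h → f ≈ h
    counts-≈₀ {f = f} _ e e' n = trans (sym (·-identityˡ f n)) (trans (e n) (e' n))

    record Splits {J K : Set} (w₁ : J → ℤ) (w₂ : K → ℤ) (f : Ser) : Set where
      constructor splits
      field
        {left right} : Ser
        counts-left : Counts w₁ left
        counts-right : Counts w₂ right
        sum : f ≈ left ⊕ right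

    split : ∀ {I J K} {w : I → ℤ} {w₁ : J → ℤ} {w₂ : K → ℤ} {f} (e : I ≅ (J ⊎ K)) →
            (∀ j → w (from e (inj₁ j)) ≡ w₁ j) → (∀ k → w (from e (inj₂ k)) ≡ w₂ k) →
            Counts w f → Splits w₁ w₂ f
    split {J = J} {K} {w} {w₁} {w₂} {f} e eq₁ eq₂ c =
      splits (counted λ n → proj₁ (proj₂ (proj₂ (s n)))) (counted λ n → proj₁ (proj₂ (proj₂ (proj₂ (s n))))) (λ n → proj₂ (proj₂ (proj₂ (proj₂ (s n)))))
      where
      w₁₂ : J ⊎ K → ℤ
      w₁₂ = [ w₁ , w₂ ]′
      s : ∀ n → Σ Bool λ x → Σ Bool λ y → Parity (Fiber w₁ (v n)) x × Parity (Fiber w₂ (v n)) y × f n ≡ x xor y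
      s n = parity-split (parity-≅ (≅-trans (fiber-≅ {w = w} {w₁₂} e (λ { (inj₁ j) → eq₁ j ; (inj₂ k) → eq₂ k }) (v n)) (fiber-⊎ w₁₂ (v n))) (at c n))

    merge : ∀ {I J K} {w : I → ℤ} {w₁ : J → ℤ} {w₂ : K → ℤ} {g h} (e : I ≅ (J ⊎ K)) →
            (∀ j → w (from e (inj₁ j)) ≡ w₁ j) → (∀ k → w (from e (inj₂ k)) ≡ w₂ k) →
            Counts w₁ g → Counts w₂ h → Counts w (g ⊕ h)
    merge {J = J} {K} {w} {w₁} {w₂} e eq₁ eq₂ c d = counted λ n → parity-≅ (≅-sym (≅-trans (fiber-≅ {w = w} {w₁₂} e (λ { (inj₁ j) → eq₁ j ; (inj₂ k) → eq₂ k }) (v n)) (fiber-⊎ w₁₂ (v n)))) (parity-⊎ (at c n) (at d n))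
      where
      w₁₂ : J ⊎ K → ℤ
      w₁₂ = [ w₁ , w₂ ]′

    counts-empty : ∀ {I} {w : I → ℤ} {f} → (∀ i n → w i ≢ v n) → Counts w f → f ≈ 𝟘
    counts-empty ne c n = parity-unique (at c n) (parity-⊥ λ (i , p) → ne i n p)

    mirror : ∀ {I J} {w : I → ℤ} {w' : J → ℤ} {f} (e : I ≅ (J ⊎ J)) →
            (∀ j → w (from e (inj₁ j)) ≡ w' j) → (∀ j → w (from e (inj₂ j)) ≡ w' j) → Counts w f → f ≈ 𝟘
    mirror {w = w} {w'} {f} e eq₁ eq₂ c = cancel (split {w = w} {w'} {w'} e eq₁ eq₂ c)
      where
      cancel : Splits w' w' f → f ≈ 𝟘
      cancel (splits {g} {h} cg ch f≈) n = trans (f≈ n) (trans (cong (_xor h n) (counts-unique cg ch n)) (xor-same (h n)))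

  -- Residue classes, signs and affine substitutions

  ℤ-cancelʳ : ∀ c a b → a + c ≡ b + c → a ≡ b
  ℤ-cancelʳ c a b e = trans (sym (eq a c)) (trans (cong (_- c) e) (eq b c))
    where
    eq : ∀ a c → a + c - c ≡ a
    eq = solve-∀

  fromInjection : ∀ {A B : Set} (to : A → B) (from : B → A) → (∀ a → from (to a) ≡ a) → (∀ {b c} → from b ≡ from c → b ≡ c) → A ≅ B
  fromInjection to from from-to inj = record { to = to ; from = from ; to-from = λ b → inj (from-to (from b)) ; from-to = from-to }

  multiple≢remainder : ∀ m r k → 0 < r → r < suc m → + suc m * k ≢ + r
  multiple≢remainder m r k 0<r r<m e with ∣ k ∣ | trans (sym (abs-* (+ suc m) k)) (cong ∣_∣ e)
  ... | zero | e' = ℕP.<⇒≢ 0<r (trans (sym (ℕP.*-zeroʳ (suc m))) e')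
  ... | suc n | e' = ℕP.<⇒≱ r<m (ℕP.≤-trans (ℕP.m≤m*n (suc m) (suc n)) (ℕP.≤-reflexive e'))

  halve : ℤ ≅ (ℤ ⊎ ℤ)
  halve = fromInjection to' from' from-to' inj
    where
    from' : ℤ ⊎ ℤ → ℤ
    from' (inj₁ k) = + 2 * k
    from' (inj₂ k) = + 2 * k + + 1
    class : ∀ z r → r < 2 → z ≡ + r + (z /ℕ 2) * + 2 → Σ (ℤ ⊎ ℤ) λ x → from' x ≡ z
    class z 0 _ e = inj₁ (z /ℕ 2) , trans (eq (z /ℕ 2)) (sym e)
      where
      eq : ∀ q → + 2 * q ≡ + 0 + q * + 2
      eq = solve-∀
    class z 1 _ e = inj₂ (z /ℕ 2) , trans (eq (z /ℕ 2)) (sym e)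
      where
      eq : ∀ q → + 2 * q + + 1 ≡ + 1 + q * + 2
      eq = solve-∀
    class z (suc (suc r)) (s≤s (s≤s ())) e
    c : ∀ z → Σ (ℤ ⊎ ℤ) λ x → from' x ≡ z
    c z = class z (z %ℕ 2) (n%ℕd<d z 2) (a≡a%ℕn+[a/ℕn]*n z 2)
    to' : ℤ → ℤ ⊎ ℤ
    to' z = proj₁ (c z)
    from-to' : ∀ z → from' (to' z) ≡ z
    from-to' z = proj₂ (c z)
    diff : ∀ k l → + 2 * k ≡ + 2 * l + + 1 → ⊥
    diff k l e = multiple≢remainder 1 1 (k - l) (s≤s z≤n) (s≤s (s≤s z≤n)) (trans (eq₁ k l) (trans (cong (_- + 2 * l) e) (eq₂ l)))
      where
      eq₁ : ∀ k l → + 2 * (k - l) ≡ + 2 * k - + 2 * l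
      eq₁ = solve-∀
      eq₂ : ∀ l → + 2 * l + + 1 - + 2 * l ≡ + 1
      eq₂ = solve-∀
    inj : ∀ {x y} → from' x ≡ from' y → x ≡ y
    inj {inj₁ k} {inj₁ l} e = cong inj₁ (*-cancelˡ-≡ (+ 2) k l e)
    inj {inj₂ k} {inj₂ l} e = cong inj₂ (*-cancelˡ-≡ (+ 2) k l (ℤ-cancelʳ (+ 1) _ _ e))
    inj {inj₁ k} {inj₂ l} e = ⊥-elim (diff k l e)
    inj {inj₂ k} {inj₁ l} e = ⊥-elim (diff l k (sym e))

  trisect : ℤ ≅ (ℤ ⊎ (ℤ ⊎ ℤ))
  trisect = fromInjection to' from' from-to' inj
    where
    T = ℤ ⊎ (ℤ ⊎ ℤ)
    from' : T → ℤ
    from' (inj₁ k) = + 3 * k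
    from' (inj₂ (inj₁ k)) = + 3 * k + + 1
    from' (inj₂ (inj₂ k)) = + 3 * k + + 2
    class : ∀ z r → r < 3 → z ≡ + r + (z /ℕ 3) * + 3 → Σ T λ x → from' x ≡ z
    class z 0 _ e = inj₁ (z /ℕ 3) , trans (eq (z /ℕ 3)) (sym e)
      where
      eq : ∀ q → + 3 * q ≡ + 0 + q * + 3
      eq = solve-∀
    class z 1 _ e = inj₂ (inj₁ (z /ℕ 3)) , trans (eq (z /ℕ 3)) (sym e)
      where
      eq : ∀ q → + 3 * q + + 1 ≡ + 1 + q * + 3
      eq = solve-∀
    class z 2 _ e = inj₂ (inj₂ (z /ℕ 3)) , trans (eq (z /ℕ 3)) (sym e)
      where
      eq : ∀ q → + 3 * q + + 2 ≡ + 2 + q * + 3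
      eq = solve-∀
    class z (suc (suc (suc r))) (s≤s (s≤s (s≤s ()))) e
    c : ∀ z → Σ T λ x → from' x ≡ z
    c z = class z (z %ℕ 3) (n%ℕd<d z 3) (a≡a%ℕn+[a/ℕn]*n z 3)
    to' : ℤ → T
    to' z = proj₁ (c z)
    from-to' : ∀ z → from' (to' z) ≡ z
    from-to' z = proj₂ (c z)
    eq₁ : ∀ k l → + 3 * (k - l) ≡ + 3 * k - + 3 * l
    eq₁ = solve-∀
    diff₁ : ∀ k l → + 3 * k ≡ + 3 * l + + 1 → ⊥
    diff₁ k l e = multiple≢remainder 2 1 (k - l) (s≤s z≤n) (s≤s (s≤s z≤n)) (trans (eq₁ k l) (trans (cong (_- + 3 * l) e) (eq₂ l)))
      where
      eq₂ : ∀ l → + 3 * l + + 1 - + 3 * l ≡ + 1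
      eq₂ = solve-∀
    diff₂ : ∀ k l → + 3 * k ≡ + 3 * l + + 2 → ⊥
    diff₂ k l e = multiple≢remainder 2 2 (k - l) (s≤s z≤n) (s≤s (s≤s (s≤s z≤n))) (trans (eq₁ k l) (trans (cong (_- + 3 * l) e) (eq₂ l)))
      where
      eq₂ : ∀ l → + 3 * l + + 2 - + 3 * l ≡ + 2
      eq₂ = solve-∀
    diff₃ : ∀ k l → + 3 * k + + 1 ≡ + 3 * l + + 2 → ⊥
    diff₃ k l e = diff₁ k l (ℤ-cancelʳ (+ 1) _ _ (trans e (eq l)))
      where
      eq : ∀ l → + 3 * l + + 2 ≡ + 3 * l + + 1 + + 1
      eq = solve-∀
    inj : ∀ {x y} → from' x ≡ from' y → x ≡ y
    inj {inj₁ k} {inj₁ l} e = cong inj₁ (*-cancelˡ-≡ (+ 3) k l e)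
    inj {inj₁ k} {inj₂ (inj₁ l)} e = ⊥-elim (diff₁ k l e)
    inj {inj₁ k} {inj₂ (inj₂ l)} e = ⊥-elim (diff₂ k l e)
    inj {inj₂ (inj₁ k)} {inj₁ l} e = ⊥-elim (diff₁ l k (sym e))
    inj {inj₂ (inj₁ k)} {inj₂ (inj₁ l)} e = cong (inj₂ ∘ inj₁) (*-cancelˡ-≡ (+ 3) k l (ℤ-cancelʳ (+ 1) _ _ e))
    inj {inj₂ (inj₁ k)} {inj₂ (inj₂ l)} e = ⊥-elim (diff₃ k l e)
    inj {inj₂ (inj₂ k)} {inj₁ l} e = ⊥-elim (diff₂ l k (sym e))
    inj {inj₂ (inj₂ k)} {inj₂ (inj₁ l)} e = ⊥-elim (diff₃ l k (sym e))
    inj {inj₂ (inj₂ k)} {inj₂ (inj₂ l)} e = cong (inj₂ ∘ inj₂) (*-cancelˡ-≡ (+ 3) k l (ℤ-cancelʳ (+ 2) _ _ e))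

  ×-distribˡ-⊎ : ∀ {A B C : Set} → (A × (B ⊎ C)) ≅ ((A × B) ⊎ (A × C))
  ×-distribˡ-⊎ = record
    { to = λ { (a , inj₁ b) → inj₁ (a , b) ; (a , inj₂ c) → inj₂ (a , c) }
    ; from = λ { (inj₁ (a , b)) → a , inj₁ b ; (inj₂ (a , c)) → a , inj₂ c }
    ; to-from = λ { (inj₁ _) → refl ; (inj₂ _) → refl }
    ; from-to = λ { (a , inj₁ b) → refl ; (a , inj₂ c) → refl } }

  ×-comm : ∀ {A B : Set} → (A × B) ≅ (B × A)
  ×-comm = record { to = λ (a , b) → b , a ; from = λ (b , a) → a , b ; to-from = λ _ → refl ; from-to = λ _ → refl }

  ≅-refl : ∀ {A} → A ≅ A
  ≅-refl = record { to = λ a → a ; from = λ a → a ; to-from = λ _ → refl ; from-to = λ _ → refl }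

  byParity : ∀ {A : Set} → (A × ℤ) ≅ ((A × ℤ) ⊎ (A × ℤ))
  byParity = ≅-trans (×-≅ ≅-refl halve) ×-distribˡ-⊎

  byThree : ∀ {A : Set} → (A × ℤ) ≅ ((A × ℤ) ⊎ ((A × ℤ) ⊎ (A × ℤ)))
  byThree = ≅-trans (×-≅ ≅-refl trisect) (≅-trans ×-distribˡ-⊎ (⊎-≅ ≅-refl ×-distribˡ-⊎))

  bySign : ∀ {A : Set} → (A × ℤ) ≅ ((A × ℕ) ⊎ (A × ℕ))
  bySign = record
    { to = λ { (a , + n) → inj₁ (a , n) ; (a , -[1+ n ]) → inj₂ (a , n) }
    ; from = λ { (inj₁ (a , n)) → a , + n ; (inj₂ (a , n)) → a , -[1+ n ] }
    ; to-from = λ { (inj₁ _) → refl ; (inj₂ _) → refl }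
    ; from-to = λ { (a , + n) → refl ; (a , -[1+ n ]) → refl } }

  bySign₀ : ∀ {A : Set} → (A × ℤ) ≅ (A ⊎ ((A × ℕ) ⊎ (A × ℕ)))
  bySign₀ = record
    { to = λ { (a , + zero) → inj₁ a ; (a , + suc n) → inj₂ (inj₁ (a , n)) ; (a , -[1+ n ]) → inj₂ (inj₂ (a , n)) }
    ; from = λ { (inj₁ a) → a , + 0 ; (inj₂ (inj₁ (a , n))) → a , + suc n ; (inj₂ (inj₂ (a , n))) → a , -[1+ n ] }
    ; to-from = λ { (inj₁ _) → refl ; (inj₂ (inj₁ _)) → refl ; (inj₂ (inj₂ _)) → refl }
    ; from-to = λ { (a , + zero) → refl ; (a , + suc n) → refl ; (a , -[1+ n ]) → refl } }

  shearing : (h : ℤ → ℤ) → (ℤ × ℤ) ≅ (ℤ × ℤ)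
  shearing h = record
    { to = λ (a , b) → a , b - h a ; from = λ (a , b) → a , b + h a
    ; to-from = λ (a , b) → cong (a ,_) (eq₁ b (h a)) ; from-to = λ (a , b) → cong (a ,_) (eq₂ b (h a)) }
    where
    eq₁ : ∀ b c → b + c - c ≡ b
    eq₁ = solve-∀
    eq₂ : ∀ b c → b - c + c ≡ b
    eq₂ = solve-∀

  reflecting : (h : ℤ → ℤ) → (ℤ × ℤ) ≅ (ℤ × ℤ)
  reflecting h = record
    { to = λ (a , b) → a , h a - b ; from = λ (a , b) → a , h a - b
    ; to-from = λ (a , b) → cong (a ,_) (eq b (h a)) ; from-to = λ (a , b) → cong (a ,_) (eq b (h a)) }
    where
    eq : ∀ b c → c - (c - b) ≡ b
    eq = solve-∀

  module Lattice (v : ℕ → ℤ) where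
    open Count v public

    Counts₂ : (ℤ → ℤ → ℤ) → Ser → Set
    Counts₂ w f = Counts (uncurry w) f

    shear : ∀ {w w' f} (h : ℤ → ℤ) → (∀ a b → w a (b + h a) ≡ w' a b) → Counts₂ w f → Counts₂ w' f
    shear h eq = reindex (shearing h) (uncurry eq)

    reflect : ∀ {w w' f} (h : ℤ → ℤ) → (∀ a b → w a (h a - b) ≡ w' a b) → Counts₂ w f → Counts₂ w' f
    reflect h eq = reindex (reflecting h) (uncurry eq)

    swapped : ∀ {w f} → Counts₂ w f → Counts₂ (λ b a → w a b) f
    swapped = reindex ×-comm (λ _ → refl)

    pointwise : ∀ {w w' f} → (∀ a b → w a b ≡ w' a b) → Counts₂ w f → Counts₂ w' f
    pointwise eq = reindex ≅-refl (uncurry eq)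

    split₂ : ∀ {w f} → Counts₂ w f → Splits (uncurry λ a b → w a (+ 2 * b)) (uncurry λ a b → w a (+ 2 * b + + 1)) f
    split₂ = split byParity (λ _ → refl) (λ _ → refl)

    merge₂ : ∀ {w g h} → Counts₂ (λ a b → w a (+ 2 * b)) g → Counts₂ (λ a b → w a (+ 2 * b + + 1)) h → Counts₂ w (g ⊕ h)
    merge₂ = merge byParity (λ _ → refl) (λ _ → refl)

    record Splits₃ (w₀ w₁ w₂ : ℤ → ℤ → ℤ) (f : Ser) : Set where
      constructor splits₃
      field
        {g₀ g₁ g₂} : Ser
        c₀ : Counts₂ w₀ g₀
        c₁ : Counts₂ w₁ g₁
        c₂ : Counts₂ w₂ g₂
        sum₃ : f ≈ g₀ ⊕ (g₁ ⊕ g₂)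

    split₃ : ∀ {w f} → Counts₂ w f → Splits₃ (λ a b → w a (+ 3 * b)) (λ a b → w a (+ 3 * b + + 1)) (λ a b → w a (+ 3 * b + + 2)) f
    split₃ {w} {f} c = outer (split {w₁ = w₀} {w₂ = [ w₁ , w₂ ]′} byThree (λ _ → refl) (λ { (inj₁ _) → refl ; (inj₂ _) → refl }) c)
      where
      w₀ w₁ w₂ : ℤ × ℤ → ℤ
      w₀ (a , b) = w a (+ 3 * b)
      w₁ (a , b) = w a (+ 3 * b + + 1)
      w₂ (a , b) = w a (+ 3 * b + + 2)
      inner : ∀ {g} → Counts w₀ g → (h : Ser) → f ≈ g ⊕ h → Splits w₁ w₂ h → Splits₃ (curry w₀) (curry w₁) (curry w₂) f
      inner {g} c₀ h e (splits c₁ c₂ e') = splits₃ c₀ c₁ c₂ λ n → trans (e n) (cong (g n xor_) (e' n))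
      outer : Splits w₀ [ w₁ , w₂ ]′ f → Splits₃ (curry w₀) (curry w₁) (curry w₂) f
      outer (splits {_} {h} c₀ ch e) = inner c₀ h e (split ≅-refl (λ _ → refl) (λ _ → refl) ch)

    -- The orbits of b ↦ -b are pairs, except for the fixed point b = 0.
    even-cancel : ∀ {w f} → (∀ a b → w a (- b) ≡ w a b) → Counts₂ w f → Counts (λ a → w a (+ 0)) f
    even-cancel {w} {f} ev c = finish (split {w₁ = λ a → w a (+ 0)} {w₂ = w'} bySign₀ (λ _ → refl) (λ { (inj₁ _) → refl ; (inj₂ _) → refl }) c)
      where
      w' : (ℤ × ℕ) ⊎ (ℤ × ℕ) → ℤ
      w' = [ (λ (a , n) → w a (+ suc n)) , (λ (a , n) → w a -[1+ n ]) ]′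
      finish : Splits (λ a → w a (+ 0)) w' f → Counts (λ a → w a (+ 0)) f
      finish (splits {g} cg ch e) = counts-≈ (λ n → sym (trans (e n) (trans (cong (g n xor_) (mirror ≅-refl (λ _ → refl) (λ (a , n) → ev a (+ suc n)) ch n)) (xor-identityʳ (g n))))) cg

    -- b ↦ -b - 1 exchanges the non-negative and the negative integers, so it has no fixed point. It
    -- is the reflection of the odd number 2b + 1.
    odd-cancel : ∀ {w f} → (∀ a b → w a (- b - + 1) ≡ w a b) → Counts₂ w f → f ≈ 𝟘
    odd-cancel {w} od = mirror {w' = λ (a , n) → w a (+ n)} bySign (λ _ → refl)
      (λ (a , n) → trans (cong (w a) (eq n)) (od a (+ n)))
      where
      eq : ∀ n → -[1+ n ] ≡ - + n - + 1
      eq zero = refl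
      eq (suc n) = cong (λ k → -[1+ suc k ]) (sym (ℕP.+-identityʳ n))

  -- Theta series as generating functions

  ℕ-uip : ∀ {a b : ℕ} (p q : a ≡ b) → p ≡ q
  ℕ-uip = Decidable⇒UIP.≡-irrelevant ℕ._≟_

  Level : {I : Set} → (I → ℕ) → ℕ → Set
  Level {I} E n = Σ I λ i → E i ≡ n

  level-≡ : ∀ {I} {E : I → ℕ} {n i j} {p : E i ≡ n} {q : E j ≡ n} → i ≡ j → _≡_ {A = Level E n} (i , p) (j , q)
  level-≡ refl = cong (_ ,_) (ℕ-uip _ _)

  Generates : {I : Set} → (I → ℕ) → Ser → Set
  Generates E f = ∀ n → Parity (Level E n) (f n)

  parity-mono : ∀ a n → Parity (a ≡ n) (mono a n)
  parity-mono zero zero = parity-⊤ refl (ℕ-uip refl)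
  parity-mono zero (suc n) = parity-⊥ λ ()
  parity-mono (suc a) zero = parity-⊥ λ ()
  parity-mono (suc a) (suc n) = parity-≅ (record { to = cong suc ; from = ℕP.suc-injective ; to-from = λ p → ℕ-uip _ p ; from-to = λ p → ℕ-uip _ p }) (parity-mono a n)

  xorSum : ℕ → (ℕ → Bool) → Bool
  xorSum zero g = false
  xorSum (suc R) g = g 0 xor xorSum R (g ∘ suc)

  xorSum-last : ∀ R g → xorSum (suc R) g ≡ xorSum R g xor g R
  xorSum-last zero g = xor-identityʳ (g 0)
  xorSum-last (suc R) g = trans (cong (g 0 xor_) (xorSum-last R (g ∘ suc))) (sym (xor-assoc (g 0) _ _))

  parity-Σℕ : ∀ R {Q : ℕ → Set} {g} → (∀ m → Parity (Q m) (g m)) → (∀ m → Q m → m < R) → Parity (Σ ℕ Q) (xorSum R g)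
  parity-Σℕ zero p b = parity-⊥ λ (m , q) → ℕP.n≮0 (b m q)
  parity-Σℕ (suc R) {Q} p b = parity-≅ (record
      { to = λ { (inj₁ q) → 0 , q ; (inj₂ (m , q)) → suc m , q }
      ; from = λ { (zero , q) → inj₁ q ; (suc m , q) → inj₂ (m , q) }
      ; to-from = λ { (zero , q) → refl ; (suc m , q) → refl }
      ; from-to = λ { (inj₁ _) → refl ; (inj₂ _) → refl } })
    (parity-⊎ (p 0) (parity-Σℕ R {Q ∘ suc} (p ∘ suc) (λ m q → ℕP.≤-pred (b (suc m) q))))

  box : (ℤ → ℕ) → ℕ → Ser
  box E N n = mono (E (+ 0)) n xor xorSum N λ m → mono (E -[1+ m ]) n xor mono (E (+ suc m)) n

  theta : (ℤ → ℕ) → Ser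
  theta E n = box E n n

  -- Makes the coefficient of q^n depend on ∣ z ∣ ≤ n alone, which is why `theta` may read it off a
  -- finite box.
  Proper : (ℤ → ℕ) → Set
  Proper E = ∀ z → ∣ z ∣ ≤ E z

  box-generates : ∀ {E} → Proper E → ∀ {N n} → n ≤ N → Parity (Level E n) (box E N n)
  box-generates {E} pr {N} {n} n≤N = parity-≅ (record
      { to = λ { (inj₁ p) → + 0 , p ; (inj₂ (m , inj₁ p)) → -[1+ m ] , p ; (inj₂ (m , inj₂ p)) → + suc m , p }
      ; from = λ { (+ zero , p) → inj₁ p ; (-[1+ m ] , p) → inj₂ (m , inj₁ p) ; (+ suc m , p) → inj₂ (m , inj₂ p) }
      ; to-from = λ { (+ zero , p) → refl ; (-[1+ m ] , p) → refl ; (+ suc m , p) → refl }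
      ; from-to = λ { (inj₁ _) → refl ; (inj₂ (_ , inj₁ _)) → refl ; (inj₂ (_ , inj₂ _)) → refl } })
    (parity-⊎ (parity-mono (E (+ 0)) n) (parity-Σℕ N (λ m → parity-⊎ (parity-mono (E -[1+ m ]) n) (parity-mono (E (+ suc m)) n))
      λ { m (inj₁ p) → ℕP.≤-trans (pr -[1+ m ]) (ℕP.≤-trans (ℕP.≤-reflexive p) n≤N) ; m (inj₂ p) → ℕP.≤-trans (pr (+ suc m)) (ℕP.≤-trans (ℕP.≤-reflexive p) n≤N) }))

  theta-generates : ∀ {E} → Proper E → Generates E (theta E)
  theta-generates pr n = box-generates pr ℕP.≤-refl

  theta-box : ∀ {E} → Proper E → ∀ N → theta E ≈[ N ] box E N
  theta-box pr N n n≤N = parity-unique (theta-generates pr n) (box-generates pr n≤N)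

  private
    Split : (ℕ → Set) → (ℕ → Set) → ℕ → Set
    Split A B zero = A 0 × B 0
    Split A B (suc n) = (A 0 × B (suc n)) ⊎ Split (A ∘ suc) B n

    Pairs : (ℕ → Set) → (ℕ → Set) → ℕ → Set
    Pairs A B n = Σ ℕ λ k → Σ ℕ λ l → (k ℕ.+ l ≡ n) × A k × B l

    pairs≅ : ∀ n {A B : ℕ → Set} → Split A B n ≅ Pairs A B n
    pairs≅ zero = record
      { to = λ (a , b) → 0 , 0 , refl , a , b
      ; from = λ { (0 , 0 , refl , a , b) → a , b }
      ; to-from = λ { (0 , 0 , refl , a , b) → refl }
      ; from-to = λ _ → refl }
    pairs≅ (suc n) {A} {B} = ≅-trans (⊎-≅ ≅-refl (pairs≅ n {A ∘ suc} {B})) (record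
      { to = λ { (inj₁ (a , b)) → 0 , suc n , refl , a , b ; (inj₂ (k , l , e , a , b)) → suc k , l , cong suc e , a , b }
      ; from = λ { (0 , _ , refl , a , b) → inj₁ (a , b) ; (suc k , l , e , a , b) → inj₂ (k , l , ℕP.suc-injective e , a , b) }
      ; to-from = λ { (0 , _ , refl , a , b) → refl ; (suc k , l , e , a , b) → cong (λ e → suc k , l , e , a , b) (ℕ-uip _ e) }
      ; from-to = λ { (inj₁ _) → refl ; (inj₂ (k , l , e , a , b)) → cong (λ e → inj₂ (k , l , e , a , b)) (ℕ-uip _ e) } })

    split-parity : ∀ n {A B f g} → (∀ k → Parity (A k) (f k)) → (∀ l → Parity (B l) (g l)) → Parity (Split A B n) ((f · g) n)
    split-parity zero p q = parity-× (p 0) (q 0)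
    split-parity (suc n) p q = parity-⊎ (parity-× (p 0) (q (suc n))) (split-parity n (p ∘ suc) q)

  generates-· : ∀ {I J} {E : I → ℕ} {E' : J → ℕ} {f g} → Generates E f → Generates E' g →
                Generates (λ (i , j) → E i ℕ.+ E' j) (f · g)
  generates-· {E = E} {E'} p q n = parity-≅ (≅-trans (pairs≅ n) collect) (split-parity n p q)
    where
    collect : Pairs (Level E) (Level E') n ≅ Level (λ (i , j) → E i ℕ.+ E' j) n
    collect = record
      { to = λ (k , l , e , (i , p) , (j , q)) → (i , j) , trans (cong₂ ℕ._+_ p q) e
      ; from = λ ((i , j) , e) → E i , E' j , e , (i , refl) , (j , refl)
      ; to-from = λ ((i , j) , e) → level-≡ {E = λ (i , j) → E i ℕ.+ E' j} refl
      ; from-to = λ { (k , l , refl , (i , refl) , (j , refl)) → refl } }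

  generates-mono : ∀ {I} {E : I → ℕ} {f} → Generates E f → ∀ s → Generates (λ i → s ℕ.+ E i) (mono s · f)
  generates-mono {f = f} p zero n = parity-≡ (sym (·-identityˡ f n)) (p n)
  generates-mono p (suc s) zero = parity-⊥ λ ()
  generates-mono {E = E} p (suc s) (suc n) = parity-≅ (record
      { to = λ (i , e) → i , cong suc e ; from = λ (i , e) → i , ℕP.suc-injective e
      ; to-from = λ (i , e) → cong (i ,_) (ℕ-uip _ e) ; from-to = λ (i , e) → cong (i ,_) (ℕ-uip _ e) })
    (generates-mono {E = E} p s n)

  generates-dilate : ∀ {I} {E : I → ℕ} {f} → Generates E f → Generates (λ i → 2 ℕ.* E i) (dilate f)
  generates-dilate {I} {E} {f} p n with halves n
    where
    halves : ∀ n → ∃ λ m → n ≡ double m ⊎ n ≡ suc (double m)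
    halves zero = 0 , inj₁ refl
    halves (suc n) with halves n
    ... | m , inj₁ e = m , inj₂ (cong suc e)
    ... | m , inj₂ e = suc m , inj₁ (cong suc e)
  ... | m , inj₁ refl = parity-≅ (record
      { to = λ (i , e) → i , trans (cong (2 ℕ.*_) e) (sym (double≡2* m))
      ; from = λ (i , e) → i , ℕP.*-cancelˡ-≡ (E i) m 2 (trans e (double≡2* m))
      ; to-from = λ (i , e) → cong (i ,_) (ℕ-uip _ e) ; from-to = λ (i , e) → cong (i ,_) (ℕ-uip _ e) })
    (parity-≡ (sym (dilate-double f m)) (p m))
  ... | m , inj₂ refl = parity-≡ (sym (dilate-odd f m)) (parity-⊥ λ (i , e) → even≢odd (E i) m (trans e (cong suc (double≡2* m))))
    where
    even≢odd : ∀ a b → 2 ℕ.* a ≢ suc (2 ℕ.* b)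
    even≢odd (suc a) zero e = ℕP.0≢1+n (sym (ℕP.suc-injective (trans (sym (ℕP.*-suc 2 a)) e)))
    even≢odd (suc a) (suc b) e = even≢odd a b (ℕP.suc-injective (ℕP.suc-injective (trans (sym (ℕP.*-suc 2 a)) (trans e (cong suc (ℕP.*-suc 2 b))))))

  generates-unique : ∀ {I} {E E' : I → ℕ} {f g} → (∀ i → E i ≡ E' i) → Generates E f → Generates E' g → f ≈ g
  generates-unique {E = E} {E'} eq p q n = parity-unique (parity-≅ (record
      { to = λ (i , e) → i , trans (sym (eq i)) e ; from = λ (i , e) → i , trans (eq i) e
      ; to-from = λ (i , e) → cong (i ,_) (ℕ-uip _ e) ; from-to = λ (i , e) → cong (i ,_) (ℕ-uip _ e) }) (p n)) (q n)

  generates⇒counts : ∀ {I} {E : I → ℕ} {f} D C .{{_ : ℕ.NonZero D}} {w : I → ℤ} → (∀ i → w i ≡ + (D ℕ.* E i ℕ.+ C)) →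
    Generates E f → Count.Counts (λ n → + (D ℕ.* n ℕ.+ C)) w f
  generates⇒counts {E = E} D C {w} weight p = Count.counted λ n → parity-≅ (record
      { to = λ (i , e) → i , trans (weight i) (cong (λ z → + (D ℕ.* z ℕ.+ C)) e)
      ; from = λ (i , e) → i , ℕP.*-cancelˡ-≡ (E i) n D (ℕP.+-cancelʳ-≡ C _ _ (+-injective (trans (sym (weight i)) e)))
      ; to-from = λ (i , e) → fiber-≡ {w = w} refl ; from-to = λ (i , e) → cong (i ,_) (ℕ-uip _ e) })
    (p n)

  -- The three theta series Σ q^{(3z²+z)/2}, Σ q^{2z²+z}, Σ q^{3z²+2z} over z ∈ ℤ;
  -- the exponent e satisfies 24 e + mult = mult · root².
  data Kind : Set where
    𝖯 𝖳 𝖮 : Kind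

  mult : Kind → ℕ
  mult 𝖯 = 1
  mult 𝖳 = 3
  mult 𝖮 = 8

  root : Kind → ℤ → ℤ
  root 𝖯 z = + 6 * z + + 1
  root 𝖳 z = + 4 * z + + 1
  root 𝖮 z = + 3 * z + + 1

  expo : Kind → ℤ → ℕ
  expo 𝖯 (+ m) = m ℕ.* m ℕ.+ tri m
  expo 𝖯 -[1+ m ] = suc m ℕ.* suc m ℕ.+ tri m
  expo 𝖳 (+ m) = m ℕ.* suc (2 ℕ.* m)
  expo 𝖳 -[1+ m ] = suc m ℕ.* suc (2 ℕ.* m)
  expo 𝖮 (+ m) = m ℕ.* suc (suc (3 ℕ.* m))
  expo 𝖮 -[1+ m ] = suc m ℕ.* suc (3 ℕ.* m)

  2tri : ∀ m → + 2 * + tri m ≡ + m * + m + + m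
  2tri m = trans (sym (pos-* 2 (tri m))) (trans (cong +_ (go m)) (trans (pos-+ (m ℕ.* m) m) (cong (_+ + m) (pos-* m m))))
    where
    eq₁ : ∀ m t → 2 ℕ.* (suc m ℕ.+ t) ≡ 2 ℕ.* suc m ℕ.+ 2 ℕ.* t
    eq₁ = ℕS.solve-∀
    eq₂ : ∀ m → 2 ℕ.* suc m ℕ.+ (m ℕ.* m ℕ.+ m) ≡ suc m ℕ.* suc m ℕ.+ suc m
    eq₂ = ℕS.solve-∀
    go : ∀ m → 2 ℕ.* tri m ≡ m ℕ.* m ℕ.+ m
    go zero = refl
    go (suc m) = trans (eq₁ m (tri m)) (trans (cong (2 ℕ.* suc m ℕ.+_) (go m)) (eq₂ m))

  private
    cast : ∀ a x b → + (a ℕ.* x ℕ.+ b) ≡ + a * + x + + b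
    cast a x b = trans (pos-+ (a ℕ.* x) b) (cong (_+ + b) (pos-* a x))

  weight : ∀ κ z → + mult κ * (root κ z * root κ z) ≡ + (24 ℕ.* expo κ z ℕ.+ mult κ)
  weight 𝖯 (+ m) = sym (trans (cast 24 (m ℕ.* m ℕ.+ tri m) 1) (trans (cong (λ x → + 24 * x + + 1) (cast m m (tri m)))
    (trans (eq₁ (+ m) (+ tri m)) (trans (cong (λ x → + 24 * (+ m * + m) + + 12 * x + + 1) (2tri m)) (eq₂ (+ m))))))
    where
    eq₁ : ∀ M T → + 24 * (M * M + T) + + 1 ≡ + 24 * (M * M) + + 12 * (+ 2 * T) + + 1
    eq₁ = solve-∀
    eq₂ : ∀ M → + 24 * (M * M) + + 12 * (M * M + M) + + 1 ≡ + 1 * ((+ 6 * M + + 1) * (+ 6 * M + + 1))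
    eq₂ = solve-∀
  weight 𝖯 -[1+ m ] = sym (trans (cast 24 (suc m ℕ.* suc m ℕ.+ tri m) 1) (trans (cong (λ x → + 24 * x + + 1) (cast (suc m) (suc m) (tri m)))
    (trans (cong (λ x → + 24 * (x * x + + tri m) + + 1) (pos-+ 1 m))
    (trans (eq₁ (+ m) (+ tri m)) (trans (cong (λ x → + 24 * ((+ 1 + + m) * (+ 1 + + m)) + + 12 * x + + 1) (2tri m)) (trans (eq₂ (+ m)) (cong (λ x → + 1 * ((+ 6 * x + + 1) * (+ 6 * x + + 1))) (cong -_ (sym (pos-+ 1 m))))))))))
    where
    eq₁ : ∀ M T → + 24 * ((+ 1 + M) * (+ 1 + M) + T) + + 1 ≡ + 24 * ((+ 1 + M) * (+ 1 + M)) + + 12 * (+ 2 * T) + + 1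
    eq₁ = solve-∀
    eq₂ : ∀ M → + 24 * ((+ 1 + M) * (+ 1 + M)) + + 12 * (M * M + M) + + 1 ≡ + 1 * ((+ 6 * (- (+ 1 + M)) + + 1) * (+ 6 * (- (+ 1 + M)) + + 1))
    eq₂ = solve-∀
  weight 𝖳 (+ m) = sym (trans (cast 24 (m ℕ.* suc (2 ℕ.* m)) 3) (trans (cong (λ x → + 24 * x + + 3) (trans (pos-* m (suc (2 ℕ.* m))) (cong (_*_ (+ m)) (trans (pos-+ 1 (2 ℕ.* m)) (cong (_+_ (+ 1)) (pos-* 2 m)))))) (eq (+ m))))
    where
    eq : ∀ M → + 24 * (M * (+ 1 + + 2 * M)) + + 3 ≡ + 3 * ((+ 4 * M + + 1) * (+ 4 * M + + 1))
    eq = solve-∀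
  weight 𝖳 -[1+ m ] = sym (trans (cast 24 (suc m ℕ.* suc (2 ℕ.* m)) 3) (trans (cong (λ x → + 24 * x + + 3) (trans (pos-* (suc m) (suc (2 ℕ.* m))) (cong₂ _*_ (pos-+ 1 m) (trans (pos-+ 1 (2 ℕ.* m)) (cong (_+_ (+ 1)) (pos-* 2 m)))))) (trans (eq (+ m)) (cong (λ x → + 3 * ((+ 4 * x + + 1) * (+ 4 * x + + 1))) (cong -_ (sym (pos-+ 1 m)))))))
    where
    eq : ∀ M → + 24 * ((+ 1 + M) * (+ 1 + + 2 * M)) + + 3 ≡ + 3 * ((+ 4 * (- (+ 1 + M)) + + 1) * (+ 4 * (- (+ 1 + M)) + + 1))
    eq = solve-∀
  weight 𝖮 (+ m) = sym (trans (cast 24 (m ℕ.* suc (suc (3 ℕ.* m))) 8) (trans (cong (λ x → + 24 * x + + 8) (trans (pos-* m (2 ℕ.+ 3 ℕ.* m)) (cong (_*_ (+ m)) (trans (pos-+ 2 (3 ℕ.* m)) (cong (_+_ (+ 2)) (pos-* 3 m)))))) (eq (+ m))))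
    where
    eq : ∀ M → + 24 * (M * (+ 2 + + 3 * M)) + + 8 ≡ + 8 * ((+ 3 * M + + 1) * (+ 3 * M + + 1))
    eq = solve-∀
  weight 𝖮 -[1+ m ] = sym (trans (cast 24 (suc m ℕ.* suc (3 ℕ.* m)) 8) (trans (cong (λ x → + 24 * x + + 8) (trans (pos-* (suc m) (suc (3 ℕ.* m))) (cong₂ _*_ (pos-+ 1 m) (trans (pos-+ 1 (3 ℕ.* m)) (cong (_+_ (+ 1)) (pos-* 3 m)))))) (trans (eq (+ m)) (cong (λ x → + 8 * ((+ 3 * x + + 1) * (+ 3 * x + + 1))) (cong -_ (sym (pos-+ 1 m)))))))
    where
    eq : ∀ M → + 24 * ((+ 1 + M) * (+ 1 + + 3 * M)) + + 8 ≡ + 8 * ((+ 3 * (- (+ 1 + M)) + + 1) * (+ 3 * (- (+ 1 + M)) + + 1))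
    eq = solve-∀

  n≤n*n : ∀ n → n ≤ n ℕ.* n
  n≤n*n zero = z≤n
  n≤n*n (suc n) = ℕP.m≤m*n (suc n) (suc n)

  expo-proper : ∀ κ → Proper (expo κ)
  expo-proper 𝖯 (+ m) = ℕP.≤-trans (n≤n*n m) (ℕP.m≤m+n _ _)
  expo-proper 𝖯 -[1+ m ] = ℕP.≤-trans (n≤n*n (suc m)) (ℕP.m≤m+n _ _)
  expo-proper 𝖳 (+ m) = ℕP.m≤m*n m _
  expo-proper 𝖳 -[1+ m ] = ℕP.m≤m*n (suc m) _
  expo-proper 𝖮 (+ m) = ℕP.m≤m*n m _
  expo-proper 𝖮 -[1+ m ] = ℕP.m≤m*n (suc m) _

  Θ : Kind → ℕ → Ser
  Θ κ k = theta λ z → k ℕ.* expo κ z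

  P ψ Ω : ℕ → Ser
  P = Θ 𝖯
  ψ = Θ 𝖳
  Ω = Θ 𝖮

  Θ-proper : ∀ κ k .{{_ : ℕ.NonZero k}} → Proper λ z → k ℕ.* expo κ z
  Θ-proper κ k z = ℕP.≤-trans (expo-proper κ z) (ℕP.m≤n*m (expo κ z) k)

  Θ-generates : ∀ κ k .{{_ : ℕ.NonZero k}} → Generates (λ z → k ℕ.* expo κ z) (Θ κ k)
  Θ-generates κ k = theta-generates (Θ-proper κ k)

  Θ-dilate : ∀ κ k .{{_ : ℕ.NonZero k}} → dilate (Θ κ k) ≈ Θ κ (2 ℕ.* k)
  Θ-dilate κ k = generates-unique (λ z → sym (ℕP.*-assoc 2 k (expo κ z))) (generates-dilate (Θ-generates κ k)) (Θ-generates κ (2 ℕ.* k) {{ℕP.m*n≢0 2 k}})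

  Θ-square : ∀ κ k .{{_ : ℕ.NonZero k}} → Θ κ k · Θ κ k ≈ Θ κ (2 ℕ.* k)
  Θ-square κ k = ≈-trans (square (Θ κ k)) (Θ-dilate κ k)

  P-head : ∀ k → P k 0 ≡ true
  P-head zero = refl
  P-head (suc k) = trans (xor-identityʳ _) (cong (λ a → mono a 0) (ℕP.*-zeroʳ k))

  -- The two exponents added by each step of `pent` are those of `expo 𝖯` at -(n + 1) and n + 1, so
  -- the partial sums are the boxes of the theta series.
  euler-P : ∀ i n → 0 < i → euler i n ≈[ n ] P i
  euler-P i n i>0 j j≤n = trans (Pentagonal.euler-pent i n i>0 j j≤n) (trans (pent-box n j) (sym (theta-box (Θ-proper 𝖯 i {{ℕ.>-nonZero i>0}}) n j j≤n)))
    where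
    pent-box : ∀ n → Pentagonal.pent i n ≈ box (λ z → i ℕ.* expo 𝖯 z) n
    pent-box zero j = sym (trans (xor-identityʳ _) (cong (λ a → mono a j) (ℕP.*-zeroʳ i)))
    pent-box (suc n) j = trans (cong (_xor last) (pent-box n j)) (trans (xor-assoc (mono (i ℕ.* 0) j) _ last)
      (cong (mono (i ℕ.* 0) j xor_) (sym (xorSum-last n (λ m → mono (i ℕ.* expo 𝖯 -[1+ m ]) j xor mono (i ℕ.* expo 𝖯 (+ suc m)) j)))))
      where
      last = mono (i ℕ.* expo 𝖯 -[1+ n ]) j xor mono (i ℕ.* expo 𝖯 (+ suc n)) j

  quad : ℤ → ℤ → ℤ → ℤ → ℤ
  quad α β x y = α * (x * x) + β * (y * y)

  scaled : ∀ D κ a k → 24 ℕ.* a ≡ D ℕ.* k → ∀ z → + (a ℕ.* mult κ) * (root κ z * root κ z) ≡ + (D ℕ.* (k ℕ.* expo κ z) ℕ.+ a ℕ.* mult κ)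
  scaled D κ a k e z = trans (cong (_* (root κ z * root κ z)) (pos-* a (mult κ))) (trans (*-assoc (+ a) (+ mult κ) (root κ z * root κ z))
    (trans (cong (_*_ (+ a)) (weight κ z)) (trans (sym (pos-* a _)) (cong +_ (trans (eq a (expo κ z) (mult κ)) (cong (ℕ._+ a ℕ.* mult κ) (trans (cong (ℕ._* expo κ z) e) (ℕP.*-assoc D k (expo κ z)))))))))
    where
    eq : ∀ a x m → a ℕ.* (24 ℕ.* x ℕ.+ m) ≡ 24 ℕ.* a ℕ.* x ℕ.+ a ℕ.* m
    eq = ℕS.solve-∀

  progression : ℕ → ℕ → ℕ → ℤ
  progression D C n = + (D ℕ.* n ℕ.+ C)

  module Std (D C : ℕ) .{{D≢0 : ℕ.NonZero D}} where
    open Lattice (progression D C) public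

    Θ-counts : ∀ κ a k s .{{_ : ℕ.NonZero k}} → 24 ℕ.* a ≡ D ℕ.* k → a ℕ.* mult κ ≡ D ℕ.* s ℕ.+ C →
      Counts (λ z → + (a ℕ.* mult κ) * (root κ z * root κ z)) (mono s · Θ κ k)
    Θ-counts κ a k s e₁ e₂ = generates⇒counts D C
      (λ z → trans (scaled D κ a k e₁ z) (cong +_ (trans (cong (D ℕ.* (k ℕ.* expo κ z) ℕ.+_) e₂) (eq D (k ℕ.* expo κ z) s C))))
      (generates-mono (Θ-generates κ k) s)
      where
      eq : ∀ D x s C → D ℕ.* x ℕ.+ (D ℕ.* s ℕ.+ C) ≡ D ℕ.* (s ℕ.+ x) ℕ.+ C
      eq = ℕS.solve-∀

    -- Completing squares on both exponents turns q^n into the value D n + C of a diagonal form. D =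
    -- 24 fits whole series; 48 and 96 fit sections, whose index was halved once or twice. The shift
    -- s absorbs a constant differing from C.
    ΘΘ-counts : ∀ κ a k κ' a' k' s .{{_ : ℕ.NonZero k}} .{{_ : ℕ.NonZero k'}} → 24 ℕ.* a ≡ D ℕ.* k → 24 ℕ.* a' ≡ D ℕ.* k' →
      a ℕ.* mult κ ℕ.+ a' ℕ.* mult κ' ≡ D ℕ.* s ℕ.+ C →
      Counts₂ (λ y z → quad (+ (a ℕ.* mult κ)) (+ (a' ℕ.* mult κ')) (root κ y) (root κ' z)) (mono s · (Θ κ k · Θ κ' k'))
    ΘΘ-counts κ a k κ' a' k' s e₁ e₂ e₃ = generates⇒counts D C
      (λ (y , z) → trans (cong₂ _+_ (scaled D κ a k e₁ y) (scaled D κ' a' k' e₂ z))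
        (trans (sym (pos-+ (D ℕ.* (k ℕ.* expo κ y) ℕ.+ a ℕ.* mult κ) _)) (cong +_ (trans (eq₁ (D ℕ.* (k ℕ.* expo κ y)) (D ℕ.* (k' ℕ.* expo κ' z)) (a ℕ.* mult κ) (a' ℕ.* mult κ'))
          (trans (cong (D ℕ.* (k ℕ.* expo κ y) ℕ.+ D ℕ.* (k' ℕ.* expo κ' z) ℕ.+_) e₃) (eq₂ D (k ℕ.* expo κ y) (k' ℕ.* expo κ' z) s C))))))
      (generates-mono (generates-· (Θ-generates κ k) (Θ-generates κ' k')) s)
      where
      eq₁ : ∀ x y a b → (x ℕ.+ a) ℕ.+ (y ℕ.+ b) ≡ x ℕ.+ y ℕ.+ (a ℕ.+ b)
      eq₁ = ℕS.solve-∀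
      eq₂ : ∀ D x y s C → D ℕ.* x ℕ.+ D ℕ.* y ℕ.+ (D ℕ.* s ℕ.+ C) ≡ D ℕ.* (s ℕ.+ (x ℕ.+ y)) ℕ.+ C
      eq₂ = ℕS.solve-∀

    -- Only the finiteness of the fibres matters here, hence the anonymous series.
    quad-counts : ∀ α β .{{_ : ℕ.NonZero α}} .{{_ : ℕ.NonZero β}} → ∃ (Counts₂ (λ b z → quad (+ α) (+ β) (+ 4 * b + + 1) z))
    quad-counts α β = _ , counted λ n → subst (λ v → Parity (Fiber w (+ v)) (series (D ℕ.* n ℕ.+ C))) (trans (ℕP.+-identityʳ _) (ℕP.*-identityˡ _)) (Count.at all (D ℕ.* n ℕ.+ C))
      where
      w : ℤ × ℤ → ℤ
      w (b , z) = quad (+ α) (+ β) (+ 4 * b + + 1) z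
      E₁ E₂ : ℤ → ℕ
      E₁ b = α ℕ.* suc (8 ℕ.* expo 𝖳 b)
      E₂ z = β ℕ.* (∣ z ∣ ℕ.* ∣ z ∣)
      series : Ser
      series = theta E₁ · theta E₂
      sq : ∀ z → z * z ≡ + (∣ z ∣ ℕ.* ∣ z ∣)
      sq (+ m) = sym (pos-* m m)
      sq -[1+ m ] = refl
      p₁ : Proper E₁
      p₁ b = ℕP.≤-trans (expo-proper 𝖳 b) (ℕP.≤-trans (ℕP.m≤n*m (expo 𝖳 b) 8) (ℕP.≤-trans (ℕP.n≤1+n _) (ℕP.m≤n*m _ α)))
      p₂ : Proper E₂
      p₂ z = ℕP.≤-trans (n≤n*n ∣ z ∣) (ℕP.m≤n*m _ β)
      square₈ : ∀ b → (+ 4 * b + + 1) * (+ 4 * b + + 1) ≡ + suc (8 ℕ.* expo 𝖳 b)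
      square₈ b = *-cancelˡ-≡ (+ 3) _ _ (trans (weight 𝖳 b) (trans (cong +_ (eq (expo 𝖳 b))) (pos-* 3 (suc (8 ℕ.* expo 𝖳 b)))))
        where
        eq : ∀ e → 24 ℕ.* e ℕ.+ 3 ≡ 3 ℕ.* suc (8 ℕ.* e)
        eq = ℕS.solve-∀
      first : ∀ b → + α * ((+ 4 * b + + 1) * (+ 4 * b + + 1)) ≡ + (α ℕ.* suc (8 ℕ.* expo 𝖳 b))
      first b = trans (cong (_*_ (+ α)) (square₈ b)) (sym (pos-* α _))
      all : Count.Counts (progression 1 0) w series
      all = generates⇒counts 1 0
        (λ (b , z) → trans (cong₂ _+_ (first b) (trans (cong (_*_ (+ β)) (sq z)) (sym (pos-* β _)))) (trans (sym (pos-+ (E₁ b) (E₂ z))) (cong +_ (sym (trans (ℕP.+-identityʳ _) (ℕP.*-identityˡ _))))))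
        (generates-· (theta-generates {E₁} p₁) (theta-generates {E₂} p₂))

  -- Substitutions in forms even in both variables

  record Even₂ (F : ℤ → ℤ → ℤ) : Set where
    field
      evˡ : ∀ x y → F (- x) y ≡ F x y
      evʳ : ∀ x y → F x (- y) ≡ F x y

    neg-l : ∀ {x x' y y'} → x ≡ - x' → y ≡ y' → F x y ≡ F x' y'
    neg-l e e' = trans (cong₂ F e e') (evˡ _ _)

    neg-r : ∀ {x x' y y'} → x ≡ x' → y ≡ - y' → F x y ≡ F x' y'
    neg-r e e' = trans (cong₂ F e e') (evʳ _ _)

    neg : ∀ {x x' y y'} → x ≡ - x' → y ≡ - y' → F x y ≡ F x' y'
    neg e e' = trans (cong₂ F e e') (trans (evˡ _ _) (evʳ _ _))

  flip-even : ∀ {F} → Even₂ F → Even₂ (λ x y → F y x)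
  flip-even ev = record { evˡ = λ x y → Even₂.evʳ ev y x ; evʳ = λ x y → Even₂.evˡ ev y x }

  quad-even : ∀ α β → Even₂ (quad α β)
  quad-even α β = record { evˡ = λ x y → eq₁ α β x y ; evʳ = λ x y → eq₂ α β x y }
    where
    eq₁ : ∀ α β x y → α * (- x * - x) + β * (y * y) ≡ α * (x * x) + β * (y * y)
    eq₁ = solve-∀
    eq₂ : ∀ α β x y → α * (x * x) + β * (- y * - y) ≡ α * (x * x) + β * (y * y)
    eq₂ = solve-∀

  module LatticeLemmas (v : ℕ → ℤ) where
    open Lattice v

    reflect₁ : ∀ {w w' : ℤ → ℤ} {f} c → (∀ z → w (c - z) ≡ w' z) → Counts w f → Counts w' f
    reflect₁ c eq = reindex (record
        { to = λ z → c - z ; from = λ z → c - z ; to-from = inv c ; from-to = inv c }) eq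
      where
      inv : ∀ c z → c - (c - z) ≡ z
      inv = solve-∀

    pointwise₁ : ∀ {w w' : ℤ → ℤ} {f} → (∀ z → w z ≡ w' z) → Counts w f → Counts w' f
    pointwise₁ = reindex ≅-refl

    ⊕-𝟘ʳ : ∀ {f g h} → f ≈ g ⊕ h → h ≈ 𝟘 → g ≈ f
    ⊕-𝟘ʳ {f} {g} {h} e z n = sym (trans (e n) (trans (cong (g n xor_) (z n)) (xor-identityʳ (g n))))

    ⊕-𝟘ˡ : ∀ {f g h} → f ≈ g ⊕ h → g ≈ 𝟘 → h ≈ f
    ⊕-𝟘ˡ {f} {g} {h} e z n = sym (trans (e n) (cong (_xor h n) (z n)))

    module _ {F : ℤ → ℤ → ℤ} (ev : Even₂ F) where
      open Even₂ ev

      -- Pairs of odd numbers congruent mod 3, up to a common sign: those prime to 3 have a unique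
      -- representative with both entries ≡ 1 (mod 6), and those divisible by 3 cancel under y ↦ - y.
      mod4→mod6 : ∀ {f} → Counts₂ (λ b c → F (+ 4 * b + + 1) (+ 4 * b + + 1 + + 6 * c)) f →
                  Counts₂ (λ a c → F (+ 6 * a + + 1) (+ 6 * c + + 1)) f
      mod4→mod6 c =
        case split₃ (swapped c) of λ { (splits₃ {g₀} {g₁} {g₂} c₀ c₁ c₂ e) →
        let
            d₀ = shear {w' = λ b c → F (+ 6 * (+ 2 * b) + + 1) (+ 6 * c + + 1)}
                   (λ b → - (+ 2 * b)) (λ b c → cong₂ F (e₁ b) (e₂ b c)) (swapped c₀)
            d₁ = reflect {w' = λ b c → F (+ 4 * (+ 3 * b + + 1) + + 1) (+ 6 * c + + 1)}
                   (λ b → - (+ 2 * b) - + 1) (λ b c → neg-r refl (e₃ b c)) (swapped c₁)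
            d₁' = reflect {w' = λ c b → F (+ 6 * (+ 2 * b + + 1) + + 1) (+ 6 * c + + 1)}
                   (λ _ → - (+ 1)) (λ c b → neg-l (e₄ b) refl) (swapped d₁)
            d₂ = shear {w' = λ b c → F (+ 4 * (+ 3 * b + + 2) + + 1) (+ 6 * c + + 3)}
                   (λ b → - (+ 2 * b) - + 1) (λ b c → cong₂ F refl (e₅ b c)) (swapped c₂)
            z₂ = odd-cancel (λ b c → neg-r refl (e₆ c)) d₂
            m = merge₂ {w = λ c a → F (+ 6 * a + + 1) (+ 6 * c + + 1)} (swapped d₀) d₁'
        in swapped (counts-≈ (⊕-𝟘ʳ (λ n → trans (e n) (sym (xor-assoc (g₀ n) (g₁ n) (g₂ n)))) z₂) m) }
        where
        e₁ : ∀ b → + 4 * (+ 3 * b) + + 1 ≡ + 6 * (+ 2 * b) + + 1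
        e₁ = solve-∀
        e₂ : ∀ b c → + 4 * (+ 3 * b) + + 1 + + 6 * (c + - (+ 2 * b)) ≡ + 6 * c + + 1
        e₂ = solve-∀
        e₃ : ∀ b c → + 4 * (+ 3 * b + + 1) + + 1 + + 6 * (- (+ 2 * b) - + 1 - c) ≡ - (+ 6 * c + + 1)
        e₃ = solve-∀
        e₄ : ∀ b → + 4 * (+ 3 * (- (+ 1) - b) + + 1) + + 1 ≡ - (+ 6 * (+ 2 * b + + 1) + + 1)
        e₄ = solve-∀
        e₅ : ∀ b c → + 4 * (+ 3 * b + + 2) + + 1 + + 6 * (c + (- (+ 2 * b) - + 1)) ≡ + 6 * c + + 3
        e₅ = solve-∀
        e₆ : ∀ c → + 6 * (- c - + 1) + + 3 ≡ - (+ 6 * c + + 3)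
        e₆ = solve-∀

      -- As in `mod4→mod6`, but the second entry has arbitrary parity. Among pairs divisible by 3
      -- the reflection y ↦ -y now fixes y = 0, which leaves an extra one-variable part.
      mod4→mod6,3 : ∀ {f} → Counts₂ (λ b c → F (+ 4 * b + + 1) (+ 4 * b + + 1 + + 3 * c)) f →
                  Splits (λ b → F (+ 3 * (+ 4 * b + + 1)) (+ 0)) (uncurry λ a c → F (+ 6 * a + + 1) (+ 3 * c + + 1)) f
      mod4→mod6,3 c =
        case split₃ (swapped c) of λ { (splits₃ {g₀} {g₁} {g₂} c₀ c₁ c₂ e) →
        let
            d₀ = shear {w' = λ b c → F (+ 6 * (+ 2 * b) + + 1) (+ 3 * c + + 1)}
                   (λ b → - (+ 4 * b)) (λ b c → cong₂ F (e₁ b) (e₂ b c)) (swapped c₀)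
            d₁ = reflect {w' = λ b c → F (+ 4 * (+ 3 * b + + 1) + + 1) (+ 3 * c + + 1)}
                   (λ b → - (+ 4 * b) - + 2) (λ b c → neg-r refl (e₃ b c)) (swapped c₁)
            d₁' = reflect {w' = λ c b → F (+ 6 * (+ 2 * b + + 1) + + 1) (+ 3 * c + + 1)}
                   (λ _ → - (+ 1)) (λ c b → neg-l (e₄ b) refl) (swapped d₁)
            d₂ = shear {w' = λ b c → F (+ 4 * (+ 3 * b + + 2) + + 1) (+ 3 * c)}
                   (λ b → - (+ 4 * b) - + 3) (λ b c → cong₂ F refl (e₅ b c)) (swapped c₂)
            d₂' = even-cancel (λ b c → neg-r refl (e₆ c)) d₂
            d₂'' = reflect₁ {w' = λ b → F (+ 3 * (+ 4 * b + + 1)) (+ 0)} (- (+ 1)) (λ b → neg-l (e₇ b) refl) d₂'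
            m = merge₂ {w = λ c a → F (+ 6 * a + + 1) (+ 3 * c + + 1)} (swapped d₀) d₁'
        in splits d₂'' (swapped m) (≈-trans e (rot g₀ g₁ g₂)) }
        where
        rot : ∀ a b c → a ⊕ (b ⊕ c) ≈ c ⊕ (a ⊕ b)
        rot = solve 3 (λ a b c → a :+ (b :+ c) := c :+ (a :+ b)) ≈-refl
        e₁ : ∀ b → + 4 * (+ 3 * b) + + 1 ≡ + 6 * (+ 2 * b) + + 1
        e₁ = solve-∀
        e₂ : ∀ b c → + 4 * (+ 3 * b) + + 1 + + 3 * (c + - (+ 4 * b)) ≡ + 3 * c + + 1
        e₂ = solve-∀
        e₃ : ∀ b c → + 4 * (+ 3 * b + + 1) + + 1 + + 3 * (- (+ 4 * b) - + 2 - c) ≡ - (+ 3 * c + + 1)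
        e₃ = solve-∀
        e₄ : ∀ b → + 4 * (+ 3 * (- (+ 1) - b) + + 1) + + 1 ≡ - (+ 6 * (+ 2 * b + + 1) + + 1)
        e₄ = solve-∀
        e₅ : ∀ b c → + 4 * (+ 3 * b + + 2) + + 1 + + 3 * (c + (- (+ 4 * b) - + 3)) ≡ + 3 * c
        e₅ = solve-∀
        e₆ : ∀ c → + 3 * - c ≡ - (+ 3 * c)
        e₆ = solve-∀
        e₇ : ∀ b → + 4 * (+ 3 * (- (+ 1) - b) + + 2) + + 1 ≡ - (+ 3 * (+ 4 * b + + 1))
        e₇ = solve-∀

      -- Choosing the sign of the first entry so that it is congruent to the second one mod 4.
      align : ∀ {f} → Counts₂ (λ b a → F (+ 4 * b + + 1) (+ 6 * a + + 1)) f → Counts₂ (λ w a → F (+ 6 * a + + 1 - + 4 * w) (+ 6 * a + + 1)) f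
      align c =
        case split₂ c of λ { (splits {g} {h} cg ch e) →
        let
            d₀ = reflect {w' = λ a w → F (+ 6 * (+ 2 * a) + + 1 - + 4 * w) (+ 6 * (+ 2 * a) + + 1)}
                   (λ a → + 3 * a) (λ a w → cong₂ F (e₁ a w) refl) (swapped cg)
            d₁ = shear {w' = λ a w → F (+ 6 * (+ 2 * a + + 1) + + 1 - + 4 * w) (+ 6 * (+ 2 * a + + 1) + + 1)}
                   (λ a → - (+ 3 * a) - + 2) (λ a w → neg-l (e₂ a w) refl) (swapped ch)
            m = merge₂ {w = λ w a → F (+ 6 * a + + 1 - + 4 * w) (+ 6 * a + + 1)} (swapped d₀) (swapped d₁)
        in counts-≈ (≈-sym e) m }
        where
        e₁ : ∀ a w → + 4 * (+ 3 * a - w) + + 1 ≡ + 6 * (+ 2 * a) + + 1 - + 4 * w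
        e₁ = solve-∀
        e₂ : ∀ a w → + 4 * (w + (- (+ 3 * a) - + 2)) + + 1 ≡ - (+ 6 * (+ 2 * a + + 1) + + 1 - + 4 * w)
        e₂ = solve-∀

      unalign : ∀ {f} → Counts₂ (λ w a → F (+ 6 * a + + 1 - + 4 * w) (+ 6 * a + + 1)) f → Counts₂ (λ b a → F (+ 4 * b + + 1) (+ 6 * a + + 1)) f
      unalign c =
        case split₂ c of λ { (splits {g} {h} cg ch e) →
        let
            d₀ = reflect {w' = λ a b → F (+ 4 * b + + 1) (+ 6 * (+ 2 * a) + + 1)}
                   (λ a → + 3 * a) (λ a w → cong₂ F (e₁ a w) refl) (swapped cg)
            d₁ = shear {w' = λ a b → F (+ 4 * b + + 1) (+ 6 * (+ 2 * a + + 1) + + 1)}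
                   (λ a → + 3 * a + + 2) (λ a w → neg-l (e₂ a w) refl) (swapped ch)
            m = merge₂ {w = λ b a → F (+ 4 * b + + 1) (+ 6 * a + + 1)} (swapped d₀) (swapped d₁)
        in counts-≈ (≈-sym e) m }
        where
        e₁ : ∀ a w → + 6 * (+ 2 * a) + + 1 - + 4 * (+ 3 * a - w) ≡ + 4 * w + + 1
        e₁ = solve-∀
        e₂ : ∀ a w → + 6 * (+ 2 * a + + 1) + + 1 - + 4 * (w + (+ 3 * a + + 2)) ≡ - (+ 4 * w + + 1)
        e₂ = solve-∀

      -- The source consists of odd pairs with x - y ≡ 2 (mod 8). For x, y ≡ 1 (mod 4), x + y is 2
      -- or 6 mod 8, so exactly one of the four sign choices, (x , -y) or (-x , y), meets this
      -- condition.
      mod8→mod4 : ∀ {f} → Counts₂ (λ b d → F (+ 8 * b + + 2 * d + + 3) (+ 2 * d + + 1)) f → Counts₂ (λ a e → F (+ 4 * a + + 1) (+ 4 * e + + 1)) f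
      mod8→mod4 c =
        case split₂ c of λ { (splits {g} {h} cg ch e) →
        let
            d₀ = pointwise {w' = λ b d → F (+ 4 * (+ 2 * b + + 1 + d) + + 1 - + 2) (+ 4 * d + + 1)}
                   (λ b d → cong₂ F (e₁ b d) (e₁' d)) cg
            d₀' = reflect {w' = λ d b → F (+ 4 * ((+ 2 * b + + 1) - d) + + 1) (+ 4 * d + + 1)}
                   (λ _ → - (+ 1)) (λ d b → neg-l (e₂ b d) refl) (swapped d₀)
            d₁ = reflect {w' = λ b d → F (+ 4 * (+ 2 * b - d) + + 1) (+ 4 * d + + 1)}
                   (λ _ → - (+ 1)) (λ b d → neg-r (e₃ b d) (e₃' d)) ch
            m = merge₂ {w = λ d s → F (+ 4 * (s - d) + + 1) (+ 4 * d + + 1)} (swapped d₁) d₀'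
            t = shear {w' = λ d a → F (+ 4 * a + + 1) (+ 4 * d + + 1)} (λ d → d) (λ d a → cong₂ F (e₄ d a) refl) m
        in swapped (counts-≈ (≈-trans (comm h g) (≈-sym e)) t) }
        where
        comm : ∀ a b → a ⊕ b ≈ b ⊕ a
        comm = solve 2 (λ a b → a :+ b := b :+ a) ≈-refl
        e₁ : ∀ b d → + 8 * b + + 2 * (+ 2 * d) + + 3 ≡ + 4 * (+ 2 * b + + 1 + d) + + 1 - + 2
        e₁ = solve-∀
        e₁' : ∀ d → + 2 * (+ 2 * d) + + 1 ≡ + 4 * d + + 1
        e₁' = solve-∀
        e₂ : ∀ b d → + 4 * (+ 2 * (- (+ 1) - b) + + 1 + d) + + 1 - + 2 ≡ - (+ 4 * ((+ 2 * b + + 1) - d) + + 1)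
        e₂ = solve-∀
        e₃ : ∀ b d → + 8 * b + + 2 * (+ 2 * (- (+ 1) - d) + + 1) + + 3 ≡ + 4 * (+ 2 * b - d) + + 1
        e₃ = solve-∀
        e₃' : ∀ d → + 2 * (+ 2 * (- (+ 1) - d) + + 1) + + 1 ≡ - (+ 4 * d + + 1)
        e₃' = solve-∀
        e₄ : ∀ d a → + 4 * (a + d - d) + + 1 ≡ + 4 * a + + 1
        e₄ = solve-∀

      -- For fixed k the first entry runs over one odd class mod 4, determined by the parity of k,
      -- so k ↦ -k acts on the second entry alone. Only k = 0 survives.
      diagonal : ∀ {f} → Counts₂ (λ b k → F (+ 4 * b + + 1 + + 2 * k) k) f → Counts (λ b → F (+ 4 * b + + 1) (+ 0)) f
      diagonal c =
        case split₂ c of λ { (splits {g} {h} cg ch e) →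
        let
            d₀ = shear {w' = λ k b → F (+ 4 * b + + 1) (+ 2 * k)} (λ k → - k) (λ k b → cong₂ F (e₁ k b) refl) (swapped cg)
            d₀' = even-cancel (λ b k → neg-r refl (e₂ k)) (swapped d₀)
            d₁ = shear {w' = λ k b → F (+ 4 * b + + 3) (+ 2 * k + + 1)} (λ k → - k) (λ k b → cong₂ F (e₃ k b) refl) (swapped ch)
            z₁ = odd-cancel (λ b k → neg-r refl (e₄ k)) (swapped d₁)
        in counts-≈ (⊕-𝟘ʳ e z₁) d₀' }
        where
        e₁ : ∀ k b → + 4 * (b + - k) + + 1 + + 2 * (+ 2 * k) ≡ + 4 * b + + 1
        e₁ = solve-∀
        e₂ : ∀ k → + 2 * - k ≡ - (+ 2 * k)
        e₂ = solve-∀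
        e₃ : ∀ k b → + 4 * (b + - k) + + 1 + + 2 * (+ 2 * k + + 1) ≡ + 4 * b + + 3
        e₃ = solve-∀
        e₄ : ∀ k → + 2 * (- k - + 1) + + 1 ≡ - (+ 2 * k + + 1)
        e₄ = solve-∀

      -- Here the first entry is even and gets reflected. Its class 2 mod 4 has no fixed point; the
      -- class 0 mod 4, which goes with second entries ≡ 3 (mod 4), leaves x = 0.
      antidiagonal : ∀ {f} → Counts₂ (λ b g → F (+ 4 * b + + 2 + + 2 * g) (+ 2 * g + + 1)) f → Counts (λ h → F (+ 0) (+ 4 * h + + 1)) f
      antidiagonal c =
        case split₂ c of λ { (splits {g} {h} cg ch e) →
        let
            d₀ = shear {w' = λ k b → F (+ 4 * b + + 2) (+ 2 * (+ 2 * k) + + 1)} (λ k → - k) (λ k b → cong₂ F (e₁ k b) refl) (swapped cg)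
            z₀ = odd-cancel (λ k b → neg-l (e₂ b) refl) d₀
            d₁ = shear {w' = λ k b → F (+ 4 * b) (+ 2 * (+ 2 * k + + 1) + + 1)} (λ k → - k - + 1) (λ k b → cong₂ F (e₃ k b) refl) (swapped ch)
            d₁' = even-cancel (λ k b → neg-l (e₄ b) refl) d₁
            d₁'' = reflect₁ {w' = λ k → F (+ 0) (+ 4 * k + + 1)} (- (+ 1)) (λ k → neg-r refl (e₅ k)) d₁'
        in counts-≈ (⊕-𝟘ˡ e z₀) d₁'' }
        where
        e₁ : ∀ k b → + 4 * (b + - k) + + 2 + + 2 * (+ 2 * k) ≡ + 4 * b + + 2
        e₁ = solve-∀
        e₂ : ∀ b → + 4 * (- b - + 1) + + 2 ≡ - (+ 4 * b + + 2)
        e₂ = solve-∀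
        e₃ : ∀ k b → + 4 * (b + (- k - + 1)) + + 2 + + 2 * (+ 2 * k + + 1) ≡ + 4 * b
        e₃ = solve-∀
        e₄ : ∀ b → + 4 * - b ≡ - (+ 4 * b)
        e₄ = solve-∀
        e₅ : ∀ k → + 2 * (+ 2 * (- (+ 1) - k) + + 1) + + 1 ≡ - (+ 4 * k + + 1)
        e₅ = solve-∀

    module _ {F : ℤ → ℤ → ℤ} (ev : Even₂ F) where
      open Even₂ ev

      -- Reflecting w disposes of w ≡ 2 (mod 4) and leaves w = 0 among the multiples of 4. For odd w
      -- the first entry, up to sign, is ≡ 1 (mod 6), and `unalign` makes the second free of it.
      skew : ∀ {f} → Counts₂ (λ a w → F (+ 2 * (+ 6 * a + + 1) - + 3 * w) w) f →
        Splits (λ a → F (+ 2 * (+ 6 * a + + 1)) (+ 0)) (uncurry λ a b → F (+ 6 * a + + 1) (+ 4 * b + + 1)) f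
      skew c =
        case split₂ c of λ { (splits {g} {h} cg ch e) →
        case split₂ cg of λ { (splits {g₀} {g₁} c₀ c₁ e') →
        let
            d₀ = shear {w' = λ k a → F (+ 2 * (+ 6 * a + + 1)) (+ 2 * (+ 2 * k))} (λ k → k) (λ k a → cong₂ F (e₁ k a) refl) (swapped c₀)
            d₀' = even-cancel (λ a k → neg-r refl (e₂ k)) (swapped d₀)
            d₁ = shear {w' = λ k a → F (+ 12 * a - + 4) (+ 2 * (+ 2 * k + + 1))} (λ k → k) (λ k a → cong₂ F (e₃ k a) refl) (swapped c₁)
            z₁ = odd-cancel (λ a k → neg-r refl (e₄ k)) (swapped d₁)
            d₂ = shear {w' = λ a k → F (+ 6 * k + + 1) (+ 2 * (k + + 2 * a) + + 1)} (λ a → + 2 * a) (λ a k → neg-l (e₅ a k) refl) ch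
            d₃ = reflect {w' = λ k w → F (+ 6 * k + + 1) (+ 6 * k + + 1 - + 4 * w)} (λ k → k) (λ k w → cong₂ F refl (e₆ k w)) (swapped d₂)
        in splits d₀' (swapped (unalign (flip-even ev) (swapped d₃))) (λ n → trans (e n) (cong (_xor h n) (sym (⊕-𝟘ʳ {g} {g₀} {g₁} e' z₁ n)))) } }
        where
        e₁ : ∀ k a → + 2 * (+ 6 * (a + k) + + 1) - + 3 * (+ 2 * (+ 2 * k)) ≡ + 2 * (+ 6 * a + + 1)
        e₁ = solve-∀
        e₂ : ∀ k → + 2 * (+ 2 * - k) ≡ - (+ 2 * (+ 2 * k))
        e₂ = solve-∀
        e₃ : ∀ k a → + 2 * (+ 6 * (a + k) + + 1) - + 3 * (+ 2 * (+ 2 * k + + 1)) ≡ + 12 * a - + 4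
        e₃ = solve-∀
        e₄ : ∀ k → + 2 * (+ 2 * (- k - + 1) + + 1) ≡ - (+ 2 * (+ 2 * k + + 1))
        e₄ = solve-∀
        e₅ : ∀ a k → + 2 * (+ 6 * a + + 1) - + 3 * (+ 2 * (k + + 2 * a) + + 1) ≡ - (+ 6 * k + + 1)
        e₅ = solve-∀
        e₆ : ∀ k w → + 2 * (k + + 2 * (k - w)) + + 1 ≡ + 6 * k + + 1 - + 4 * w
        e₆ = solve-∀

  even-counts : ∀ {I} {w : I → ℤ} {f} D C → Count.Counts (progression D C) w f → Count.Counts (progression (2 ℕ.* D) C) w (even f)
  even-counts {w = w} {f} D C c = Count.counted λ n →
    subst (λ v → Parity (Fiber w (+ v)) (even f n)) (trans (cong (λ m → D ℕ.* m ℕ.+ C) (double≡2* n)) (eq D C n)) (Count.at c (double n))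
    where
    eq : ∀ D C n → D ℕ.* (2 ℕ.* n) ℕ.+ C ≡ 2 ℕ.* D ℕ.* n ℕ.+ C
    eq = ℕS.solve-∀

  odd-counts : ∀ {I} {w : I → ℤ} {f} D C → Count.Counts (progression D C) w f → Count.Counts (progression (2 ℕ.* D) (D ℕ.+ C)) w (odd f)
  odd-counts {w = w} {f} D C c = Count.counted λ n →
    subst (λ v → Parity (Fiber w (+ v)) (odd f n)) (trans (cong (λ m → D ℕ.* suc m ℕ.+ C) (double≡2* n)) (eq D C n)) (Count.at c (suc (double n)))
    where
    eq : ∀ D C n → D ℕ.* suc (2 ℕ.* n) ℕ.+ C ≡ 2 ℕ.* D ℕ.* n ℕ.+ (D ℕ.+ C)
    eq = ℕS.solve-∀

  off-residue : ∀ d C r → 0 < r → r < suc d → ∀ {w} t n → w ≡ + suc d * t + + (r ℕ.+ C) → w ≢ progression (suc d) C n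
  off-residue d C r r>0 r<d t n e e' = multiple≢remainder d r (+ n - t) r>0 r<d
    (trans (eq₁ (+ suc d) (+ n) t (+ r) (+ C)) (trans (cong (λ z → z - (+ suc d * t + (+ r + + C)) + + r) key) (eq₂ (+ suc d * t + (+ r + + C)) (+ r))))
    where
    eq₁ : ∀ d n t r C → d * (n - t) ≡ d * n + C - (d * t + (r + C)) + r
    eq₁ = solve-∀
    eq₂ : ∀ x r → x - x + r ≡ r
    eq₂ = solve-∀
    key : + suc d * + n + + C ≡ + suc d * t + (+ r + + C)
    key = trans (sym (trans (pos-+ (suc d ℕ.* n) C) (cong (_+ + C) (pos-* (suc d) n)))) (trans (sym e') (trans e (cong (_+_ (+ suc d * t)) (pos-+ r C))))

  counts-off : ∀ {I} {w : I → ℤ} {f} d C r → 0 < r → r < suc d → (t : I → ℤ) → (∀ i → w i ≡ + suc d * t i + + (r ℕ.+ C)) →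
               Count.Counts (progression (suc d) C) w f → f ≈ 𝟘
  counts-off d C r r>0 r<d t e = Count.counts-empty _ λ i n → off-residue d C r r>0 r<d (t i) n (e i)

  -- Theta identities from binary quadratic forms

  module Base (D C : ℕ) .{{_ : ℕ.NonZero D}} where
    open Std D C

    -- Provides the finite index sets from which two evaluations of one count can start; the
    -- congruence classes below inherit finiteness by splitting.
    cone : ∀ α β .{{_ : ℕ.NonZero α}} .{{_ : ℕ.NonZero β}} → ∃ (Counts₂ (λ b c → quad (+ α) (+ β) (+ 4 * b + + 1) (+ 4 * b + + 1 + c)))
    cone α β = _ , shear (λ b → + 4 * b + + 1) (λ b c → cong (quad (+ α) (+ β) (+ 4 * b + + 1)) (eq b c)) (proj₂ (quad-counts α β))
      where
      eq : ∀ b c → c + (+ 4 * b + + 1) ≡ + 4 * b + + 1 + c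
      eq = solve-∀

    cone₃ : ∀ α β .{{_ : ℕ.NonZero α}} .{{_ : ℕ.NonZero β}} → ∃ (Counts₂ (λ b c → quad (+ α) (+ β) (+ 4 * b + + 1) (+ 4 * b + + 1 + + 3 * c)))
    cone₃ α β = case split₃ (proj₂ (cone α β)) of λ { (splits₃ {g₀} c₀ _ _ _) → g₀ , c₀ }

    cone₆ : ∀ α β .{{_ : ℕ.NonZero α}} .{{_ : ℕ.NonZero β}} → ∃ (Counts₂ (λ b c → quad (+ α) (+ β) (+ 4 * b + + 1) (+ 4 * b + + 1 + + 6 * c)))
    cone₆ α β = case split₂ (proj₂ (cone₃ α β)) of λ { (splits {g₀} c₀ _ _) →
      g₀ , pointwise (λ b c → cong (quad (+ α) (+ β) (+ 4 * b + + 1)) (eq b c)) c₀ }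
      where
      eq : ∀ b c → + 4 * b + + 1 + + 3 * (+ 2 * c) ≡ + 4 * b + + 1 + + 6 * c
      eq = solve-∀

  -- The pairs (y , y + 6c), y ≡ 1 (mod 4), are counted twice over. `mod4→mod6` yields the product
  -- on the left. Replacing y by y - 4c gives (y - 4c)² + 2 (y + 2c)² = 3y² + 24c², where c ↦ -c
  -- leaves c = 0.
  P·P : ∀ i .{{_ : ℕ.NonZero i}} → P i · P (2 ℕ.* i) ≈ ψ i
  P·P i = case cone₆ (i ℕ.* 1) (2 ℕ.* i ℕ.* 1) {{ℕP.m*n≢0 i 1}} {{ℕP.m*n≢0 (2 ℕ.* i) 1 {{ℕP.m*n≢0 2 i}}}} of λ { (f , c) →
    let c₁ = mod4→mod6 (quad-even (+ (i ℕ.* 1)) (+ (2 ℕ.* i ℕ.* 1))) c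
        p = ΘΘ-counts 𝖯 i i 𝖯 (2 ℕ.* i) (2 ℕ.* i) 0 {{it}} {{ℕP.m*n≢0 2 i}} refl refl refl
        c₂ = shear {w' = λ c b → + (i ℕ.* 3) * ((+ 4 * b + + 1) * (+ 4 * b + + 1)) + + 24 * + i * (c * c)} (λ c → - c) eq (swapped c)
        c₃ = pointwise₁ eq₀ (even-cancel (λ b c → eq₋ (+ (i ℕ.* 3)) (+ i) b c) (swapped c₂))
        q = Θ-counts 𝖳 i i 0 refl (eqC i)
    in ≈-trans (counts-unique₀ p c₁) (≈-sym (counts-unique₀ q c₃)) }
    where
    C = i ℕ.* 1 ℕ.+ 2 ℕ.* i ℕ.* 1
    open Std 24 C
    open Base 24 C
    open LatticeLemmas (progression 24 C)
    eqC : ∀ i → i ℕ.* 3 ≡ 24 ℕ.* 0 ℕ.+ (i ℕ.* 1 ℕ.+ 2 ℕ.* i ℕ.* 1)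
    eqC = ℕS.solve-∀
    ring : ∀ I c b → I * + 1 * ((+ 4 * (b + - c) + + 1) * (+ 4 * (b + - c) + + 1)) + + 2 * I * + 1 * ((+ 4 * (b + - c) + + 1 + + 6 * c) * (+ 4 * (b + - c) + + 1 + + 6 * c))
           ≡ I * + 3 * ((+ 4 * b + + 1) * (+ 4 * b + + 1)) + + 24 * I * (c * c)
    ring = solve-∀
    eq : ∀ c b → quad (+ (i ℕ.* 1)) (+ (2 ℕ.* i ℕ.* 1)) (+ 4 * (b + - c) + + 1) (+ 4 * (b + - c) + + 1 + + 6 * c)
           ≡ + (i ℕ.* 3) * ((+ 4 * b + + 1) * (+ 4 * b + + 1)) + + 24 * + i * (c * c)
    eq c b = trans (cong₂ (λ α β → quad α β (+ 4 * (b + - c) + + 1) (+ 4 * (b + - c) + + 1 + + 6 * c)) (pos-* i 1) (trans (pos-* (2 ℕ.* i) 1) (cong (_* + 1) (pos-* 2 i))))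
      (trans (ring (+ i) c b) (cong (λ γ → γ * ((+ 4 * b + + 1) * (+ 4 * b + + 1)) + + 24 * + i * (c * c)) (sym (pos-* i 3))))
    eq₋ : ∀ G I b c → G * ((+ 4 * b + + 1) * (+ 4 * b + + 1)) + + 24 * I * (- c * - c) ≡ G * ((+ 4 * b + + 1) * (+ 4 * b + + 1)) + + 24 * I * (c * c)
    eq₋ = solve-∀
    ring₀ : ∀ X I → X + + 24 * I * (+ 0 * + 0) ≡ X
    ring₀ = solve-∀
    eq₀ : ∀ b → + (i ℕ.* 3) * ((+ 4 * b + + 1) * (+ 4 * b + + 1)) + + 24 * + i * (+ 0 * + 0) ≡ + (i ℕ.* 3) * ((+ 4 * b + + 1) * (+ 4 * b + + 1))
    eq₀ b = ring₀ (+ (i ℕ.* 3) * ((+ 4 * b + + 1) * (+ 4 * b + + 1))) (+ i)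

  -- The pairs (y , y + 3c) under x² + 8y² have even fibres in total: a substitution turns the form
  -- into 3 (4b + 1)² + 6 (2c + 1)², even in an odd number. Hence the two parts found by
  -- `mod4→mod6,3` coincide.
  P·Ω : ∀ i .{{_ : ℕ.NonZero i}} → P i · Ω i ≈ ψ (3 ℕ.* i)
  P·Ω i = case cone₃ (i ℕ.* 1) (i ℕ.* 8) {{ℕP.m*n≢0 i 1}} {{ℕP.m*n≢0 i 8}} of λ { (f , c) →
    case mod4→mod6,3 (quad-even (+ (i ℕ.* 1)) (+ (i ℕ.* 8))) c of λ { (splits {g} {h} cg ch e) →
    let p = ΘΘ-counts 𝖯 i i 𝖮 i i 0 refl refl refl
        q = Θ-counts 𝖳 (3 ℕ.* i) (3 ℕ.* i) 0 {{ℕP.m*n≢0 3 i}} refl (eqC i)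
        c₂ = shear {w' = λ c b → + i * (+ 3 * ((+ 4 * b + + 1) * (+ 4 * b + + 1)) + + 6 * ((+ 4 * b + + 1 - + 2 * c) * (+ 4 * b + + 1 - + 2 * c)))} (λ c → - c) eq (swapped c)
        c₃ = reflect {w' = λ b c → + i * (+ 3 * ((+ 4 * b + + 1) * (+ 4 * b + + 1)) + + 6 * ((+ 2 * c + + 1) * (+ 2 * c + + 1)))} (λ b → + 2 * b) (λ b c → eq₁ (+ i) b c) (swapped c₂)
        z = odd-cancel (λ b c → eq₂ (+ i) b c) c₃
        g≈ψ = counts-unique₀ q (pointwise₁ eq₀ cg)
        h≈P = counts-unique₀ p ch
    in ≈-trans h≈P (≈-trans (cancel f g h e z) (≈-sym g≈ψ)) } }
    where
    C = i ℕ.* 1 ℕ.+ i ℕ.* 8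
    open Std 24 C
    open Base 24 C
    open LatticeLemmas (progression 24 C)
    cancel : ∀ f g h → f ≈ g ⊕ h → f ≈ 𝟘 → h ≈ g
    cancel f g h e z n = sym (xor-false⇒≡ (g n) (h n) (trans (sym (e n)) (z n)))
    eqC : ∀ i → 3 ℕ.* i ℕ.* 3 ≡ 24 ℕ.* 0 ℕ.+ (i ℕ.* 1 ℕ.+ i ℕ.* 8)
    eqC = ℕS.solve-∀
    ring : ∀ I c b → I * + 1 * ((+ 4 * (b + - c) + + 1) * (+ 4 * (b + - c) + + 1)) + I * + 8 * ((+ 4 * (b + - c) + + 1 + + 3 * c) * (+ 4 * (b + - c) + + 1 + + 3 * c))
           ≡ I * (+ 3 * ((+ 4 * b + + 1) * (+ 4 * b + + 1)) + + 6 * ((+ 4 * b + + 1 - + 2 * c) * (+ 4 * b + + 1 - + 2 * c)))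
    ring = solve-∀
    eq : ∀ c b → quad (+ (i ℕ.* 1)) (+ (i ℕ.* 8)) (+ 4 * (b + - c) + + 1) (+ 4 * (b + - c) + + 1 + + 3 * c)
           ≡ + i * (+ 3 * ((+ 4 * b + + 1) * (+ 4 * b + + 1)) + + 6 * ((+ 4 * b + + 1 - + 2 * c) * (+ 4 * b + + 1 - + 2 * c)))
    eq c b = trans (cong₂ (λ α β → quad α β (+ 4 * (b + - c) + + 1) (+ 4 * (b + - c) + + 1 + + 3 * c)) (pos-* i 1) (pos-* i 8)) (ring (+ i) c b)
    eq₁ : ∀ I b c → I * (+ 3 * ((+ 4 * b + + 1) * (+ 4 * b + + 1)) + + 6 * ((+ 4 * b + + 1 - + 2 * (+ 2 * b - c)) * (+ 4 * b + + 1 - + 2 * (+ 2 * b - c))))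
          ≡ I * (+ 3 * ((+ 4 * b + + 1) * (+ 4 * b + + 1)) + + 6 * ((+ 2 * c + + 1) * (+ 2 * c + + 1)))
    eq₁ = solve-∀
    eq₂ : ∀ I b c → I * (+ 3 * ((+ 4 * b + + 1) * (+ 4 * b + + 1)) + + 6 * ((+ 2 * (- c - + 1) + + 1) * (+ 2 * (- c - + 1) + + 1)))
          ≡ I * (+ 3 * ((+ 4 * b + + 1) * (+ 4 * b + + 1)) + + 6 * ((+ 2 * c + + 1) * (+ 2 * c + + 1)))
    eq₂ = solve-∀
    ring₀ : ∀ I b → I * + 1 * ((+ 3 * (+ 4 * b + + 1)) * (+ 3 * (+ 4 * b + + 1))) + I * + 8 * (+ 0 * + 0) ≡ + 3 * I * + 3 * ((+ 4 * b + + 1) * (+ 4 * b + + 1))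
    ring₀ = solve-∀
    eq₀ : ∀ b → quad (+ (i ℕ.* 1)) (+ (i ℕ.* 8)) (+ 3 * (+ 4 * b + + 1)) (+ 0) ≡ + (3 ℕ.* i ℕ.* 3) * ((+ 4 * b + + 1) * (+ 4 * b + + 1))
    eq₀ b = trans (cong₂ (λ α β → quad α β (+ 3 * (+ 4 * b + + 1)) (+ 0)) (pos-* i 1) (pos-* i 8))
      (trans (ring₀ (+ i) b) (cong (_* ((+ 4 * b + + 1) * (+ 4 * b + + 1))) (sym (trans (pos-* (3 ℕ.* i) 3) (cong (_* + 3) (pos-* 3 i))))))

  24<48 : 24 < 48
  24<48 = ℕP.m<m+n 24 (s≤s z≤n)

  quad-zeroʳ : ∀ α β x → quad α β x (+ 0) ≡ α * (x * x)
  quad-zeroʳ = eq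
    where
    eq : ∀ α β x → α * (x * x) + β * (+ 0 * + 0) ≡ α * (x * x)
    eq = solve-∀

  quad-zeroˡ : ∀ α β y → quad α β (+ 0) y ≡ β * (y * y)
  quad-zeroˡ = eq
    where
    eq : ∀ α β y → α * (+ 0 * + 0) + β * (y * y) ≡ β * (y * y)
    eq = solve-∀

  quad-two : ∀ α β x → quad α β (+ 2 * x) (+ 0) ≡ α * + 4 * (x * x)
  quad-two = eq
    where
    eq : ∀ α β x → α * ((+ 2 * x) * (+ 2 * x)) + β * (+ 0 * + 0) ≡ α * + 4 * (x * x)
    eq = solve-∀

  Ω-halves : ∀ i .{{_ : ℕ.NonZero i}} → Ω i ≈ P (8 ℕ.* i) ⊕ mono i · Ω (4 ℕ.* i)
  Ω-halves i = case split halve (λ _ → refl) (λ _ → refl) (Θ-counts 𝖮 i i 0 refl refl) of λ { (splits cg ch e) →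
    let p = Θ-counts 𝖯 (8 ℕ.* i) (8 ℕ.* i) 0 {{ℕP.m*n≢0 8 i}} refl (c₁ i)
        o = Θ-counts 𝖮 (4 ℕ.* i) (4 ℕ.* i) i {{ℕP.m*n≢0 4 i}} refl (c₂ i)
    in ≈-trans (≈-sym (·-identityˡ (Ω i))) (≈-trans e (⊕-cong (≈-sym (counts-unique₀ p (pointwise₁ eq₁ cg))) (≈-sym (counts-unique o (reflect₁ (- (+ 1)) eq₂ ch))))) }
    where
    open Std 24 (i ℕ.* 8)
    open LatticeLemmas (progression 24 (i ℕ.* 8))
    c₁ : ∀ i → 8 ℕ.* i ℕ.* 1 ≡ 24 ℕ.* 0 ℕ.+ i ℕ.* 8
    c₁ = ℕS.solve-∀
    c₂ : ∀ i → 4 ℕ.* i ℕ.* 8 ≡ 24 ℕ.* i ℕ.+ i ℕ.* 8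
    c₂ = ℕS.solve-∀
    ring₁ : ∀ I z → I * + 8 * ((+ 3 * (+ 2 * z) + + 1) * (+ 3 * (+ 2 * z) + + 1)) ≡ + 8 * I * + 1 * ((+ 6 * z + + 1) * (+ 6 * z + + 1))
    ring₁ = solve-∀
    ring₂ : ∀ I z → I * + 8 * ((+ 3 * (+ 2 * (- (+ 1) - z) + + 1) + + 1) * (+ 3 * (+ 2 * (- (+ 1) - z) + + 1) + + 1)) ≡ + 4 * I * + 8 * ((+ 3 * z + + 1) * (+ 3 * z + + 1))
    ring₂ = solve-∀
    eq₁ : ∀ z → + (i ℕ.* 8) * ((+ 3 * (+ 2 * z) + + 1) * (+ 3 * (+ 2 * z) + + 1)) ≡ + (8 ℕ.* i ℕ.* 1) * ((+ 6 * z + + 1) * (+ 6 * z + + 1))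
    eq₁ z = trans (cong (_* _) (pos-* i 8)) (trans (ring₁ (+ i) z) (cong (_* ((+ 6 * z + + 1) * (+ 6 * z + + 1))) (sym (trans (pos-* (8 ℕ.* i) 1) (cong (_* + 1) (pos-* 8 i))))))
    eq₂ : ∀ z → + (i ℕ.* 8) * ((+ 3 * (+ 2 * (- (+ 1) - z) + + 1) + + 1) * (+ 3 * (+ 2 * (- (+ 1) - z) + + 1) + + 1)) ≡ + (4 ℕ.* i ℕ.* 8) * ((+ 3 * z + + 1) * (+ 3 * z + + 1))
    eq₂ z = trans (cong (_* ((+ 3 * (+ 2 * (- (+ 1) - z) + + 1) + + 1) * (+ 3 * (+ 2 * (- (+ 1) - z) + + 1) + + 1))) (pos-* i 8)) (trans (ring₂ (+ i) z) (cong (_* ((+ 3 * z + + 1) * (+ 3 * z + + 1))) (sym (trans (pos-* (4 ℕ.* i) 8) (cong (_* + 8) (pos-* 4 i))))))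

  -- The numbers ≡ 1 (mod 4), up to sign, are either ≡ 1 (mod 6) or three times such a number ≡ 1
  -- (mod 4).
  ψ-thirds : ψ 1 ≈ P 3 ⊕ mono 1 · ψ 9
  ψ-thirds = case split trisect (λ _ → refl) (λ _ → refl) (Θ-counts 𝖳 1 1 0 refl refl) of λ { (splits {g} {h} c₀ c₁₂ e) →
    case split ≅-refl (λ _ → refl) (λ _ → refl) c₁₂ of λ { (splits {g₁} {g₂} c₁ c₂ e') →
    let p = Θ-counts 𝖯 3 3 0 refl refl
        t = Θ-counts 𝖳 9 9 1 refl refl
        m = merge {w = λ a → + 3 * ((+ 6 * a + + 1) * (+ 6 * a + + 1))} halve (λ _ → refl) (λ _ → refl) (pointwise₁ eq₀ c₀) (reflect₁ (- (+ 1)) eq₁ c₁)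
    in ≈-trans (≈-sym (·-identityˡ (ψ 1))) (≈-trans e (≈-trans (⊕-cong (≈-refl {g}) e') (≈-trans (assoc g g₁ g₂) (⊕-cong (≈-sym (counts-unique₀ p m)) (≈-sym (counts-unique t (reflect₁ (- (+ 1)) eq₂ c₂))))))) } }
    where
    open Std 24 3
    open LatticeLemmas (progression 24 3)
    assoc : ∀ a b c → a ⊕ (b ⊕ c) ≈ (a ⊕ b) ⊕ c
    assoc = solve 3 (λ a b c → a :+ (b :+ c) := (a :+ b) :+ c) ≈-refl
    eq₀ : ∀ z → + 3 * ((+ 4 * (+ 3 * z) + + 1) * (+ 4 * (+ 3 * z) + + 1)) ≡ + 3 * ((+ 6 * (+ 2 * z) + + 1) * (+ 6 * (+ 2 * z) + + 1))
    eq₀ = solve-∀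
    eq₁ : ∀ z → + 3 * ((+ 4 * (+ 3 * (- (+ 1) - z) + + 1) + + 1) * (+ 4 * (+ 3 * (- (+ 1) - z) + + 1) + + 1)) ≡ + 3 * ((+ 6 * (+ 2 * z + + 1) + + 1) * (+ 6 * (+ 2 * z + + 1) + + 1))
    eq₁ = solve-∀
    eq₂ : ∀ z → + 3 * ((+ 4 * (+ 3 * (- (+ 1) - z) + + 2) + + 1) * (+ 4 * (+ 3 * (- (+ 1) - z) + + 2) + + 1)) ≡ + 27 * ((+ 4 * z + + 1) * (+ 4 * z + + 1))
    eq₂ = solve-∀

  -- After `align`, 3 (y - 4w)² + 5y² = 2 (2y - 3w)² + 30w² brings the form into the shape for
  -- `skew`.
  ψ₁P₅ : ψ 1 · P 5 ≈ P 8 ⊕ mono 1 · (P 2 · ψ 10)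
  ψ₁P₅ = case skew (quad-even (+ 2) (+ 30)) (swapped (pointwise {w' = λ w a → quad (+ 2) (+ 30) (+ 2 * (+ 6 * a + + 1) - + 3 * w) w} (λ w a → eq (+ 6 * a + + 1) w)
      (align (quad-even (+ 3) (+ 5)) c))) of λ { (splits cg ch e) →
    counts-≈₀ c e (⊕-cong (≈-sym (counts-unique₀ (Θ-counts 𝖯 8 8 0 refl refl) (pointwise₁ (λ a → quad-two (+ 2) (+ 30) (+ 6 * a + + 1)) cg)))
                          (counts-unique ch (ΘΘ-counts 𝖯 2 2 𝖳 10 10 1 refl refl refl))) }
    where
    open Std 24 8
    open LatticeLemmas (progression 24 8)
    c = ΘΘ-counts 𝖳 1 1 𝖯 5 5 0 refl refl refl
    eq : ∀ y w → + 3 * ((y - + 4 * w) * (y - + 4 * w)) + + 5 * (y * y) ≡ + 2 * ((+ 2 * y - + 3 * w) * (+ 2 * y - + 3 * w)) + + 30 * (w * w)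
    eq = solve-∀

  -- As for P 5, except that odd w gives values ≡ 40 (mod 48), off the progression of the even
  -- section; the required shape appears only after w is doubled.
  even-ψ₁P₁₃ : even (ψ 1 · P 13) ≈ P 8 ⊕ mono 3 · (P 2 · ψ 26)
  even-ψ₁P₁₃ = case split₂ (swapped (align (quad-even (+ 3) (+ 13)) c)) of λ { (splits c₀ c₁ e) →
    case skew (quad-even (+ 4) (+ 156)) (pointwise {w' = λ a w → quad (+ 4) (+ 156) (+ 2 * (+ 6 * a + + 1) - + 3 * w) w} (λ a w → eq (+ 6 * a + + 1) w) c₀) of λ { (splits cg ch e') →
    ≈-trans (≈-sym (λ n → ·-identityˡ (ψ 1 · P 13) (double n))) (≈-trans e (≈-trans (⊕-cong e' (counts-off 47 16 24 (s≤s z≤n) 24<48 (λ (a , w) → + 12 * a * a + a - + 6 * a * w + + 4 * w * w + + 3 * w) (λ (a , w) → eq' a w) c₁))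
      (≈-trans (λ n → xor-identityʳ _) (⊕-cong (≈-sym (counts-unique₀ (Θ-counts 𝖯 16 8 0 refl refl) (pointwise₁ (λ a → quad-two (+ 4) (+ 156) (+ 6 * a + + 1)) cg)))
                          (counts-unique ch (ΘΘ-counts 𝖯 4 2 𝖳 52 26 3 refl refl refl)))))) } }
    where
    open Std 48 16
    open LatticeLemmas (progression 48 16)
    c = even-counts 24 16 (Std.ΘΘ-counts 24 16 𝖳 1 1 𝖯 13 13 0 refl refl refl)
    eq : ∀ y w → + 3 * ((y - + 4 * (+ 2 * w)) * (y - + 4 * (+ 2 * w))) + + 13 * (y * y) ≡ + 4 * ((+ 2 * y - + 3 * w) * (+ 2 * y - + 3 * w)) + + 156 * (w * w)
    eq = solve-∀
    eq' : ∀ a w → + 3 * ((+ 6 * a + + 1 - + 4 * (+ 2 * w + + 1)) * (+ 6 * a + + 1 - + 4 * (+ 2 * w + + 1))) + + 13 * ((+ 6 * a + + 1) * (+ 6 * a + + 1))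
          ≡ + 48 * (+ 12 * a * a + a - + 6 * a * w + + 4 * w * w + + 3 * w) + + 40
    eq' = solve-∀

  -- With x = y + 4c the form is 24y² + 24yc + 48c². Even c gives 24 (y + k)² + 168k², degenerate by
  -- `diagonal` and `antidiagonal`; odd c gives twice the original form, through `mod8→mod4`.
  ψ₁ψ₇ : ψ 1 · ψ 7 ≈ (ψ 8 ⊕ mono 6 · ψ 56) ⊕ mono 1 · (ψ 2 · ψ 14)
  ψ₁ψ₇ = case split₂ (shear {w' = λ d c → quad (+ 3) (+ 21) (+ 4 * d + + 1 + + 4 * c) (+ 4 * d + + 1)} (λ d → d) (λ d c → cong (λ x → quad (+ 3) (+ 21) x (+ 4 * d + + 1)) (eq₀ d c)) (swapped c)) of λ { (splits cE cO e) →
    case split₂ (pointwise {w' = λ d k → quad (+ 24) (+ 168) (+ 4 * d + + 1 + k) k} (λ d k → eq₁ (+ 4 * d + + 1) k) cE) of λ { (splits c₀ c₁ e') →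
    let d₀ = diagonal (quad-even (+ 24) (+ 672)) (pointwise {w' = λ d k → quad (+ 24) (+ 672) (+ 4 * d + + 1 + + 2 * k) k} (λ d k → eq₂ (+ 4 * d + + 1) k) c₀)
        d₁ = antidiagonal (quad-even (+ 24) (+ 168)) (pointwise {w' = λ d k → quad (+ 24) (+ 168) (+ 4 * d + + 2 + + 2 * k) (+ 2 * k + + 1)} (λ d k → cong (λ x → quad (+ 24) (+ 168) x (+ 2 * k + + 1)) (eq₃ d k)) c₁)
        d₂ = mod8→mod4 (quad-even (+ 6) (+ 42)) (pointwise {w' = λ b d → quad (+ 6) (+ 42) (+ 8 * b + + 2 * d + + 3) (+ 2 * d + + 1)} eq₄ cO)
    in counts-≈₀ c e (⊕-cong (≈-trans e' (⊕-cong (≈-sym (counts-unique₀ (Θ-counts 𝖳 8 8 0 refl refl) (pointwise₁ (λ b → quad-zeroʳ (+ 24) (+ 672) (+ 4 * b + + 1)) d₀)))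
                                                (counts-unique (pointwise₁ (λ b → quad-zeroˡ (+ 24) (+ 168) (+ 4 * b + + 1)) d₁) (Θ-counts 𝖳 56 56 6 refl refl))))
                          (counts-unique d₂ (ΘΘ-counts 𝖳 2 2 𝖳 14 14 1 refl refl refl))) } }
    where
    open Std 24 24
    open LatticeLemmas (progression 24 24)
    c = ΘΘ-counts 𝖳 1 1 𝖳 7 7 0 refl refl refl
    eq₀ : ∀ d c → + 4 * (c + d) + + 1 ≡ + 4 * d + + 1 + + 4 * c
    eq₀ = solve-∀
    eq₁ : ∀ y k → + 3 * ((y + + 4 * (+ 2 * k)) * (y + + 4 * (+ 2 * k))) + + 21 * (y * y) ≡ + 24 * ((y + k) * (y + k)) + + 168 * (k * k)
    eq₁ = solve-∀
    eq₂ : ∀ y k → + 24 * ((y + + 2 * k) * (y + + 2 * k)) + + 168 * ((+ 2 * k) * (+ 2 * k)) ≡ + 24 * ((y + + 2 * k) * (y + + 2 * k)) + + 672 * (k * k)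
    eq₂ = solve-∀
    eq₃ : ∀ d k → + 4 * d + + 1 + (+ 2 * k + + 1) ≡ + 4 * d + + 2 + + 2 * k
    eq₃ = solve-∀
    eq₄ : ∀ b d → + 3 * ((+ 4 * b + + 1 + + 4 * (+ 2 * d + + 1)) * (+ 4 * b + + 1 + + 4 * (+ 2 * d + + 1))) + + 21 * ((+ 4 * b + + 1) * (+ 4 * b + + 1))
          ≡ + 6 * ((+ 8 * b + + 2 * d + + 3) * (+ 8 * b + + 2 * d + + 3)) + + 42 * ((+ 2 * d + + 1) * (+ 2 * d + + 1))
    eq₄ = solve-∀

  -- With x = y + 4c the form is 4 (3y + c)² + 44c². Multiples of 3 among the c give the two single
  -- ψ. The classes 1 and 2 mod 3 match up to a common sign and merge; the parity of k then decides
  -- which of the two entries is even and yields Ω.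
  ψ₁ψ₁₁ : ψ 1 · ψ 11 ≈ (ψ 12 ⊕ mono 15 · ψ 132) ⊕ (mono 1 · (Ω 2 · P 44) ⊕ mono 6 · (P 4 · Ω 22))
  ψ₁ψ₁₁ = case split₃ (shear {w' = λ d c → quad (+ 4) (+ 44) (+ 12 * d + + 3 + c) c} (λ d → d) eq₀ (swapped c)) of λ { (splits₃ {g₀} {g₁} {g₂} c₀ c₁ c₂ e) →
    case split₂ (pointwise {w' = λ d k → quad (+ 36) (+ 396) (+ 4 * d + + 1 + k) k} eq₁ c₀) of λ { (splits b₀ b₁ e₀) →
    let d₀ = diagonal (quad-even (+ 36) (+ 1584)) (pointwise {w' = λ d k → quad (+ 36) (+ 1584) (+ 4 * d + + 1 + + 2 * k) k} (λ d k → eq₂ (+ 4 * d + + 1) k) b₀)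
        d₁ = antidiagonal (quad-even (+ 36) (+ 396)) (pointwise {w' = λ d k → quad (+ 36) (+ 396) (+ 4 * d + + 2 + + 2 * k) (+ 2 * k + + 1)} (λ d k → cong (λ x → quad (+ 36) (+ 396) x (+ 2 * k + + 1)) (eq₃ d k)) b₁)
        a₁ = pointwise {w' = λ d k → F (+ 6 * (+ 2 * d) + + 4 + + 3 * k) (+ 3 * k + + 1)} (λ d k → cong (λ x → F x (+ 3 * k + + 1)) (eq₄ d k)) c₁
        a₂ = reflect {w' = λ d k → F (+ 12 * d + + 2 - + 3 * k) (- (+ 3 * k + + 1))} (λ _ → - (+ 1)) (λ d k → cong₂ F (eq₅ d k) (eq₅' k)) c₂
        a₃ = reflect {w' = λ k d → F (+ 6 * (+ 2 * d + + 1) + + 4 + + 3 * k) (+ 3 * k + + 1)} (λ _ → - (+ 1)) (λ k d → Even₂.neg ev {y' = + 3 * k + + 1} (eq₆ k d) refl) (swapped a₂)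
        m = merge₂ {w = λ k t → F (+ 6 * t + + 4 + + 3 * k) (+ 3 * k + + 1)} (swapped a₁) a₃
    in case split₂ (swapped m) of λ { (splits n₀ n₁ e₁) →
    let s₀ = shear {w' = λ g t → F (+ 6 * t + + 4) (+ 6 * g + + 1)} (λ g → - g) (λ g t → cong₂ F (eq₇ g t) (eq₇' g)) (swapped n₀)
        s₀' = reflect {w' = λ g t → quad (+ 16) (+ 44) (+ 3 * t + + 1) (+ 6 * g + + 1)} (λ _ → - (+ 1)) (λ g t → eq₈ t (+ 6 * g + + 1)) s₀
        s₁ = shear {w' = λ g t → F (+ 6 * t + + 1) (+ 6 * g + + 4)} (λ g → - g - + 1) (λ g t → cong₂ F (eq₉ g t) (eq₉' g)) (swapped n₁)
        s₁' = reflect {w' = λ t g → quad (+ 4) (+ 176) (+ 6 * t + + 1) (+ 3 * g + + 1)} (λ _ → - (+ 1)) (λ t g → eq₁₀ (+ 6 * t + + 1) g) (swapped s₁)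
    in counts-≈₀ c e (⊕-cong
         (≈-trans e₀ (⊕-cong (≈-sym (counts-unique₀ (Θ-counts 𝖳 12 12 0 refl refl) (pointwise₁ (λ b → quad-zeroʳ (+ 36) (+ 1584) (+ 4 * b + + 1)) d₀)))
                             (counts-unique (pointwise₁ (λ b → quad-zeroˡ (+ 36) (+ 396) (+ 4 * b + + 1)) d₁) (Θ-counts 𝖳 132 132 15 refl refl))))
         (≈-trans e₁ (⊕-cong (counts-unique (swapped s₀') (ΘΘ-counts 𝖮 2 2 𝖯 44 44 1 refl refl refl)) (counts-unique s₁' (ΘΘ-counts 𝖯 4 4 𝖮 22 22 6 refl refl refl))))) } } }
    where
    open Std 24 36
    open LatticeLemmas (progression 24 36)
    F : ℤ → ℤ → ℤ
    F = quad (+ 4) (+ 44)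
    ev : Even₂ F
    ev = quad-even (+ 4) (+ 44)
    c = ΘΘ-counts 𝖳 1 1 𝖳 11 11 0 refl refl refl
    eq₀ : ∀ d c → + 3 * ((+ 4 * (c + d) + + 1) * (+ 4 * (c + d) + + 1)) + + 33 * ((+ 4 * d + + 1) * (+ 4 * d + + 1)) ≡ + 4 * ((+ 12 * d + + 3 + c) * (+ 12 * d + + 3 + c)) + + 44 * (c * c)
    eq₀ = solve-∀
    eq₁ : ∀ d k → + 4 * ((+ 12 * d + + 3 + + 3 * k) * (+ 12 * d + + 3 + + 3 * k)) + + 44 * ((+ 3 * k) * (+ 3 * k)) ≡ + 36 * ((+ 4 * d + + 1 + k) * (+ 4 * d + + 1 + k)) + + 396 * (k * k)
    eq₁ = solve-∀
    eq₂ : ∀ y k → + 36 * ((y + + 2 * k) * (y + + 2 * k)) + + 396 * ((+ 2 * k) * (+ 2 * k)) ≡ + 36 * ((y + + 2 * k) * (y + + 2 * k)) + + 1584 * (k * k)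
    eq₂ = solve-∀
    eq₃ : ∀ d k → + 4 * d + + 1 + (+ 2 * k + + 1) ≡ + 4 * d + + 2 + + 2 * k
    eq₃ = solve-∀
    eq₄ : ∀ d k → + 12 * d + + 3 + (+ 3 * k + + 1) ≡ + 6 * (+ 2 * d) + + 4 + + 3 * k
    eq₄ = solve-∀
    eq₅ : ∀ d k → + 12 * d + + 3 + (+ 3 * (- (+ 1) - k) + + 2) ≡ + 12 * d + + 2 - + 3 * k
    eq₅ = solve-∀
    eq₅' : ∀ k → + 3 * (- (+ 1) - k) + + 2 ≡ - (+ 3 * k + + 1)
    eq₅' = solve-∀
    eq₆ : ∀ k d → + 12 * (- (+ 1) - d) + + 2 - + 3 * k ≡ - (+ 6 * (+ 2 * d + + 1) + + 4 + + 3 * k)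
    eq₆ = solve-∀
    eq₇ : ∀ g t → + 6 * (t + - g) + + 4 + + 3 * (+ 2 * g) ≡ + 6 * t + + 4
    eq₇ = solve-∀
    eq₇' : ∀ g → + 3 * (+ 2 * g) + + 1 ≡ + 6 * g + + 1
    eq₇' = solve-∀
    eq₈ : ∀ t y → + 4 * ((+ 6 * (- (+ 1) - t) + + 4) * (+ 6 * (- (+ 1) - t) + + 4)) + + 44 * (y * y) ≡ + 16 * ((+ 3 * t + + 1) * (+ 3 * t + + 1)) + + 44 * (y * y)
    eq₈ = solve-∀
    eq₉ : ∀ g t → + 6 * (t + (- g - + 1)) + + 4 + + 3 * (+ 2 * g + + 1) ≡ + 6 * t + + 1
    eq₉ = solve-∀
    eq₉' : ∀ g → + 3 * (+ 2 * g + + 1) + + 1 ≡ + 6 * g + + 4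
    eq₉' = solve-∀
    eq₁₀ : ∀ x g → + 4 * (x * x) + + 44 * ((+ 6 * (- (+ 1) - g) + + 4) * (+ 6 * (- (+ 1) - g) + + 4)) ≡ + 4 * (x * x) + + 176 * ((+ 3 * g + + 1) * (+ 3 * g + + 1))
    eq₁₀ = solve-∀

  -- Of 48y² + 24yc + 48c² the odd section sees only odd c. Writing c = y + 4k or c = -(y + 4k)
  -- diagonalises the form in two ways, and each loses a variable by `diagonal`.
  odd-ψ₁ψ₁₅ : odd (ψ 1 · ψ 15) ≈ ψ 12 ⊕ mono 1 · ψ 20
  odd-ψ₁ψ₁₅ = case split₂ (shear {w' = λ d c → + 48 * ((+ 4 * d + + 1) * (+ 4 * d + + 1)) + + 24 * ((+ 4 * d + + 1) * c) + + 48 * (c * c)} (λ d → d) eq₀ (swapped c)) of λ { (splits c₀ c₁ e) →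
    case split₂ c₁ of λ { (splits b₀ b₁ e') →
    let z = counts-off 47 72 24 (s≤s z≤n) 24<48 (λ (d , c) → + 16 * d * d + + 8 * d + (+ 4 * d + + 1) * c + + 4 * c * c - + 1) (λ (d , c) → eq₁ d c) c₀
        d₀ = diagonal (quad-even (+ 120) (+ 288)) (shear {w' = λ d k → quad (+ 120) (+ 288) (+ 4 * d + + 1 + + 2 * k) k} (λ d → d) eq₂ b₀)
        d₁ = diagonal (quad-even (+ 72) (+ 480)) (reflect {w' = λ d k → quad (+ 72) (+ 480) (+ 4 * d + + 1 + + 2 * k) k} (λ d → - (+ 1) - d) eq₃ b₁)
    in ≈-trans (≈-sym (λ n → ·-identityˡ (ψ 1 · ψ 15) (suc (double n)))) (≈-trans e (≈-trans (⊕-cong z e') (λ n → trans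
         (cong₂ _xor_ (counts-unique (pointwise₁ (λ b → quad-zeroʳ (+ 120) (+ 288) (+ 4 * b + + 1)) d₀) (Θ-counts 𝖳 40 20 1 refl refl) n)
                      (sym (counts-unique₀ (Θ-counts 𝖳 24 12 0 refl refl) (pointwise₁ (λ b → quad-zeroʳ (+ 72) (+ 480) (+ 4 * b + + 1)) d₁) n)))
         (xor-comm ((mono 1 · ψ 20) n) (ψ 12 n))))) } }
    where
    open Std 48 72
    open LatticeLemmas (progression 48 72)
    c = odd-counts 24 48 (Std.ΘΘ-counts 24 48 𝖳 1 1 𝖳 15 15 0 refl refl refl)
    eq₀ : ∀ d c → + 3 * ((+ 4 * (c + d) + + 1) * (+ 4 * (c + d) + + 1)) + + 45 * ((+ 4 * d + + 1) * (+ 4 * d + + 1)) ≡ + 48 * ((+ 4 * d + + 1) * (+ 4 * d + + 1)) + + 24 * ((+ 4 * d + + 1) * c) + + 48 * (c * c)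
    eq₀ = solve-∀
    eq₁ : ∀ d c → + 48 * ((+ 4 * d + + 1) * (+ 4 * d + + 1)) + + 24 * ((+ 4 * d + + 1) * (+ 2 * c)) + + 48 * ((+ 2 * c) * (+ 2 * c)) ≡ + 48 * (+ 16 * d * d + + 8 * d + (+ 4 * d + + 1) * c + + 4 * c * c - + 1) + + 96
    eq₁ = solve-∀
    eq₂ : ∀ d k → + 48 * ((+ 4 * d + + 1) * (+ 4 * d + + 1)) + + 24 * ((+ 4 * d + + 1) * (+ 2 * (+ 2 * (k + d)) + + 1)) + + 48 * ((+ 2 * (+ 2 * (k + d)) + + 1) * (+ 2 * (+ 2 * (k + d)) + + 1))
          ≡ + 120 * ((+ 4 * d + + 1 + + 2 * k) * (+ 4 * d + + 1 + + 2 * k)) + + 288 * (k * k)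
    eq₂ = solve-∀
    eq₃ : ∀ d k → + 48 * ((+ 4 * d + + 1) * (+ 4 * d + + 1)) + + 24 * ((+ 4 * d + + 1) * (+ 2 * (+ 2 * (- (+ 1) - d - k) + + 1) + + 1)) + + 48 * ((+ 2 * (+ 2 * (- (+ 1) - d - k) + + 1) + + 1) * (+ 2 * (+ 2 * (- (+ 1) - d - k) + + 1) + + 1))
          ≡ + 72 * ((+ 4 * d + + 1 + + 2 * k) * (+ 4 * d + + 1 + + 2 * k)) + + 480 * (k * k)
    eq₃ = solve-∀

  -- The section forces c ≡ 2 (mod 4) in the same form, which is then four times the original one:
  -- the product reproduces itself.
  odd-even-ψ₁ψ₁₅ : odd (even (ψ 1 · ψ 15)) ≈ mono 1 · (ψ 1 · ψ 15)
  odd-even-ψ₁ψ₁₅ = case Std.split₂ 48 48 (Std.shear 48 48 {w' = λ d c → + 48 * ((+ 4 * d + + 1) * (+ 4 * d + + 1)) + + 24 * ((+ 4 * d + + 1) * c) + + 48 * (c * c)} (λ d → d) eq₀ (Std.swapped 48 48 c)) of λ { (Count.splits {l} {r} c₀ c₁ e) →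
    case split₂ (odd-counts 48 48 c₀) of λ { (splits {l'} {r'} b₀ b₁ e') →
    let z = counts-off 47 48 24 (s≤s z≤n) 24<48 (λ (d , c) → + 16 * d * d + + 8 * d + + 4 * d * c + c + + 2 * d + + 4 * c * c + + 4 * c + + 1) (λ (d , c) → eq₁ d c) c₁
        z' = counts-off 95 96 48 (s≤s z≤n) (ℕP.m<m+n 48 (s≤s z≤n)) (λ (d , c) → + 8 * d * d + + 4 * d + + 4 * d * c + c + + 8 * c * c - + 1) (λ (d , c) → eq₂ d c) b₀
        d₁ = mod8→mod4 (quad-even (+ 12) (+ 180)) (pointwise {w' = λ b d → quad (+ 12) (+ 180) (+ 8 * b + + 2 * d + + 3) (+ 2 * d + + 1)} eq₃ b₁)
    in ≈-trans (≈-sym (λ n → ·-identityˡ (ψ 1 · ψ 15) (double (suc (double n))))) (≈-trans (λ n → trans (e (suc (double n))) (trans (cong (l (suc (double n)) xor_) (z (suc (double n)))) (xor-identityʳ (l (suc (double n))))))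
         (≈-trans e' (≈-trans (λ n → cong (_xor r' n) (z' n)) (counts-unique d₁ (ΘΘ-counts 𝖳 4 1 𝖳 60 15 1 refl refl refl))))) } }
    where
    open Std 96 96
    open LatticeLemmas (progression 96 96)
    c = even-counts 24 48 (Std.ΘΘ-counts 24 48 𝖳 1 1 𝖳 15 15 0 refl refl refl)
    eq₀ : ∀ d c → + 3 * ((+ 4 * (c + d) + + 1) * (+ 4 * (c + d) + + 1)) + + 45 * ((+ 4 * d + + 1) * (+ 4 * d + + 1)) ≡ + 48 * ((+ 4 * d + + 1) * (+ 4 * d + + 1)) + + 24 * ((+ 4 * d + + 1) * c) + + 48 * (c * c)
    eq₀ = solve-∀
    eq₁ : ∀ d c → + 48 * ((+ 4 * d + + 1) * (+ 4 * d + + 1)) + + 24 * ((+ 4 * d + + 1) * (+ 2 * c + + 1)) + + 48 * ((+ 2 * c + + 1) * (+ 2 * c + + 1)) ≡ + 48 * (+ 16 * d * d + + 8 * d + + 4 * d * c + c + + 2 * d + + 4 * c * c + + 4 * c + + 1) + + 72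
    eq₁ = solve-∀
    eq₂ : ∀ d c → + 48 * ((+ 4 * d + + 1) * (+ 4 * d + + 1)) + + 24 * ((+ 4 * d + + 1) * (+ 2 * (+ 2 * c))) + + 48 * ((+ 2 * (+ 2 * c)) * (+ 2 * (+ 2 * c))) ≡ + 96 * (+ 8 * d * d + + 4 * d + + 4 * d * c + c + + 8 * c * c - + 1) + + 144
    eq₂ = solve-∀
    eq₃ : ∀ b d → + 48 * ((+ 4 * b + + 1) * (+ 4 * b + + 1)) + + 24 * ((+ 4 * b + + 1) * (+ 2 * (+ 2 * d + + 1))) + + 48 * ((+ 2 * (+ 2 * d + + 1)) * (+ 2 * (+ 2 * d + + 1)))
          ≡ + 12 * ((+ 8 * b + + 2 * d + + 3) * (+ 8 * b + + 2 * d + + 3)) + + 180 * ((+ 2 * d + + 1) * (+ 2 * d + + 1))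
    eq₃ = solve-∀

  -- The product is first traded for pairs (y , y + 6c) by `mod4→mod6`, where 17y² + (y + 6c)² = 2
  -- (3y + c)² + 34c². The classes c ≡ 0, 1 (mod 4) miss the section; c ≡ 2, 3 give pairs of the
  -- same kind for other coefficients, which are traded back.
  odd-P₁P₁₇ : odd (P 17 · P 1) ≈ P 17 · P 4 ⊕ mono 2 · (P 1 · P 68)
  odd-P₁P₁₇ = case cone₆ 17 1 of λ { (f , c) →
    case split₂ (pointwise {w' = λ b c → quad (+ 2) (+ 34) (+ 12 * b + + 3 + c) c} eq₀ c) of λ { (splits {g} {h} cg ch e) →
    case split₂ cg of λ { (splits {g₀} {g₁} c₀ c₁ e₀) →
    case split₂ ch of λ { (splits {h₀} {h₁} d₀ d₁ e₁) →
    let z₀ = counts-off 47 42 24 (s≤s z≤n) 24<48 (λ (b , k) → + 6 * b * b + + 3 * b + + 4 * k * b + k + + 12 * k * k - + 1) (λ (b , k) → eq₁ b k) c₀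
        z₁ = counts-off 47 42 24 (s≤s z≤n) 24<48 (λ (b , k) → + 6 * b * b + + 4 * b + + 4 * k * b + + 7 * k + + 12 * k * k) (λ (b , k) → eq₂ b k) d₀
        a₁ = shear {w' = λ b k → F (+ 4 * k + + 1) (+ 4 * k + + 1 + + 6 * (b - k))} (λ b → - (+ 3 * b) - + 1) eq₃ c₁
        a₂ = shear {w' = λ k b → F (+ 4 * k + + 1) (+ 4 * k + + 1 + + 6 * b)} (λ k → k) (λ k b → cong (λ x → F (+ 4 * k + + 1) (+ 4 * k + + 1 + + 6 * x)) (eq₄ k b)) (swapped a₁)
        b₁ = reflect {w' = λ b k → G (+ 4 * k + + 1) (+ 4 * k + + 1 + + 6 * (b - k))} (λ _ → - (+ 1)) eq₅ d₁
        b₂ = shear {w' = λ k b → G (+ 4 * k + + 1) (+ 4 * k + + 1 + + 6 * b)} (λ k → k) (λ k b → cong (λ x → G (+ 4 * k + + 1) (+ 4 * k + + 1 + + 6 * x)) (eq₄ k b)) (swapped b₁)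
        base = odd-counts 24 18 (Std.ΘΘ-counts 24 18 𝖯 17 17 𝖯 1 1 0 refl refl refl)
        g₁≈ = counts-unique (mod4→mod6 (quad-even (+ 2) (+ 136)) a₂) (ΘΘ-counts 𝖯 2 1 𝖯 136 68 2 refl refl refl)
        h₁≈ = counts-unique₀ (ΘΘ-counts 𝖯 34 17 𝖯 8 4 0 refl refl refl) (mod4→mod6 (quad-even (+ 34) (+ 8)) b₂)
    in ≈-trans (≈-sym (λ n → ·-identityˡ (P 17 · P 1) (suc (double n)))) (≈-trans (counts-unique base (mod4→mod6 (quad-even (+ 17) (+ 1)) c))
         (≈-trans (assemble f g h g₀ g₁ h₀ h₁ e e₀ e₁ z₀ z₁) (⊕-cong (≈-sym h₁≈) g₁≈))) } } } }
    where
    open Std 48 42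
    open Base 48 42
    open LatticeLemmas (progression 48 42)
    F G : ℤ → ℤ → ℤ
    F = quad (+ 2) (+ 136)
    G = quad (+ 34) (+ 8)
    assemble : ∀ f g h g₀ g₁ h₀ h₁ → f ≈ g ⊕ h → g ≈ g₀ ⊕ g₁ → h ≈ h₀ ⊕ h₁ → g₀ ≈ 𝟘 → h₀ ≈ 𝟘 → f ≈ h₁ ⊕ g₁
    assemble f g h g₀ g₁ h₀ h₁ e e₀ e₁ z₀ z₁ n =
      trans (e n) (trans (cong₂ _xor_ (trans (e₀ n) (cong (_xor g₁ n) (z₀ n))) (trans (e₁ n) (cong (_xor h₁ n) (z₁ n)))) (xor-comm (g₁ n) (h₁ n)))
    eq₀ : ∀ b c → + 17 * ((+ 4 * b + + 1) * (+ 4 * b + + 1)) + + 1 * ((+ 4 * b + + 1 + + 6 * c) * (+ 4 * b + + 1 + + 6 * c)) ≡ + 2 * ((+ 12 * b + + 3 + c) * (+ 12 * b + + 3 + c)) + + 34 * (c * c)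
    eq₀ = solve-∀
    eq₁ : ∀ b k → + 2 * ((+ 12 * b + + 3 + + 2 * (+ 2 * k)) * (+ 12 * b + + 3 + + 2 * (+ 2 * k))) + + 34 * ((+ 2 * (+ 2 * k)) * (+ 2 * (+ 2 * k))) ≡ + 48 * (+ 6 * b * b + + 3 * b + + 4 * k * b + k + + 12 * k * k - + 1) + + 66
    eq₁ = solve-∀
    eq₂ : ∀ b k → + 2 * ((+ 12 * b + + 3 + (+ 2 * (+ 2 * k) + + 1)) * (+ 12 * b + + 3 + (+ 2 * (+ 2 * k) + + 1))) + + 34 * ((+ 2 * (+ 2 * k) + + 1) * (+ 2 * (+ 2 * k) + + 1)) ≡ + 48 * (+ 6 * b * b + + 4 * b + + 4 * k * b + + 7 * k + + 12 * k * k) + + 66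
    eq₂ = solve-∀
    eq₃ : ∀ b k → + 2 * ((+ 12 * b + + 3 + + 2 * (+ 2 * (k + (- (+ 3 * b) - + 1)) + + 1)) * (+ 12 * b + + 3 + + 2 * (+ 2 * (k + (- (+ 3 * b) - + 1)) + + 1))) + + 34 * ((+ 2 * (+ 2 * (k + (- (+ 3 * b) - + 1)) + + 1)) * (+ 2 * (+ 2 * (k + (- (+ 3 * b) - + 1)) + + 1)))
          ≡ + 2 * ((+ 4 * k + + 1) * (+ 4 * k + + 1)) + + 136 * ((+ 4 * k + + 1 + + 6 * (b - k)) * (+ 4 * k + + 1 + + 6 * (b - k)))
    eq₃ = solve-∀
    eq₄ : ∀ k b → b + k - k ≡ b
    eq₄ = solve-∀
    eq₅ : ∀ b k → + 2 * ((+ 12 * b + + 3 + (+ 2 * (+ 2 * (- (+ 1) - k) + + 1) + + 1)) * (+ 12 * b + + 3 + (+ 2 * (+ 2 * (- (+ 1) - k) + + 1) + + 1))) + + 34 * ((+ 2 * (+ 2 * (- (+ 1) - k) + + 1) + + 1) * (+ 2 * (+ 2 * (- (+ 1) - k) + + 1) + + 1))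
          ≡ + 34 * ((+ 4 * k + + 1) * (+ 4 * k + + 1)) + + 8 * ((+ 4 * k + + 1 + + 6 * (b - k)) * (+ 4 * k + + 1 + + 6 * (b - k)))
    eq₅ = solve-∀

  -- Derived from the known side: in 2x² + 14y² put x = y + 6t. Even t fits `skew`; odd t
  -- corresponds to the pairs that the even section keeps of 63x² + y². The shift by q² makes that
  -- constant agree, 63 + 1 = 24 * 2 + 16.
  even-P₁ψ₂₁ : P 1 · P 7 ≈ (P 8 ⊕ mono 5 · (P 2 · ψ 42)) ⊕ even (mono 2 · (ψ 21 · P 1))
  even-P₁ψ₂₁ = case split₂ (swapped (align (quad-even (+ 63) (+ 1)) base)) of λ { (splits {l} {r} c₀ c₁ e) →
    case split₂ (shear {w' = λ a t → quad (+ 2) (+ 14) (+ 6 * a + + 1 + + 6 * t) (+ 6 * a + + 1)} (λ a → a) (λ a t → cong (λ x → quad (+ 2) (+ 14) x (+ 6 * a + + 1)) (eq₀ a t)) (swapped p)) of λ { (splits {l'} {r'} d₀ d₁ e') →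
    case skew (quad-even (+ 4) (+ 252)) (reflect {w' = λ a w → quad (+ 4) (+ 252) (+ 2 * (+ 6 * a + + 1) - + 3 * w) w} (λ _ → + 0) (λ a w → eq₁ (+ 6 * a + + 1) w) d₀) of λ { (splits cg ch e'') →
    let z = counts-off 47 16 24 (s≤s z≤n) 24<48 (λ (a , w) → + 48 * a * a + + 16 * a - + 126 * a * w - + 63 * a - + 21 * w + + 84 * w * w + + 84 * w + + 11) (λ (a , w) → eq₂ a w) c₁
        k₁ = shear {w' = λ l a → quad (+ 63) (+ 1) (+ 6 * a + + 1 - + 2 * l) (+ 6 * a + + 1 + + 6 * l)} (λ l → l) (λ l a → cong₂ (quad (+ 63) (+ 1)) (eq₃ l a) (eq₃' l a)) (swapped c₀)
        k₂ = shear {w' = λ a l → quad (+ 2) (+ 14) (+ 6 * a + + 1 + + 6 * (+ 2 * l + + 1)) (+ 6 * a + + 1)} (λ a → + 3 * a + + 1) eq₄ (swapped k₁)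
    in counts-≈₀ p e' (⊕-cong (≈-trans e'' (⊕-cong (≈-sym (counts-unique₀ (Θ-counts 𝖯 16 8 0 refl refl) (pointwise₁ (λ a → quad-two (+ 4) (+ 252) (+ 6 * a + + 1)) cg)))
                          (counts-unique ch (ΘΘ-counts 𝖯 4 2 𝖳 84 42 5 refl refl refl))))
         (≈-trans (counts-unique d₁ k₂) (≈-sym (λ n → trans (e n) (trans (cong (l n xor_) (z n)) (xor-identityʳ (l n))))))) } } }
    where
    open Std 48 16
    open LatticeLemmas (progression 48 16)
    base = even-counts 24 16 (Std.ΘΘ-counts 24 16 𝖳 21 21 𝖯 1 1 2 refl refl refl)
    p = ΘΘ-counts 𝖯 2 1 𝖯 14 7 0 refl refl refl
    eq₀ : ∀ a t → + 6 * (t + a) + + 1 ≡ + 6 * a + + 1 + + 6 * t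
    eq₀ = solve-∀
    eq₁ : ∀ y w → + 2 * ((y + + 6 * (+ 2 * (+ 0 - w))) * (y + + 6 * (+ 2 * (+ 0 - w)))) + + 14 * (y * y) ≡ + 4 * ((+ 2 * y - + 3 * w) * (+ 2 * y - + 3 * w)) + + 252 * (w * w)
    eq₁ = solve-∀
    eq₂ : ∀ a w → + 63 * ((+ 6 * a + + 1 - + 4 * (+ 2 * w + + 1)) * (+ 6 * a + + 1 - + 4 * (+ 2 * w + + 1))) + + 1 * ((+ 6 * a + + 1) * (+ 6 * a + + 1))
          ≡ + 48 * (+ 48 * a * a + + 16 * a - + 126 * a * w - + 63 * a - + 21 * w + + 84 * w * w + + 84 * w + + 11) + + 40
    eq₂ = solve-∀
    eq₃ : ∀ l a → + 6 * (a + l) + + 1 - + 4 * (+ 2 * l) ≡ + 6 * a + + 1 - + 2 * l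
    eq₃ = solve-∀
    eq₃' : ∀ l a → + 6 * (a + l) + + 1 ≡ + 6 * a + + 1 + + 6 * l
    eq₃' = solve-∀
    eq₄ : ∀ a l → + 63 * ((+ 6 * a + + 1 - + 2 * (l + (+ 3 * a + + 1))) * (+ 6 * a + + 1 - + 2 * (l + (+ 3 * a + + 1)))) + + 1 * ((+ 6 * a + + 1 + + 6 * (l + (+ 3 * a + + 1))) * (+ 6 * a + + 1 + + 6 * (l + (+ 3 * a + + 1))))
          ≡ + 2 * ((+ 6 * a + + 1 + + 6 * (+ 2 * l + + 1)) * (+ 6 * a + + 1 + + 6 * (+ 2 * l + + 1))) + + 14 * ((+ 6 * a + + 1) * (+ 6 * a + + 1))
    eq₄ = solve-∀

  -- In terms of T (g , f) = 48 (3 g² + g f + 2 f²), the three series count the pairs (g , f) up to sign with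
  -- g + f odd, g odd and f odd; a pair not divisible by 2 satisfies exactly two of these conditions.
  odd-ψ₁ψ₂₃ : P 46 · P 2 ≈ odd (ψ 1 · ψ 23) ⊕ mono 1 · (ψ 1 · ψ 23)
  odd-ψ₁ψ₂₃ = case split₂ (shear {w' = λ d c → + 72 * ((+ 4 * d + + 1) * (+ 4 * d + + 1)) + + 24 * ((+ 4 * d + + 1) * c) + + 48 * (c * c)} (λ d → d) eq₀ (swapped base)) of λ { (splits {l} {r} c₀ c₁ e) →
    case split₂ (reflect {w' = λ d f → T (+ 4 * d + + 1 - f) f} (λ d → + 2 * d) eq₂ c₁) of λ { (splits {oe} {eo} a₀ a₁ e₁) →
    case split₂ (shear {w' = λ d f → T (+ 4 * d + + 1) f} (λ d → d) eq₃ (swapped double-base)) of λ { (splits {oe'} {oo} b₀ b₁ e₂) →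
    case split₂ a₀ of λ { (splits {p₀} {p₁} u₀ u₁ e₃) →
    case split₂ a₁ of λ { (splits {q₀} {q₁} v₀ v₁ e₄) →
    case split₂ b₁ of λ { (splits {r₀} {r₁} w₀ w₁ e₅) →
    let z = counts-off 47 96 24 (s≤s z≤n) 24<48 (λ (d , c) → + 24 * d * d + + 12 * d + (+ 4 * d + + 1) * c + + 4 * c * c - + 1) (λ (d , c) → eq₁ d c) c₀
        OE = merge₂ {w = λ d h → T (+ 4 * d + + 1) (+ 2 * h)}
               (swapped (shear {w' = λ j d → T (+ 4 * d + + 1) (+ 2 * (+ 2 * j))} (λ j → j) (λ j d → cong (λ x → T x (+ 2 * (+ 2 * j))) (eq₄ j d)) (swapped u₀)))
               (swapped (reflect {w' = λ j d → T (+ 4 * d + + 1) (+ 2 * (+ 2 * j + + 1))} (λ j → - (+ 1) - j) (λ j d → T-neg (eq₅ j d) refl)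
                 (swapped (reflect {w' = λ d j → T (+ 4 * d + + 3 + + 4 * j) (- (+ 2 * (+ 2 * j + + 1)))} (λ _ → - (+ 1)) (λ d j → cong₂ T (eq₆ d j) (eq₆' j)) u₁))))
        EO = merge₂ {w = λ j g → T (+ 2 * g) (+ 4 * j + + 1)}
               (shear {w' = λ j d → T (+ 2 * (+ 2 * d)) (+ 4 * j + + 1)} (λ j → j) (λ j d → cong₂ T (eq₇ j d) (eq₇' j)) (swapped v₀))
               (reflect {w' = λ j d → T (+ 2 * (+ 2 * d + + 1)) (+ 4 * j + + 1)} (λ j → - (+ 1) - j) (λ j d → T-neg (eq₈ j d) refl)
                 (swapped (reflect {w' = λ d j → T (+ 4 * d + + 2 + + 4 * j) (- (+ 4 * j + + 1))} (λ _ → - (+ 1)) (λ d j → cong₂ T (eq₉ d j) (eq₉' j)) v₁)))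
        OO = merge₂ {w = λ j g → T (+ 2 * g + + 1) (+ 4 * j + + 1)}
               (swapped (pointwise {w' = λ d j → T (+ 2 * (+ 2 * d) + + 1) (+ 4 * j + + 1)} (λ d j → cong₂ T (eq₁₀ d) (sym (eq₁₀ j))) w₀))
               (reflect {w' = λ j d → T (+ 2 * (+ 2 * d + + 1) + + 1) (+ 4 * j + + 1)} (λ _ → - (+ 1)) (λ j d → T-neg (eq₁₁ d) refl)
                 (swapped (reflect {w' = λ d j → T (+ 4 * d + + 1) (- (+ 4 * j + + 1))} (λ _ → - (+ 1)) (λ d j → cong (T (+ 4 * d + + 1)) (eq₁₂ j)) w₁)))
        S₃ = mod4→mod6 (quad-even (+ 92) (+ 4)) (pointwise {w' = λ b c → quad (+ 92) (+ 4) (+ 4 * b + + 1) (+ 4 * b + + 1 + + 6 * c)} eq₁₃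
               (merge₂ {w = λ b c → T c (+ 4 * b + + 1)} EO OO))
        oe≈ = counts-unique OE b₀
    in ≈-trans (counts-unique₀ (ΘΘ-counts 𝖯 92 46 𝖯 4 2 0 refl refl refl) S₃)
         (assemble (≈-trans (≈-sym (λ n → ·-identityˡ (ψ 1 · ψ 23) (suc (double n)))) e) z e₁ e₂ (≈-trans e₃ oe≈) e₄ e₅) } } } } } }
    where
    open Std 48 96
    open LatticeLemmas (progression 48 96)
    T : ℤ → ℤ → ℤ
    T g f = + 144 * (g * g) + + 48 * (g * f) + + 96 * (f * f)
    T-neg : ∀ {g g' f f'} → g ≡ - g' → f ≡ - f' → T g f ≡ T g' f'
    T-neg {g} {g'} {f} {f'} refl refl = eq g' f'
      where
      eq : ∀ g f → + 144 * (- g * - g) + + 48 * (- g * - f) + + 96 * (- f * - f) ≡ + 144 * (g * g) + + 48 * (g * f) + + 96 * (f * f)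
      eq = solve-∀
    base = odd-counts 24 72 (Std.ΘΘ-counts 24 72 𝖳 1 1 𝖳 23 23 0 refl refl refl)
    double-base = ΘΘ-counts 𝖳 2 1 𝖳 46 23 1 refl refl refl
    eq₀ : ∀ d c → + 3 * ((+ 4 * (c + d) + + 1) * (+ 4 * (c + d) + + 1)) + + 69 * ((+ 4 * d + + 1) * (+ 4 * d + + 1)) ≡ + 72 * ((+ 4 * d + + 1) * (+ 4 * d + + 1)) + + 24 * ((+ 4 * d + + 1) * c) + + 48 * (c * c)
    eq₀ = solve-∀
    eq₁ : ∀ d c → + 72 * ((+ 4 * d + + 1) * (+ 4 * d + + 1)) + + 24 * ((+ 4 * d + + 1) * (+ 2 * c)) + + 48 * ((+ 2 * c) * (+ 2 * c)) ≡ + 48 * (+ 24 * d * d + + 12 * d + (+ 4 * d + + 1) * c + + 4 * c * c - + 1) + + 120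
    eq₁ = solve-∀
    eq₂ : ∀ d f → + 72 * ((+ 4 * d + + 1) * (+ 4 * d + + 1)) + + 24 * ((+ 4 * d + + 1) * (+ 2 * (+ 2 * d - f) + + 1)) + + 48 * ((+ 2 * (+ 2 * d - f) + + 1) * (+ 2 * (+ 2 * d - f) + + 1)) ≡ + 144 * ((+ 4 * d + + 1 - f) * (+ 4 * d + + 1 - f)) + + 48 * ((+ 4 * d + + 1 - f) * f) + + 96 * (f * f)
    eq₂ = solve-∀
    eq₃ : ∀ d f → + 6 * ((+ 4 * (f + d) + + 1) * (+ 4 * (f + d) + + 1)) + + 138 * ((+ 4 * d + + 1) * (+ 4 * d + + 1)) ≡ + 144 * ((+ 4 * d + + 1) * (+ 4 * d + + 1)) + + 48 * ((+ 4 * d + + 1) * f) + + 96 * (f * f)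
    eq₃ = solve-∀
    eq₄ : ∀ j d → + 4 * (d + j) + + 1 - + 2 * (+ 2 * j) ≡ + 4 * d + + 1
    eq₄ = solve-∀
    eq₅ : ∀ j d → + 4 * (- (+ 1) - j - d) + + 3 + + 4 * j ≡ - (+ 4 * d + + 1)
    eq₅ = solve-∀
    eq₆ : ∀ d j → + 4 * d + + 1 - + 2 * (+ 2 * (- (+ 1) - j) + + 1) ≡ + 4 * d + + 3 + + 4 * j
    eq₆ = solve-∀
    eq₆' : ∀ j → + 2 * (+ 2 * (- (+ 1) - j) + + 1) ≡ - (+ 2 * (+ 2 * j + + 1))
    eq₆' = solve-∀
    eq₇ : ∀ j d → + 4 * (d + j) + + 1 - (+ 2 * (+ 2 * j) + + 1) ≡ + 2 * (+ 2 * d)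
    eq₇ = solve-∀
    eq₇' : ∀ j → + 2 * (+ 2 * j) + + 1 ≡ + 4 * j + + 1
    eq₇' = solve-∀
    eq₈ : ∀ j d → + 4 * (- (+ 1) - j - d) + + 2 + + 4 * j ≡ - (+ 2 * (+ 2 * d + + 1))
    eq₈ = solve-∀
    eq₉ : ∀ d j → + 4 * d + + 1 - (+ 2 * (+ 2 * (- (+ 1) - j) + + 1) + + 1) ≡ + 4 * d + + 2 + + 4 * j
    eq₉ = solve-∀
    eq₉' : ∀ j → + 2 * (+ 2 * (- (+ 1) - j) + + 1) + + 1 ≡ - (+ 4 * j + + 1)
    eq₉' = solve-∀
    eq₁₀ : ∀ d → + 4 * d + + 1 ≡ + 2 * (+ 2 * d) + + 1
    eq₁₀ = solve-∀
    eq₁₁ : ∀ d → + 4 * (- (+ 1) - d) + + 1 ≡ - (+ 2 * (+ 2 * d + + 1) + + 1)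
    eq₁₁ = solve-∀
    eq₁₂ : ∀ j → + 2 * (+ 2 * (- (+ 1) - j) + + 1) + + 1 ≡ - (+ 4 * j + + 1)
    eq₁₂ = solve-∀
    eq₁₃ : ∀ b c → + 144 * (c * c) + + 48 * (c * (+ 4 * b + + 1)) + + 96 * ((+ 4 * b + + 1) * (+ 4 * b + + 1)) ≡ + 92 * ((+ 4 * b + + 1) * (+ 4 * b + + 1)) + + 4 * ((+ 4 * b + + 1 + + 6 * c) * (+ 4 * b + + 1 + + 6 * c))
    eq₁₃ = solve-∀
    assemble : ∀ {u l r oe eo oe' oo s Q R} → u ≈ l ⊕ r → l ≈ 𝟘 → r ≈ oe ⊕ eo → s ≈ oe' ⊕ oo → oe ≈ oe' → eo ≈ Q → oo ≈ R → Q ⊕ R ≈ u ⊕ s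
    assemble {oe' = oe'} {Q = Q} {R} e z e₁ e₂ e₃ e₄ e₅ n = sym (trans
      (cong₂ _xor_ (trans (e n) (cong₂ _xor_ (z n) (trans (e₁ n) (cong₂ _xor_ (e₃ n) (e₄ n))))) (trans (e₂ n) (cong (oe' n xor_) (e₅ n))))
      (trans (xor-interchange (oe' n) (Q n) (oe' n) (R n)) (cong (_xor (Q n xor R n)) (xor-same (oe' n)))))

-- The generating function mod 2 and sparse theta products

module Lacunarity where

  open Density using (Sparse; count; count-suc; norm; norm-sparse; sparse-⊆; sparse-tail)
  open Series
  open EulerProduct using (numerator; partialProd-euler; numerator-euler)
  open Theta hiding (from; to)
  open import Defs
  open import Data.Nat as ℕ using (ℕ; zero; suc; _≤_; _<_; z≤n; s≤s)
  import Data.Nat.Properties as ℕP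
  import Data.Nat.Tactic.RingSolver as ℕS
  open import Data.Nat.Divisibility using (_∣_; _∣?_; divides)
  open import Data.Integer as ℤ using (ℤ; +_; -[1+_]; ∣_∣)
  import Data.Integer.Properties as ℤP
  import Data.Integer.Tactic.RingSolver as ℤS
  open import Data.Rational as ℚ using (ℚ; mkℚ; 0ℚ; 1ℚ)
  import Data.Rational.Properties as ℚP
  open import Data.Rational.Unnormalised as ℚᵘ using (mkℚᵘ)
  import Data.Rational.Unnormalised.Properties as ℚᵘP
  open import Data.Bool using (Bool; true; false; _∧_; _xor_; not)
  open import Data.Bool.Properties using (xor-identityʳ)
  open import Data.List using (applyUpTo; filter; length)
  open import Data.List.Properties using (filter-accept; filter-reject)
  open import Data.Product using (∃₂; _×_; _,_; proj₁; proj₂)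
  open import Function using (_∘_; id; it)
  open import Relation.Nullary
  open import Relation.Unary using (Decidable)
  open import Relation.Binary.PropositionalEquality
  open SeriesSolver using (solve; _:*_; _:+_; _:=_)

  G : ℕ → Ser
  G i = mod2 (Cbar (4 ℕ.* i) i)

  P-square : ∀ k .{{_ : ℕ.NonZero k}} → P k · P k ≈ P (2 ℕ.* k)
  P-square k = Θ-square 𝖯 k

  ≈[]-trans : ∀ {n f g h} → f ≈[ n ] g → g ≈[ n ] h → f ≈[ n ] h
  ≈[]-trans e e' j j≤n = trans (e j j≤n) (e' j j≤n)

  ≈⇒≈[] : ∀ {n f g} → f ≈ g → f ≈[ n ] g
  ≈⇒≈[] e j _ = e j

  ≈[]-mono : ∀ {m n f g} → m ≤ n → f ≈[ n ] g → f ≈[ m ] g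
  ≈[]-mono m≤n e j j≤m = e j (ℕP.≤-trans j≤m m≤n)

  -- By `numerator-euler` the numerator is P_i P_4i / P_2i, and P_4i = P_2i² reduces it to P_i P_2i.
  numerator-ψ : ∀ i .{{_ : ℕ.NonZero i}} n → numerator i n ≈[ n ] ψ i
  numerator-ψ i n = ·-cancelʳ-≈[] (P (2 ℕ.* i)) (P-head (2 ℕ.* i))
    (≈[]-trans (·-≈[] (λ _ _ → refl) (λ j j≤n → sym (euler-P (2 ℕ.* i) (2 ℕ.* n) 2i>0 j (ℕP.≤-trans j≤n (ℕP.m≤n*m n 2)))))
    (≈[]-trans (≈⇒≈[] (numerator-euler i n))
    (≈[]-trans (·-≈[] (≈[]-mono (ℕP.m≤n*m n 4) (euler-P i (4 ℕ.* n) i>0)) (euler-P (4 ℕ.* i) n 4i>0))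
    (≈⇒≈[] (≈-trans (·-cong (≈-refl {P i}) (≈-trans (≡⇒≈ P (ℕP.*-assoc 2 2 i)) (≈-sym (P-square (2 ℕ.* i) {{2i≢0}}))))
      (≈-trans (≈-sym (·-assoc (P i) (P (2 ℕ.* i)) (P (2 ℕ.* i)))) (·-cong (P·P i) (≈-refl {P (2 ℕ.* i)})))))))) 
    where
    2i≢0 : ℕ.NonZero (2 ℕ.* i)
    2i≢0 = ℕP.m*n≢0 2 i
    i>0 : 0 < i
    i>0 = ℕ.>-nonZero⁻¹ i
    2i>0 : 0 < 2 ℕ.* i
    2i>0 = ℕ.>-nonZero⁻¹ (2 ℕ.* i) {{2i≢0}}
    4i>0 : 0 < 4 ℕ.* i
    4i>0 = ℕ.>-nonZero⁻¹ (4 ℕ.* i) {{ℕP.m*n≢0 4 i}}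

  partialProd-ψ : ∀ i .{{_ : ℕ.NonZero i}} n → mod2 (partialProd (4 ℕ.* i) i n) · P 1 ≈[ n ] ψ i
  partialProd-ψ i n = ≈[]-trans (·-≈[] (λ _ _ → refl) (λ j j≤n → sym (euler-P 1 n (s≤s z≤n) j j≤n))) (≈[]-trans (≈⇒≈[] (partialProd-euler i n)) (numerator-ψ i n))

  G·P₁ : ∀ i .{{_ : ℕ.NonZero i}} → G i · P 1 ≈ ψ i
  G·P₁ i n = trans (·-cong[] n settled (λ _ _ → refl)) (partialProd-ψ i n n ℕP.≤-refl)
    where
    -- `Cbar` takes its j-th coefficient from the j-th partial product. That product and the n-th
    -- one agree up to degree j since both become ψ_i after multiplication by `P 1`.
    settled : G i ≈[ n ] mod2 (partialProd (4 ℕ.* i) i n)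
    settled j j≤n = ·-cancelʳ-≈[] {j} {mod2 (partialProd (4 ℕ.* i) i j)} {mod2 (partialProd (4 ℕ.* i) i n)} (P 1) (P-head 1)
      (≈[]-trans (partialProd-ψ i j) (≈[]-mono j≤n (λ k k≤n → sym (partialProd-ψ i n k k≤n)))) j ℕP.≤-refl

  -- P_4 = P_1 P_1 P_2: one P_1 is absorbed by G, and the other pairs with P_2 to ψ_1.
  G·P₄ : ∀ i .{{_ : ℕ.NonZero i}} → G i · P 4 ≈ ψ 1 · ψ i
  G·P₄ i = ≈-trans (·-cong (≈-refl {G i}) (≈-trans (≈-sym (P-square 2)) (·-cong (≈-sym (P-square 1)) (≈-refl {P 2}))))
    (≈-trans (regroup (G i) (P 1) (P 2)) (·-cong (P·P 1) (G·P₁ i)))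
    where
    regroup : ∀ g p p' → g · ((p · p) · p') ≈ (p · p') · (g · p)
    regroup = solve 3 (λ g p p' → g :* ((p :* p) :* p') := (p :* p') :* (g :* p)) ≈-refl

  -- Sparseness of theta products

  sparse-≈ : ∀ {f g} → f ≈ g → Sparse g → Sparse f
  sparse-≈ e = sparse-⊆ λ n p → trans (sym (e n)) p

  sparse-mono : ∀ {f} → Sparse f → ∀ s → Sparse (mono s · f)
  sparse-mono {f} sp zero = sparse-≈ (·-identityˡ f) sp
  sparse-mono {f} sp (suc s) K with sparse-mono sp s K
  ... | X₀ , h = X₀ , λ X X≥ → ℕP.≤-trans (ℕP.*-monoʳ-≤ K (le X)) (h X X≥)
    where
    le : ∀ X → count (mono (suc s) · f) X ≤ count (mono s · f) X
    le zero = z≤n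
    le (suc X) = ℕP.≤-trans (ℕP.≤-reflexive (count-suc (mono (suc s) · f) X)) (ℕP.m≤m+n _ _)

  sparse-unmono : ∀ {f} → Sparse (mono 1 · f) → Sparse f
  sparse-unmono {f} sp = sparse-≈ (λ n → sym (·-identityˡ f n)) (sparse-tail sp)

  affine-norm-sparse : ∀ (f : Ser) A B N → 0 < A → 0 < N → (∀ n → f n ≡ true → ∃₂ λ x y → A ℕ.* n ℕ.+ B ≡ norm N x y) → Sparse f
  affine-norm-sparse f (suc a) B N _ N>0 rep = norm-sparse f a B N N>0 rep

  square-root : ∀ κ z → mult κ ℕ.* (∣ root κ z ∣ ℕ.* ∣ root κ z ∣) ≡ 24 ℕ.* expo κ z ℕ.+ mult κ
  square-root κ z = ℤP.+-injective (trans (trans (ℤP.pos-* (mult κ) _) (cong (ℤ._*_ (+ mult κ)) (sym (sq (root κ z))))) (weight κ z))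
    where
    sq : ∀ z → z ℤ.* z ≡ + (∣ z ∣ ℕ.* ∣ z ∣)
    sq (+ m) = sym (ℤP.pos-* m m)
    sq -[1+ m ] = refl

  mult-nonZero : ∀ κ → ℕ.NonZero (mult κ)
  mult-nonZero 𝖯 = _
  mult-nonZero 𝖳 = _
  mult-nonZero 𝖮 = _

  -- α x² + β y² = M gives (α x)² + α β y² = α M.
  ΘΘ-sparse : ∀ κ k κ' k' .{{_ : ℕ.NonZero k}} .{{_ : ℕ.NonZero k'}} → Sparse (Θ κ k · Θ κ' k')
  ΘΘ-sparse κ k κ' k' = affine-norm-sparse (Θ κ k · Θ κ' k') (24 ℕ.* α) (α ℕ.* (α ℕ.+ β)) (α ℕ.* β)
      (ℕ.>-nonZero⁻¹ (24 ℕ.* α) {{ℕP.m*n≢0 24 α {{_}} {{α≢0}}}}) (ℕ.>-nonZero⁻¹ (α ℕ.* β) {{ℕP.m*n≢0 α β {{α≢0}} {{β≢0}}}})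
      λ n true → rep n (parity-true (subst (Parity' n) true (generates-· (Θ-generates κ k) (Θ-generates κ' k') n)))
    where
    Parity' : ℕ → Bool → Set
    Parity' n = Parity (Level (λ (y , z) → k ℕ.* expo κ y ℕ.+ k' ℕ.* expo κ' z) n)
    α β : ℕ
    α = k ℕ.* mult κ
    β = k' ℕ.* mult κ'
    α≢0 : ℕ.NonZero α
    α≢0 = ℕP.m*n≢0 k (mult κ) {{it}} {{mult-nonZero κ}}
    β≢0 : ℕ.NonZero β
    β≢0 = ℕP.m*n≢0 k' (mult κ') {{it}} {{mult-nonZero κ'}}
    expand : ∀ k k' e e' m m' X Y → m ℕ.* X ≡ 24 ℕ.* e ℕ.+ m → m' ℕ.* Y ≡ 24 ℕ.* e' ℕ.+ m' →
      24 ℕ.* (k ℕ.* e ℕ.+ k' ℕ.* e') ℕ.+ (k ℕ.* m ℕ.+ k' ℕ.* m') ≡ k ℕ.* m ℕ.* X ℕ.+ k' ℕ.* m' ℕ.* Y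
    expand k k' e e' m m' X Y p q = trans (eq₁ k k' e e' m m') (trans (cong₂ (λ a b → k ℕ.* a ℕ.+ k' ℕ.* b) (sym p) (sym q)) (eq₂ k k' m m' X Y))
      where
      eq₁ : ∀ k k' e e' m m' → 24 ℕ.* (k ℕ.* e ℕ.+ k' ℕ.* e') ℕ.+ (k ℕ.* m ℕ.+ k' ℕ.* m') ≡ k ℕ.* (24 ℕ.* e ℕ.+ m) ℕ.+ k' ℕ.* (24 ℕ.* e' ℕ.+ m')
      eq₁ = ℕS.solve-∀
      eq₂ : ∀ k k' m m' X Y → k ℕ.* (m ℕ.* X) ℕ.+ k' ℕ.* (m' ℕ.* Y) ≡ k ℕ.* m ℕ.* X ℕ.+ k' ℕ.* m' ℕ.* Y
      eq₂ = ℕS.solve-∀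
    rep : ∀ n → Level (λ (y , z) → k ℕ.* expo κ y ℕ.+ k' ℕ.* expo κ' z) n → ∃₂ λ x y → 24 ℕ.* α ℕ.* n ℕ.+ α ℕ.* (α ℕ.+ β) ≡ norm (α ℕ.* β) x y
    rep n ((y , z) , refl) = α ℕ.* X , Y ,
      trans (eq₃ α β (k ℕ.* expo κ y ℕ.+ k' ℕ.* expo κ' z)) (trans (cong (α ℕ.*_) (expand k k' (expo κ y) (expo κ' z) (mult κ) (mult κ') (X ℕ.* X) (Y ℕ.* Y) (square-root κ y) (square-root κ' z))) (eq₄ α β X Y))
      where
      X Y : ℕ
      X = ∣ root κ y ∣
      Y = ∣ root κ' z ∣
      eq₃ : ∀ α β n → 24 ℕ.* α ℕ.* n ℕ.+ α ℕ.* (α ℕ.+ β) ≡ α ℕ.* (24 ℕ.* n ℕ.+ (α ℕ.+ β))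
      eq₃ = ℕS.solve-∀
      eq₄ : ∀ α β X Y → α ℕ.* (α ℕ.* (X ℕ.* X) ℕ.+ β ℕ.* (Y ℕ.* Y)) ≡ α ℕ.* X ℕ.* (α ℕ.* X) ℕ.+ α ℕ.* β ℕ.* (Y ℕ.* Y)
      eq₄ = ℕS.solve-∀

  Θ-sparse : ∀ κ k .{{_ : ℕ.NonZero k}} → Sparse (Θ κ k)
  Θ-sparse κ k = affine-norm-sparse (Θ κ k) (24 ℕ.* α) (α ℕ.* α) 1 (ℕ.>-nonZero⁻¹ (24 ℕ.* α) {{ℕP.m*n≢0 24 α {{_}} {{α≢0}}}}) (s≤s z≤n)
      λ n true → rep n (parity-true (subst (Parity (Level (λ z → k ℕ.* expo κ z) n)) true (Θ-generates κ k n)))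
    where
    α : ℕ
    α = k ℕ.* mult κ
    α≢0 : ℕ.NonZero α
    α≢0 = ℕP.m*n≢0 k (mult κ) {{it}} {{mult-nonZero κ}}
    rep : ∀ n → Level (λ z → k ℕ.* expo κ z) n → ∃₂ λ x y → 24 ℕ.* α ℕ.* n ℕ.+ α ℕ.* α ≡ norm 1 x y
    rep n (z , refl) = α ℕ.* X , 0 , trans (eq₁ k (mult κ) (expo κ z)) (trans (cong (λ t → α ℕ.* (k ℕ.* t)) (sym (square-root κ z))) (eq₂ k (mult κ) X))
      where
      X : ℕ
      X = ∣ root κ z ∣
      eq₁ : ∀ k m e → 24 ℕ.* (k ℕ.* m) ℕ.* (k ℕ.* e) ℕ.+ k ℕ.* m ℕ.* (k ℕ.* m) ≡ k ℕ.* m ℕ.* (k ℕ.* (24 ℕ.* e ℕ.+ m))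
      eq₁ = ℕS.solve-∀
      eq₂ : ∀ k m X → k ℕ.* m ℕ.* (k ℕ.* (m ℕ.* (X ℕ.* X))) ≡ k ℕ.* m ℕ.* X ℕ.* (k ℕ.* m ℕ.* X) ℕ.+ 1 ℕ.* (0 ℕ.* 0)
      eq₂ = ℕS.solve-∀

  -- Lacunarity

  even⇔ : ∀ n → (isOdd n ≡ false → 2 ∣ n) × (2 ∣ n → isOdd n ≡ false)
  even⇔ n = (λ e → from n e) , λ { (divides q refl) → trans (isOdd-* q 2) (∧-zero (isOdd q)) }
    where
    ∧-zero : ∀ b → b ∧ false ≡ false
    ∧-zero true = refl
    ∧-zero false = refl
    from : ∀ n → isOdd n ≡ false → 2 ∣ n
    from zero _ = divides 0 refl
    from (suc (suc n)) e with from n (trans (sym (not-not (isOdd n))) e)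
      where
      not-not : ∀ b → not (not b) ≡ b
      not-not true = refl
      not-not false = refl
    ... | divides q refl = divides (suc q) refl

  length-filter-count : ∀ {Q : ℕ → Set} (Q? : Decidable Q) (f : Ser) → (∀ n → f n ≡ false → Q n) → (∀ n → Q n → f n ≡ false) →
    ∀ (h : ℕ → ℕ) m → length (filter Q? (applyUpTo h m)) ℕ.+ count (f ∘ h) m ≡ m
  length-filter-count Q? f to from h zero = refl
  length-filter-count Q? f to from h (suc m) with f (h 0) in eq | count-suc (f ∘ h) m | length-filter-count Q? f to from (h ∘ suc) m
  ... | false | e | ih = trans (cong₂ (λ l c → length l ℕ.+ c) (filter-accept Q? (to (h 0) eq)) e) (cong suc ih)
  ... | true | e | ih = trans (cong₂ (λ l c → length l ℕ.+ c) (filter-reject Q? {x = h 0} (λ q → true≢false (trans (sym eq) (from (h 0) q)))) e) (trans (ℕP.+-suc _ _) (cong suc ih))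
    where
    true≢false : true ≢ false
    true≢false ()

  countEven-odd : ∀ a x → countEven a x ℕ.+ count (mod2 a) (suc x) ≡ suc x
  countEven-odd a x = length-filter-count (λ n → 2 ∣? ∣ a n ∣) (mod2 a) (λ n → proj₁ (even⇔ ∣ a n ∣)) (λ n → proj₂ (even⇔ ∣ a n ∣)) id (suc x)

  -- The indices 0, ..., y + 1 number y + 2 while the denominator is y + 1, so the deviation is (1 -
  -- O)/(y + 1); the summand 1 is why `suc O` appears. A positive ε is at least the reciprocal of
  -- its denominator.
  ratio-bound : ∀ E O y (ε : ℚ) → 0ℚ ℚ.< ε → E ℕ.+ O ≡ suc (suc y) → ℚ.↧ₙ ε ℕ.* suc O < suc y → ℚ.∣ (+ E) ℚ./ suc y ℚ.- 1ℚ ∣ ℚ.< ε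
  ratio-bound E O y ε@(mkℚ (+ suc k) d _) _ e lt = ℚP.toℚᵘ-cancel-< (ℚᵘP.<-respˡ-≃ (ℚᵘP.≃-sym (ℚᵘP.≃-trans (ℚP.toℚᵘ-homo-∣-∣ (r ℚ.- 1ℚ)) (ℚᵘP.∣-∣-cong r-1))) (ℚᵘ.*<* (subst₂ ℤ._<_ (ℤP.pos-* ∣ N ∣ (suc d)) (ℤP.pos-* (suc k) (suc (y ℕ.* 1))) (ℤ.+<+ bound))))
    where
    r : ℚ
    r = (+ E) ℚ./ suc y
    r-1 : ℚ.toℚᵘ (r ℚ.- 1ℚ) ℚᵘ.≃ mkℚᵘ (+ E) y ℚᵘ.- ℚᵘ.1ℚᵘ
    r-1 = ℚᵘP.≃-trans (ℚP.toℚᵘ-homo-+ r (ℚ.- 1ℚ)) (ℚᵘP.+-congˡ (ℚᵘ.- ℚᵘ.1ℚᵘ) (ℚP.toℚᵘ-fromℚᵘ (mkℚᵘ (+ E) y)))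
    N : ℤ
    N = + E ℤ.* + 1 ℤ.+ -[1+ 0 ] ℤ.* + suc y
    N≡ : N ≡ + 1 ℤ.- + O
    N≡ = trans (eq₁ (+ E) (+ suc y)) (trans (cong (λ z → z ℤ.- + O ℤ.- + suc y) (trans (sym (ℤP.pos-+ E O)) (trans (cong +_ e) (ℤP.pos-+ 1 (suc y))))) (eq₂ (+ suc y) (+ O)))
      where
      eq₁ : ∀ E s → E ℤ.* + 1 ℤ.+ -[1+ 0 ] ℤ.* s ≡ (E ℤ.+ + O) ℤ.- + O ℤ.- s
      eq₁ E s = eq E s (+ O)
        where
        eq : ∀ E s O → E ℤ.* + 1 ℤ.+ -[1+ 0 ] ℤ.* s ≡ (E ℤ.+ O) ℤ.- O ℤ.- s
        eq = ℤS.solve-∀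
      eq₂ : ∀ s O → (+ 1 ℤ.+ s) ℤ.- O ℤ.- s ≡ + 1 ℤ.- O
      eq₂ = ℤS.solve-∀
    bound : ∣ N ∣ ℕ.* suc d < suc k ℕ.* suc (y ℕ.* 1)
    bound = begin-strict
      ∣ N ∣ ℕ.* suc d                 ≤⟨ ℕP.*-monoˡ-≤ (suc d) (ℕP.≤-trans (ℕP.≤-reflexive (cong ∣_∣ N≡)) (ℤP.∣i-j∣≤∣i∣+∣j∣ (+ 1) (+ O))) ⟩
      suc O ℕ.* suc d                 ≡⟨ ℕP.*-comm (suc O) (suc d) ⟩
      suc d ℕ.* suc O                 <⟨ lt ⟩
      suc y                           ≡⟨ cong suc (sym (ℕP.*-identityʳ y)) ⟩
      suc (y ℕ.* 1)                   ≤⟨ ℕP.m≤n*m (suc (y ℕ.* 1)) (suc k) ⟩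
      suc k ℕ.* suc (y ℕ.* 1) ∎
      where open ℕP.≤-Reasoning
  ratio-bound E O y (mkℚ (+ zero) _ _) (ℚ.*<* (ℤ.+<+ ()))
  ratio-bound E O y (mkℚ -[1+ _ ] _ _) (ℚ.*<* ())

  sparse⇒lacunary : ∀ a → Sparse (mod2 a) → LacunaryMod2 a
  sparse⇒lacunary a sp ε ε>0 = X₀ ℕ.+ 4 ℕ.* q , λ y y≥ → ratio-bound (countEven a (suc y)) (count (mod2 a) (2 ℕ.+ y)) y ε ε>0 (countEven-odd a (suc y)) (bound y y≥)
    where
    q X₀ : ℕ
    q = ℚ.↧ₙ ε
    X₀ = proj₁ (sp (4 ℕ.* q))
    h : ∀ X → X₀ ≤ X → 4 ℕ.* q ℕ.* count (mod2 a) X ≤ X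
    h = proj₂ (sp (4 ℕ.* q))
    bound : ∀ y → X₀ ℕ.+ 4 ℕ.* q ≤ y → q ℕ.* suc (count (mod2 a) (2 ℕ.+ y)) < suc y
    bound y y≥ = ℕP.*-cancelˡ-< 4 _ _ (begin-strict
      4 ℕ.* (q ℕ.* suc O)             ≡⟨ eq q O ⟩
      4 ℕ.* q ℕ.+ 4 ℕ.* q ℕ.* O       ≤⟨ ℕP.+-mono-≤ (ℕP.≤-trans (ℕP.m≤n+m _ X₀) y≥) (h (2 ℕ.+ y) (ℕP.≤-trans (ℕP.≤-trans (ℕP.m≤m+n X₀ _) y≥) (ℕP.m≤n+m y 2))) ⟩
      y ℕ.+ (2 ℕ.+ y)                 <⟨ ℕP.m<m+n _ (s≤s z≤n) ⟩
      y ℕ.+ (2 ℕ.+ y) ℕ.+ suc (suc (2 ℕ.* y)) ≡⟨ eq' y ⟩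
      4 ℕ.* suc y ∎)
      where
      open ℕP.≤-Reasoning
      O = count (mod2 a) (2 ℕ.+ y)
      eq : ∀ q O → 4 ℕ.* (q ℕ.* suc O) ≡ 4 ℕ.* q ℕ.+ 4 ℕ.* q ℕ.* O
      eq = ℕS.solve-∀
      eq' : ∀ y → y ℕ.+ (2 ℕ.+ y) ℕ.+ suc (suc (2 ℕ.* y)) ≡ 4 ℕ.* suc y
      eq' = ℕS.solve-∀

  -- Sections of monomials and theta products

  even-cong : ∀ {f g} → f ≈ g → even f ≈ even g
  even-cong e n = e (double n)

  odd-cong : ∀ {f g} → f ≈ g → odd f ≈ odd g
  odd-cong e n = e (suc (double n))

  even-mono : ∀ s → even (mono (double s)) ≈ mono s
  even-mono zero zero = refl
  even-mono zero (suc n) = refl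
  even-mono (suc s) zero = refl
  even-mono (suc s) (suc n) = even-mono s n

  even-mono-odd : ∀ s → even (mono (suc (double s))) ≈ 𝟘
  even-mono-odd s zero = refl
  even-mono-odd zero (suc n) = refl
  even-mono-odd (suc s) (suc n) = even-mono-odd s n

  odd-mono : ∀ s → odd (mono (suc (double s))) ≈ mono s
  odd-mono zero zero = refl
  odd-mono zero (suc n) = refl
  odd-mono (suc s) zero = refl
  odd-mono (suc s) (suc n) = odd-mono s n

  odd-mono-even : ∀ s → odd (mono (double s)) ≈ 𝟘
  odd-mono-even zero n = refl
  odd-mono-even (suc s) zero = refl
  odd-mono-even (suc s) (suc n) = odd-mono-even s n

  even-shift : ∀ f → even (mono 2 · f) ≈ mono 1 · even f
  even-shift f zero = refl
  even-shift f (suc n) = trans (·-identityˡ f (double n)) (sym (·-identityˡ (even f) n))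

  even-·Θ : ∀ κ k .{{_ : ℕ.NonZero k}} f → even (f · Θ κ (2 ℕ.* k)) ≈ even f · Θ κ k
  even-·Θ κ k f = ≈-trans (even-cong (·-cong (≈-refl {f}) (≈-sym (Θ-dilate κ k)))) (even-· f (Θ κ k))

  odd-·Θ : ∀ κ k .{{_ : ℕ.NonZero k}} f → odd (f · Θ κ (2 ℕ.* k)) ≈ odd f · Θ κ k
  odd-·Θ κ k f = ≈-trans (odd-cong (·-cong (≈-refl {f}) (≈-sym (Θ-dilate κ k)))) (odd-· f (Θ κ k))

  even-Θ : ∀ κ k .{{_ : ℕ.NonZero k}} → even (Θ κ (2 ℕ.* k)) ≈ Θ κ k
  even-Θ κ k = ≈-trans (even-cong (≈-sym (Θ-dilate κ k))) (dilate-double (Θ κ k))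

  odd-Θ : ∀ κ k .{{_ : ℕ.NonZero k}} → odd (Θ κ (2 ℕ.* k)) ≈ 𝟘
  odd-Θ κ k = ≈-trans (odd-cong (≈-sym (Θ-dilate κ k))) (dilate-odd (Θ κ k))

  even-·ΘΘ : ∀ κ k κ' k' .{{_ : ℕ.NonZero k}} .{{_ : ℕ.NonZero k'}} f → even (f · (Θ κ (2 ℕ.* k) · Θ κ' (2 ℕ.* k'))) ≈ even f · (Θ κ k · Θ κ' k')
  even-·ΘΘ κ k κ' k' f = ≈-trans (even-cong (≈-sym (·-assoc f (Θ κ (2 ℕ.* k)) (Θ κ' (2 ℕ.* k'))))) (≈-trans (even-·Θ κ' k' (f · Θ κ (2 ℕ.* k)))
    (≈-trans (·-cong (even-·Θ κ k f) (≈-refl {Θ κ' k'})) (·-assoc (even f) (Θ κ k) (Θ κ' k'))))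

  odd-·ΘΘ : ∀ κ k κ' k' .{{_ : ℕ.NonZero k}} .{{_ : ℕ.NonZero k'}} f → odd (f · (Θ κ (2 ℕ.* k) · Θ κ' (2 ℕ.* k'))) ≈ odd f · (Θ κ k · Θ κ' k')
  odd-·ΘΘ κ k κ' k' f = ≈-trans (odd-cong (≈-sym (·-assoc f (Θ κ (2 ℕ.* k)) (Θ κ' (2 ℕ.* k'))))) (≈-trans (odd-·Θ κ' k' (f · Θ κ (2 ℕ.* k)))
    (≈-trans (·-cong (odd-·Θ κ k f) (≈-refl {Θ κ' k'})) (·-assoc (odd f) (Θ κ k) (Θ κ' k'))))

  vanish : ∀ {f g} → f ≈ 𝟘 → f · g ≈ 𝟘
  vanish {f} {g} z = ≈-trans (·-cong z (≈-refl {g})) (·-zeroˡ g)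

  drop-unit : ∀ {f g} → f ≈ mono 0 → f · g ≈ g
  drop-unit {f} {g} u = ≈-trans (·-cong u (≈-refl {g})) (·-identityˡ g)

  ⊕-zeroʳ : ∀ {f g h} → g ≈ 𝟘 → f ≈ h → f ⊕ g ≈ h
  ⊕-zeroʳ {h = h} z e n = trans (cong₂ _xor_ (e n) (z n)) (xor-identityʳ (h n))

  ⊕-zeroˡ : ∀ {f g h} → f ≈ 𝟘 → g ≈ h → f ⊕ g ≈ h
  ⊕-zeroˡ z e n = cong₂ _xor_ (z n) (e n)

  evenG : ∀ i .{{_ : ℕ.NonZero i}} → even (G i) · P 2 ≈ even (ψ 1 · ψ i)
  evenG i = ≈-trans (≈-sym (even-·Θ 𝖯 2 (G i))) (even-cong (G·P₄ i))

  oddG : ∀ i .{{_ : ℕ.NonZero i}} → odd (G i) · P 2 ≈ odd (ψ 1 · ψ i)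
  oddG i = ≈-trans (≈-sym (odd-·Θ 𝖯 2 (G i))) (odd-cong (G·P₄ i))

  cancel-P : ∀ k {f g} → f · P k ≈ g · P k → f ≈ g
  cancel-P k = ·-cancelʳ (P k) (P-head k)

  P₈ : P 8 ≈ ψ 2 · P 2
  P₈ = ≈-trans (≈-sym (P-square 4)) (≈-trans (·-cong (≈-refl {P 4}) (≈-sym (P-square 2))) (≈-trans (regroup (P 4) (P 2)) (·-cong (P·P 2) (≈-refl {P 2}))))
    where
    regroup : ∀ a b → a · (b · b) ≈ (b · a) · b
    regroup = solve 2 (λ a b → a :* (b :* b) := (b :* a) :* b) ≈-refl

  P₄ : P 4 ≈ (P 1 · P 2) · P 1
  P₄ = ≈-trans (≈-sym (P-square 2)) (≈-trans (·-cong (≈-refl {P 2}) (≈-sym (P-square 1))) (regroup (P 2) (P 1)))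
    where
    regroup : ∀ a b → a · (b · b) ≈ (b · a) · b
    regroup = solve 2 (λ a b → a :* (b :* b) := (b :* a) :* b) ≈-refl

  ψ₁·-P₂ : ∀ f → ψ 1 · f ≈ (P 1 · f) · P 2
  ψ₁·-P₂ f = ≈-trans (·-cong (≈-sym (P·P 1)) (≈-refl {f})) (regroup (P 1) (P 2) f)
    where
    regroup : ∀ a b f → (a · b) · f ≈ (a · f) · b
    regroup = solve 3 (λ a b f → (a :* b) :* f := (a :* f) :* b) ≈-refl

  ψ₁·-P₁ : ∀ f → ψ 1 · f ≈ (P 2 · f) · P 1
  ψ₁·-P₁ f = ≈-trans (·-cong (≈-sym (P·P 1)) (≈-refl {f})) (regroup (P 1) (P 2) f)
    where
    regroup : ∀ a b f → (a · b) · f ≈ (b · f) · a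
    regroup = solve 3 (λ a b f → (a :* b) :* f := (b :* f) :* a) ≈-refl

  -- The individual families

  G₁ : G 1 ≈ P 2
  G₁ = cancel-P 1 (≈-trans (G·P₁ 1) (≈-trans (≈-sym (P·P 1)) (·-comm (P 1) (P 2))))

  G₃ : G 3 ≈ Ω 1
  G₃ = cancel-P 1 (≈-trans (G·P₁ 3) (≈-trans (≈-sym (P·Ω 1)) (·-comm (P 1) (Ω 1))))

  -- Through ψ_5 = P_5 P_10 the factor P_10 leaves the section, and `ψ₁P₅` has the even part P_4 =
  -- P_2².
  G₅ : even (G 5) ≈ P 2 · P 5
  G₅ = cancel-P 2 (begin
    even (G 5) · P 2                               ≈⟨ evenG 5 ⟩
    even (ψ 1 · ψ 5)                               ≈⟨ even-cong (≈-trans (·-cong (≈-refl {ψ 1}) (≈-sym (P·P 5))) (≈-sym (·-assoc (ψ 1) (P 5) (P 10)))) ⟩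
    even ((ψ 1 · P 5) · P 10)                      ≈⟨ even-·Θ 𝖯 5 (ψ 1 · P 5) ⟩
    even (ψ 1 · P 5) · P 5                         ≈⟨ ·-cong (≈-trans (even-cong ψ₁P₅) (⊕-zeroʳ (≈-trans (even-·ΘΘ 𝖯 1 𝖳 5 (mono 1)) (vanish (even-mono-odd 0))) (even-Θ 𝖯 4))) (≈-refl {P 5}) ⟩
    P 4 · P 5                                      ≈⟨ ·-cong (≈-sym (P-square 2)) (≈-refl {P 5}) ⟩
    (P 2 · P 2) · P 5                              ≈⟨ regroup (P 2) (P 5) ⟩
    (P 2 · P 5) · P 2 ∎)
    where
    open ≈-Reasoning
    regroup : ∀ a b → (a · a) · b ≈ (a · b) · a
    regroup = solve 2 (λ a b → (a :* a) :* b := (a :* b) :* a) ≈-refl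

  G₇-odd : odd (G 7) ≈ P 1 · ψ 7
  G₇-odd = cancel-P 2 (≈-trans (oddG 7) (≈-trans (odd-cong ψ₁ψ₇) (≈-trans
    (⊕-zeroˡ (⊕-zeroʳ (≈-trans (odd-·Θ 𝖳 28 (mono 6)) (vanish (odd-mono-even 3))) (odd-Θ 𝖳 4)) (≈-trans (odd-·ΘΘ 𝖳 1 𝖳 7 (mono 1)) (drop-unit (odd-mono 0))))
    (ψ₁·-P₂ (ψ 7)))))

  G₇-even : even (even (G 7)) ≈ P 1 · P 4
  G₇-even = cancel-P 1 (begin
    even (even (G 7)) · P 1                        ≈⟨ ≈-sym (even-·Θ 𝖯 1 (even (G 7))) ⟩
    even (even (G 7) · P 2)                        ≈⟨ even-cong (≈-trans (evenG 7) (≈-trans (even-cong ψ₁ψ₇) (⊕-zeroʳ (≈-trans (even-·ΘΘ 𝖳 1 𝖳 7 (mono 1)) (vanish (even-mono-odd 0)))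
                                                       (⊕-cong (even-Θ 𝖳 4) (≈-trans (even-·Θ 𝖳 28 (mono 6)) (·-cong (even-mono 3) (≈-refl {ψ 28}))))))) ⟩
    even (ψ 4 ⊕ mono 3 · ψ 28)                     ≈⟨ ⊕-zeroʳ (≈-trans (even-·Θ 𝖳 14 (mono 3)) (vanish (even-mono-odd 1))) (even-Θ 𝖳 2) ⟩
    ψ 2                                            ≈⟨ ≈-sym (P·P 2) ⟩
    P 2 · P 4                                      ≈⟨ ·-cong (≈-sym (P-square 1)) (≈-refl {P 4}) ⟩
    (P 1 · P 1) · P 4                              ≈⟨ regroup (P 1) (P 4) ⟩
    (P 1 · P 4) · P 1 ∎)
    where
    open ≈-Reasoning
    regroup : ∀ a b → (a · a) · b ≈ (a · b) · a
    regroup = solve 2 (λ a b → (a :* a) :* b := (a :* b) :* a) ≈-refl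

  -- `ψ-thirds` acts twice: forwards to open ψ_1 ψ_9, and backwards on the odd section, where Ω_6 =
  -- Ω_3² and ψ_9 = P_3 Ω_3 let Ω_3 be factored out and ψ_1 reappear.
  G₉ : odd (G 9) ≈ P 1 · Ω 3
  G₉ = cancel-P 2 (begin
    odd (G 9) · P 2                                           ≈⟨ oddG 9 ⟩
    odd (ψ 1 · ψ 9)                                           ≈⟨ odd-cong (≈-trans (·-cong ψ-thirds (≈-refl {ψ 9})) (≈-trans (expand (P 3) (mono 1) (ψ 9)) (⊕-cong (≈-trans (·-cong (≈-refl {P 3}) (≈-sym (P·Ω 3))) (≈-trans (collect (P 3) (Ω 3)) (·-cong (≈-refl {Ω 3}) (P-square 3)))) (·-cong (≈-refl {mono 1}) (Θ-square 𝖳 9))))) ⟩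
    odd (Ω 3 · P 6 ⊕ mono 1 · ψ 18)                           ≈⟨ ⊕-cong (≈-trans (odd-·Θ 𝖯 3 (Ω 3)) (·-cong odd-Ω₃ (≈-refl {P 3}))) (≈-trans (odd-·Θ 𝖳 9 (mono 1)) (drop-unit (odd-mono 0))) ⟩
    (mono 1 · Ω 6) · P 3 ⊕ ψ 9                                ≈⟨ ⊕-cong (·-cong (·-cong (≈-refl {mono 1}) (≈-sym (Θ-square 𝖮 3))) (≈-refl {P 3})) (≈-sym (P·Ω 3)) ⟩
    (mono 1 · (Ω 3 · Ω 3)) · P 3 ⊕ P 3 · Ω 3                  ≈⟨ factor-out (mono 1) (Ω 3) (P 3) ⟩
    (P 3 ⊕ mono 1 · (P 3 · Ω 3)) · Ω 3                        ≈⟨ ·-cong (≈-trans (⊕-cong (≈-refl {P 3}) (·-cong (≈-refl {mono 1}) (P·Ω 3))) (≈-sym ψ-thirds)) (≈-refl {Ω 3}) ⟩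
    ψ 1 · Ω 3                                                 ≈⟨ ψ₁·-P₂ (Ω 3) ⟩
    (P 1 · Ω 3) · P 2 ∎)
    where
    open ≈-Reasoning
    odd-Ω₃ : odd (Ω 3) ≈ mono 1 · Ω 6
    odd-Ω₃ = ≈-trans (odd-cong (Ω-halves 3)) (⊕-zeroˡ (odd-Θ 𝖯 12) (≈-trans (odd-·Θ 𝖮 6 (mono 3)) (·-cong (odd-mono 1) (≈-refl {Ω 6}))))
    expand : ∀ a m b → (a ⊕ m · b) · b ≈ a · b ⊕ m · (b · b)
    expand = solve 3 (λ a m b → (a :+ m :* b) :* b := a :* b :+ m :* (b :* b)) ≈-refl
    collect : ∀ a b → a · (a · b) ≈ b · (a · a)
    collect = solve 2 (λ a b → a :* (a :* b) := b :* (a :* a)) ≈-refl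
    factor-out : ∀ m o p → (m · (o · o)) · p ⊕ p · o ≈ (p ⊕ m · (p · o)) · o
    factor-out = solve 3 (λ m o p → (m :* (o :* o)) :* p :+ p :* o := (p :+ m :* (p :* o)) :* o) ≈-refl

  G₁₁-even : even (G 11) ≈ Ω 2 ⊕ mono 3 · Ω 11
  G₁₁-even = cancel-P 2 (begin
    even (G 11) · P 2                              ≈⟨ evenG 11 ⟩
    even (ψ 1 · ψ 11)                              ≈⟨ even-cong ψ₁ψ₁₁ ⟩
    even ((ψ 12 ⊕ mono 15 · ψ 132) ⊕ (mono 1 · (Ω 2 · P 44) ⊕ mono 6 · (P 4 · Ω 22)))
      ≈⟨ ⊕-cong (⊕-zeroʳ (≈-trans (even-·Θ 𝖳 66 (mono 15)) (vanish (even-mono-odd 7))) (even-Θ 𝖳 6))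
                (⊕-zeroˡ (≈-trans (even-·ΘΘ 𝖮 1 𝖯 22 (mono 1)) (vanish (even-mono-odd 0))) (≈-trans (even-·ΘΘ 𝖯 2 𝖮 11 (mono 6)) (·-cong (even-mono 3) (≈-refl {P 2 · Ω 11})))) ⟩
    ψ 6 ⊕ mono 3 · (P 2 · Ω 11)                    ≈⟨ ⊕-cong (≈-sym (P·Ω 2)) (≈-refl {mono 3 · (P 2 · Ω 11)}) ⟩
    P 2 · Ω 2 ⊕ mono 3 · (P 2 · Ω 11)              ≈⟨ factor-out (P 2) (Ω 2) (mono 3) (Ω 11) ⟩
    (Ω 2 ⊕ mono 3 · Ω 11) · P 2 ∎)
    where
    open ≈-Reasoning
    factor-out : ∀ p a m b → p · a ⊕ m · (p · b) ≈ (a ⊕ m · b) · p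
    factor-out = solve 4 (λ p a m b → p :* a :+ m :* (p :* b) := (a :+ m :* b) :* p) ≈-refl

  G₁₁-odd : even (odd (G 11)) ≈ ψ 1 · P 11
  G₁₁-odd = cancel-P 1 (begin
    even (odd (G 11)) · P 1                        ≈⟨ ≈-sym (even-·Θ 𝖯 1 (odd (G 11))) ⟩
    even (odd (G 11) · P 2)                        ≈⟨ even-cong (≈-trans (oddG 11) (≈-trans (odd-cong ψ₁ψ₁₁)
        (⊕-cong (⊕-zeroˡ (odd-Θ 𝖳 6) (≈-trans (odd-·Θ 𝖳 66 (mono 15)) (·-cong (odd-mono 7) (≈-refl {ψ 66}))))
                (⊕-zeroʳ (≈-trans (odd-·ΘΘ 𝖯 2 𝖮 11 (mono 6)) (vanish (odd-mono-even 3))) (≈-trans (odd-·ΘΘ 𝖮 1 𝖯 22 (mono 1)) (drop-unit (odd-mono 0))))))) ⟩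
    even (mono 7 · ψ 66 ⊕ Ω 1 · P 22)              ≈⟨ ⊕-zeroˡ (≈-trans (even-·Θ 𝖳 33 (mono 7)) (vanish (even-mono-odd 3))) (≈-trans (even-·Θ 𝖯 11 (Ω 1)) (·-cong even-Ω₁ (≈-refl {P 11}))) ⟩
    P 4 · P 11                                     ≈⟨ ·-cong (≈-trans P₄ (·-cong (P·P 1) (≈-refl {P 1}))) (≈-refl {P 11}) ⟩
    (ψ 1 · P 1) · P 11                             ≈⟨ regroup (ψ 1) (P 1) (P 11) ⟩
    (ψ 1 · P 11) · P 1 ∎)
    where
    open ≈-Reasoning
    even-Ω₁ : even (Ω 1) ≈ P 4
    even-Ω₁ = ≈-trans (even-cong (Ω-halves 1)) (⊕-zeroʳ (≈-trans (even-·Θ 𝖮 2 (mono 1)) (vanish (even-mono-odd 0))) (even-Θ 𝖯 4))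
    regroup : ∀ a b c → (a · b) · c ≈ (a · c) · b
    regroup = solve 3 (λ a b c → (a :* b) :* c := (a :* c) :* b) ≈-refl

  G₁₃ : even (G 13) ≈ ψ 2 · P 13 ⊕ mono 3 · (ψ 26 · P 13)
  G₁₃ = cancel-P 2 (begin
    even (G 13) · P 2                              ≈⟨ evenG 13 ⟩
    even (ψ 1 · ψ 13)                              ≈⟨ even-cong (≈-trans (·-cong (≈-refl {ψ 1}) (≈-sym (P·P 13))) (≈-sym (·-assoc (ψ 1) (P 13) (P 26)))) ⟩
    even ((ψ 1 · P 13) · P 26)                     ≈⟨ even-·Θ 𝖯 13 (ψ 1 · P 13) ⟩
    even (ψ 1 · P 13) · P 13                       ≈⟨ ·-cong (≈-trans even-ψ₁P₁₃ (⊕-cong P₈ (≈-refl {mono 3 · (P 2 · ψ 26)}))) (≈-refl {P 13}) ⟩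
    (ψ 2 · P 2 ⊕ mono 3 · (P 2 · ψ 26)) · P 13     ≈⟨ factor-out (ψ 2) (P 2) (mono 3) (ψ 26) (P 13) ⟩
    (ψ 2 · P 13 ⊕ mono 3 · (ψ 26 · P 13)) · P 2 ∎)
    where
    open ≈-Reasoning
    factor-out : ∀ a p m b r → (a · p ⊕ m · (p · b)) · r ≈ (a · r ⊕ m · (b · r)) · p
    factor-out = solve 5 (λ a p m b r → (a :* p :+ m :* (p :* b)) :* r := (a :* r :+ m :* (b :* r)) :* p) ≈-refl

  G₁₅-odd-even : even (odd (G 15)) ≈ ψ 3 · Ω 1
  G₁₅-odd-even = cancel-P 1 (begin
    even (odd (G 15)) · P 1                        ≈⟨ ≈-sym (even-·Θ 𝖯 1 (odd (G 15))) ⟩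
    even (odd (G 15) · P 2)                        ≈⟨ even-cong (≈-trans (oddG 15) odd-ψ₁ψ₁₅) ⟩
    even (ψ 12 ⊕ mono 1 · ψ 20)                    ≈⟨ ⊕-zeroʳ (≈-trans (even-·Θ 𝖳 10 (mono 1)) (vanish (even-mono-odd 0))) (even-Θ 𝖳 6) ⟩
    ψ 6                                            ≈⟨ ≈-sym (Θ-square 𝖳 3) ⟩
    ψ 3 · ψ 3                                      ≈⟨ ·-cong (≈-refl {ψ 3}) (≈-sym (P·Ω 1)) ⟩
    ψ 3 · (P 1 · Ω 1)                              ≈⟨ regroup (ψ 3) (P 1) (Ω 1) ⟩
    (ψ 3 · Ω 1) · P 1 ∎)
    where
    open ≈-Reasoning
    regroup : ∀ a b c → a · (b · c) ≈ (a · c) · b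
    regroup = solve 3 (λ a b c → a :* (b :* c) := (a :* c) :* b) ≈-refl

  -- This is `ψ₁P₅` divided by P_2, as ψ_1 = P_1 P_2 and P_8 = P_2 P_4 P_2.
  mono₁ψ₁₀ : mono 1 · ψ 10 ≈ P 1 · P 5 ⊕ P 2 · P 4
  mono₁ψ₁₀ = ≈-trans (swap (mono 1 · ψ 10) (P 2 · P 4) (P 1 · P 5) P₁P₅) (≈-refl {P 1 · P 5 ⊕ P 2 · P 4})
    where
    swap : ∀ a b c → c ≈ b ⊕ a → a ≈ c ⊕ b
    swap a b c e = ≈-trans (solve 2 (λ a b → a := (b :+ a) :+ b) ≈-refl a b) (⊕-cong (≈-sym e) (≈-refl {b}))
    regroup : ∀ a b c → (a · b) · c ≈ (a · c) · b
    regroup = solve 3 (λ a b c → (a :* b) :* c := (a :* c) :* b) ≈-refl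
    factor-out : ∀ a p m b → a · p ⊕ m · (p · b) ≈ (a ⊕ m · b) · p
    factor-out = solve 4 (λ a p m b → a :* p :+ m :* (p :* b) := (a :+ m :* b) :* p) ≈-refl
    P₁P₅ : P 1 · P 5 ≈ P 2 · P 4 ⊕ mono 1 · ψ 10
    P₁P₅ = cancel-P 2 (≈-trans (≈-sym (regroup (P 1) (P 2) (P 5))) (≈-trans (·-cong (P·P 1) (≈-refl {P 5})) (≈-trans ψ₁P₅
      (≈-trans (⊕-cong (≈-trans P₈ (·-cong (≈-sym (P·P 2)) (≈-refl {P 2}))) (≈-refl {mono 1 · (P 2 · ψ 10)})) (factor-out (P 2 · P 4) (P 2) (mono 1) (ψ 10))))))

  -- Stated with a factor q because only q ψ_10 splits into products divisible by P_1.
  G₁₅-odd-odd : mono 1 · odd (odd (G 15)) ≈ P 5 ⊕ P 1 · P 4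
  G₁₅-odd-odd = cancel-P 1 (begin
    (mono 1 · odd (odd (G 15))) · P 1              ≈⟨ ·-assoc (mono 1) (odd (odd (G 15))) (P 1) ⟩
    mono 1 · (odd (odd (G 15)) · P 1)              ≈⟨ ·-cong (≈-refl {mono 1}) (≈-trans (≈-sym (odd-·Θ 𝖯 1 (odd (G 15)))) (≈-trans (odd-cong (≈-trans (oddG 15) odd-ψ₁ψ₁₅))
                                                       (⊕-zeroˡ (odd-Θ 𝖳 6) (≈-trans (odd-·Θ 𝖳 10 (mono 1)) (drop-unit (odd-mono 0)))))) ⟩
    mono 1 · ψ 10                                  ≈⟨ mono₁ψ₁₀ ⟩
    P 1 · P 5 ⊕ P 2 · P 4                          ≈⟨ ⊕-cong (≈-refl {P 1 · P 5}) (·-cong (≈-sym (P-square 1)) (≈-refl {P 4})) ⟩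
    P 1 · P 5 ⊕ (P 1 · P 1) · P 4                  ≈⟨ factor-out (P 1) (P 5) (P 4) ⟩
    (P 5 ⊕ P 1 · P 4) · P 1 ∎)
    where
    open ≈-Reasoning
    factor-out : ∀ p a b → p · a ⊕ (p · p) · b ≈ (a ⊕ p · b) · p
    factor-out = solve 3 (λ p a b → p :* a :+ (p :* p) :* b := (a :+ p :* b) :* p) ≈-refl

  -- Since ψ_1 ψ_15 reproduces itself in this section, ψ_1 = P_1 P_2 supplies the factor P_1 to
  -- cancel.
  G₁₅-even-odd : odd (even (G 15)) ≈ mono 1 · (P 2 · ψ 15)
  G₁₅-even-odd = cancel-P 1 (≈-trans (≈-sym (odd-·Θ 𝖯 1 (even (G 15)))) (≈-trans (odd-cong (evenG 15)) (≈-trans odd-even-ψ₁ψ₁₅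
    (≈-trans (·-cong (≈-refl {mono 1}) (ψ₁·-P₁ (ψ 15))) (≈-sym (·-assoc (mono 1) (P 2 · ψ 15) (P 1)))))))

  -- Expanding ψ_1 ψ_17 into four P leaves P_2 P_34 outside the section. It comes back as P_1 P_17,
  -- and squaring either factor in the two terms produces the P_2 to cancel.
  G₁₇ : odd (G 17) ≈ ψ 1 · P 34 ⊕ mono 2 · (P 17 · P 68)
  G₁₇ = cancel-P 2 (begin
    odd (G 17) · P 2                                          ≈⟨ oddG 17 ⟩
    odd (ψ 1 · ψ 17)                                          ≈⟨ odd-cong (≈-trans (·-cong (≈-sym (P·P 1)) (≈-sym (P·P 17))) (regroup (P 1) (P 2) (P 17) (P 34))) ⟩
    odd ((P 17 · P 1) · (P 2 · P 34))                         ≈⟨ odd-·ΘΘ 𝖯 1 𝖯 17 (P 17 · P 1) ⟩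
    odd (P 17 · P 1) · (P 1 · P 17)                           ≈⟨ ·-cong odd-P₁P₁₇ (≈-refl {P 1 · P 17}) ⟩
    (P 17 · P 4 ⊕ mono 2 · (P 1 · P 68)) · (P 1 · P 17)       ≈⟨ expand (P 17) (P 4) (mono 2) (P 1) (P 68) ⟩
    (P 1 · (P 17 · P 17)) · P 4 ⊕ (mono 2 · (P 17 · P 68)) · (P 1 · P 1)
      ≈⟨ ⊕-cong (·-cong (·-cong (≈-refl {P 1}) (P-square 17)) (≈-sym (P-square 2))) (·-cong (≈-refl {mono 2 · (P 17 · P 68)}) (P-square 1)) ⟩
    (P 1 · P 34) · (P 2 · P 2) ⊕ (mono 2 · (P 17 · P 68)) · P 2      ≈⟨ collect (P 1) (P 34) (P 2) (mono 2 · (P 17 · P 68)) ⟩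
    ((P 1 · P 2) · P 34 ⊕ mono 2 · (P 17 · P 68)) · P 2              ≈⟨ ·-cong (⊕-cong (·-cong (P·P 1) (≈-refl {P 34})) (≈-refl {mono 2 · (P 17 · P 68)})) (≈-refl {P 2}) ⟩
    (ψ 1 · P 34 ⊕ mono 2 · (P 17 · P 68)) · P 2 ∎)
    where
    open ≈-Reasoning
    regroup : ∀ a b c d → (a · b) · (c · d) ≈ (c · a) · (b · d)
    regroup = solve 4 (λ a b c d → (a :* b) :* (c :* d) := (c :* a) :* (b :* d)) ≈-refl
    expand : ∀ s f m p x → (s · f ⊕ m · (p · x)) · (p · s) ≈ (p · (s · s)) · f ⊕ (m · (s · x)) · (p · p)
    expand = solve 5 (λ s f m p x → (s :* f :+ m :* (p :* x)) :* (p :* s) := (p :* (s :* s)) :* f :+ (m :* (s :* x)) :* (p :* p)) ≈-refl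
    collect : ∀ a b c r → (a · b) · (c · c) ⊕ r · c ≈ ((a · c) · b ⊕ r) · c
    collect = solve 4 (λ a b c r → (a :* b) :* (c :* c) :+ r :* c := ((a :* c) :* b :+ r) :* c) ≈-refl

  -- The factor q is inherited from the shift by q² in `even-P₁ψ₂₁`, halved by the even section.
  G₂₁ : mono 1 · even (G 21) ≈ (P 7 ⊕ P 1 · ψ 2) ⊕ mono 5 · (P 1 · ψ 42)
  G₂₁ = cancel-P 2 (begin
    (mono 1 · even (G 21)) · P 2                   ≈⟨ ≈-trans (·-assoc (mono 1) (even (G 21)) (P 2)) (·-cong (≈-refl {mono 1}) (evenG 21)) ⟩
    mono 1 · even (ψ 1 · ψ 21)                     ≈⟨ ·-cong (≈-refl {mono 1}) (≈-trans (even-cong (≈-trans (·-cong (≈-sym (P·P 1)) (≈-refl {ψ 21})) (regroup (P 1) (P 2) (ψ 21)))) (even-·Θ 𝖯 1 (ψ 21 · P 1))) ⟩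
    mono 1 · (even (ψ 21 · P 1) · P 1)             ≈⟨ ≈-trans (≈-sym (·-assoc (mono 1) (even (ψ 21 · P 1)) (P 1))) (·-cong (≈-sym (even-shift (ψ 21 · P 1))) (≈-refl {P 1})) ⟩
    even (mono 2 · (ψ 21 · P 1)) · P 1             ≈⟨ ·-cong (swap (even (mono 2 · (ψ 21 · P 1))) (P 8 ⊕ mono 5 · (P 2 · ψ 42)) (P 1 · P 7) even-P₁ψ₂₁) (≈-refl {P 1}) ⟩
    (P 1 · P 7 ⊕ (P 8 ⊕ mono 5 · (P 2 · ψ 42))) · P 1     ≈⟨ ·-cong (⊕-cong (≈-refl {P 1 · P 7}) (⊕-cong P₈ (≈-refl {mono 5 · (P 2 · ψ 42)}))) (≈-refl {P 1}) ⟩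
    (P 1 · P 7 ⊕ (ψ 2 · P 2 ⊕ mono 5 · (P 2 · ψ 42))) · P 1   ≈⟨ expand (P 1) (P 7) (ψ 2) (P 2) (mono 5) (ψ 42) ⟩
    P 7 · (P 1 · P 1) ⊕ (P 1 · ψ 2 ⊕ mono 5 · (P 1 · ψ 42)) · P 2   ≈⟨ ⊕-cong (·-cong (≈-refl {P 7}) (P-square 1)) (≈-refl {(P 1 · ψ 2 ⊕ mono 5 · (P 1 · ψ 42)) · P 2}) ⟩
    P 7 · P 2 ⊕ (P 1 · ψ 2 ⊕ mono 5 · (P 1 · ψ 42)) · P 2   ≈⟨ collect (P 7) (P 2) (P 1 · ψ 2) (mono 5 · (P 1 · ψ 42)) ⟩
    ((P 7 ⊕ P 1 · ψ 2) ⊕ mono 5 · (P 1 · ψ 42)) · P 2 ∎)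
    where
    open ≈-Reasoning
    swap : ∀ a b c → c ≈ b ⊕ a → a ≈ c ⊕ b
    swap a b c e = ≈-trans (solve 2 (λ a b → a := (b :+ a) :+ b) ≈-refl a b) (⊕-cong (≈-sym e) (≈-refl {b}))
    regroup : ∀ a b c → (a · b) · c ≈ (c · a) · b
    regroup = solve 3 (λ a b c → (a :* b) :* c := (c :* a) :* b) ≈-refl
    expand : ∀ p s t u m w → (p · s ⊕ (t · u ⊕ m · (u · w))) · p ≈ s · (p · p) ⊕ (p · t ⊕ m · (p · w)) · u
    expand = solve 6 (λ p s t u m w → (p :* s :+ (t :* u :+ m :* (u :* w))) :* p := s :* (p :* p) :+ (p :* t :+ m :* (p :* w)) :* u) ≈-refl
    collect : ∀ a p b c → a · p ⊕ (b ⊕ c) · p ≈ ((a ⊕ b) ⊕ c) · p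
    collect = solve 4 (λ a p b c → a :* p :+ (b :+ c) :* p := ((a :+ b) :+ c) :* p) ≈-refl

  G₂₃ : odd (G 23) ≈ P 46 ⊕ mono 1 · (P 1 · ψ 23)
  G₂₃ = cancel-P 2 (≈-trans (oddG 23) (≈-trans (swap (odd (ψ 1 · ψ 23)) (mono 1 · (ψ 1 · ψ 23)) (P 46 · P 2) odd-ψ₁ψ₂₃)
    (≈-trans (⊕-cong (≈-refl {P 46 · P 2}) (·-cong (≈-refl {mono 1}) (ψ₁·-P₂ (ψ 23)))) (factor-out (P 46) (P 2) (mono 1) (P 1 · ψ 23)))))
    where
    swap : ∀ a b c → c ≈ a ⊕ b → a ≈ c ⊕ b
    swap a b c e = ≈-trans (solve 2 (λ a b → a := (a :+ b) :+ b) ≈-refl a b) (⊕-cong (≈-sym e) (≈-refl {b}))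
    factor-out : ∀ a p m b → a · p ⊕ m · (b · p) ≈ (a ⊕ m · b) · p
    factor-out = solve 4 (λ a p m b → a :* p :+ m :* (b :* p) := (a :+ m :* b) :* p) ≈-refl

  lacunary : ∀ i (φ φ' : ℕ → ℕ) → (∀ n → φ n ≡ φ' n) → Sparse (λ n → G i (φ' n)) → LacunaryMod2 (λ n → Cbar (4 ℕ.* i) i (φ n))
  lacunary i φ φ' e sp = sparse⇒lacunary (λ n → Cbar (4 ℕ.* i) i (φ n)) (sparse-≈ (λ n → cong (G i) (e n)) sp)

  2n : ∀ n → 2 ℕ.* n ≡ double n
  2n n = sym (double≡2* n)

  2n+1 : ∀ n → 2 ℕ.* n ℕ.+ 1 ≡ suc (double n)
  2n+1 n = trans (ℕP.+-comm (2 ℕ.* n) 1) (cong suc (2n n))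

  4n : ∀ n → 4 ℕ.* n ≡ double (double n)
  4n n = trans (ℕP.*-assoc 2 2 n) (trans (cong (2 ℕ.*_) (2n n)) (2n (double n)))

  4n+1 : ∀ n → 4 ℕ.* n ℕ.+ 1 ≡ suc (double (double n))
  4n+1 n = trans (ℕP.+-comm (4 ℕ.* n) 1) (cong suc (4n n))

  4n+2 : ∀ n → 4 ℕ.* n ℕ.+ 2 ≡ double (suc (double n))
  4n+2 n = trans (ℕP.+-comm (4 ℕ.* n) 2) (cong (2 ℕ.+_) (4n n))

open Lacunarity
open Density using (sparse-xor; sparse-halves)
open Series using (odd; double)
open Theta using (𝖯; 𝖳; 𝖮)
open import Data.Nat using (suc; _+_; _*_)
open import Data.Product using (_×_; _,_)
open import Relation.Binary.PropositionalEquality using (refl; cong)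

theorem2 : LacunaryMod2 (λ n → Cbar 4 1 n)
    × LacunaryMod2 (λ n → Cbar 12 3 n)
    × LacunaryMod2 (λ n → Cbar 20 5 (2 * n))
    × LacunaryMod2 (λ n → Cbar 28 7 (2 * n + 1))
    × LacunaryMod2 (λ n → Cbar 28 7 (4 * n))
    × LacunaryMod2 (λ n → Cbar 36 9 (2 * n + 1))
    × LacunaryMod2 (λ n → Cbar 44 11 (2 * n))
    × LacunaryMod2 (λ n → Cbar 44 11 (4 * n + 1))
    × LacunaryMod2 (λ n → Cbar 52 13 (2 * n))
    × LacunaryMod2 (λ n → Cbar 60 15 (2 * n + 1))
    × LacunaryMod2 (λ n → Cbar 60 15 (4 * n + 2))
    × LacunaryMod2 (λ n → Cbar 68 17 (2 * n + 1))
    × LacunaryMod2 (λ n → Cbar 84 21 (2 * n))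
    × LacunaryMod2 (λ n → Cbar 92 23 (2 * n + 1))
theorem2 =
    lacunary 1 (λ n → n) (λ n → n) (λ _ → refl) (sparse-≈ G₁ (Θ-sparse 𝖯 2))
  , lacunary 3 (λ n → n) (λ n → n) (λ _ → refl) (sparse-≈ G₃ (Θ-sparse 𝖮 1))
  , lacunary 5 (λ n → 2 * n) double 2n (sparse-≈ G₅ (ΘΘ-sparse 𝖯 2 𝖯 5))
  , lacunary 7 (λ n → 2 * n + 1) (λ n → suc (double n)) 2n+1 (sparse-≈ G₇-odd (ΘΘ-sparse 𝖯 1 𝖳 7))
  , lacunary 7 (λ n → 4 * n) (λ n → double (double n)) 4n (sparse-≈ G₇-even (ΘΘ-sparse 𝖯 1 𝖯 4))
  , lacunary 9 (λ n → 2 * n + 1) (λ n → suc (double n)) 2n+1 (sparse-≈ G₉ (ΘΘ-sparse 𝖯 1 𝖮 3))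
  , lacunary 11 (λ n → 2 * n) double 2n (sparse-≈ G₁₁-even (sparse-xor (Θ-sparse 𝖮 2) (sparse-mono (Θ-sparse 𝖮 11) 3)))
  , lacunary 11 (λ n → 4 * n + 1) (λ n → suc (double (double n))) 4n+1 (sparse-≈ G₁₁-odd (ΘΘ-sparse 𝖳 1 𝖯 11))
  , lacunary 13 (λ n → 2 * n) double 2n (sparse-≈ G₁₃ (sparse-xor (ΘΘ-sparse 𝖳 2 𝖯 13) (sparse-mono (ΘΘ-sparse 𝖳 26 𝖯 13) 3)))
  -- The odd indices are treated as 4n + 1 and 4n + 3 separately; for the latter a factor q is
  -- removed again at the end.
  , lacunary 15 (λ n → 2 * n + 1) (λ n → suc (double n)) 2n+1 (sparse-halves
      (sparse-≈ (λ n → cong (odd (G 15)) (2n n)) (sparse-≈ G₁₅-odd-even (ΘΘ-sparse 𝖳 3 𝖮 1)))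
      (sparse-≈ (λ n → cong (λ m → odd (G 15) (suc m)) (2n n)) (sparse-unmono (sparse-≈ G₁₅-odd-odd (sparse-xor (Θ-sparse 𝖯 5) (ΘΘ-sparse 𝖯 1 𝖯 4))))))
  , lacunary 15 (λ n → 4 * n + 2) (λ n → double (suc (double n))) 4n+2 (sparse-≈ G₁₅-even-odd (sparse-mono (ΘΘ-sparse 𝖯 2 𝖳 15) 1))
  , lacunary 17 (λ n → 2 * n + 1) (λ n → suc (double n)) 2n+1 (sparse-≈ G₁₇ (sparse-xor (ΘΘ-sparse 𝖳 1 𝖯 34) (sparse-mono (ΘΘ-sparse 𝖯 17 𝖯 68) 2)))
  , lacunary 21 (λ n → 2 * n) double 2n (sparse-unmono (sparse-≈ G₂₁ (sparse-xor (sparse-xor (Θ-sparse 𝖯 7) (ΘΘ-sparse 𝖯 1 𝖳 2)) (sparse-mono (ΘΘ-sparse 𝖯 1 𝖳 42) 5))))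
  , lacunary 23 (λ n → 2 * n + 1) (λ n → suc (double n)) 2n+1 (sparse-≈ G₂₃ (sparse-xor (Θ-sparse 𝖯 46) (sparse-mono (ΘΘ-sparse 𝖯 1 𝖳 23) 1)))
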